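{- Let $a_3(n)$ be defined by \[\sum_{n\geq 0}a_3(n)q^n=\frac{f_3f_6}{f_1f_2},\qquad f_k=\prod_{m=1}^{\infty}(1-q^{km}).\] Then for every integer $\alpha\geq 0$ and every integer $n\geq 0$, \begin{align*} a_3\left(3^{2\alpha}n+\frac{3^{2\alpha}-1}{4}\right)&\equiv 0 \pmod{3^{\alpha}},\\ a_3\left(3^{2\alpha+1}n+\frac{3^{2\alpha+2}-1}{4}\right)&\equiv 0 \pmod{3^{\alpha+1}},\\ a_3\left(3^{2\alpha+2}n+\frac{7\cdot 3^{2\alpha+1}-1}{4}\right)&\equiv 0 \pmod{3^{\alpha+2}},\\ a_3\left(3^{2\alpha+2}n+\frac{11\cdot 3^{2\alpha+1}-1}{4}\right)&\equiv 0 \pmod{3^{\alpha+2}}. \end{align*}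
   Context: $a_3(n)$ is the number of 3-regular cubic partitions of $n$; its generating function is as given, where $f_k=(q^k;q^k)_\infty$. -}

module Defs where

open import Data.Bool.Base using (if_then_else_)
open import Data.Fin.Base using (Fin; zero; suc; toℕ)
open import Data.Fin.Properties using (toℕ<n)
open import Data.Integer.Base using (ℤ; 0ℤ; 1ℤ; -_; _+_; _-_; _*_)
open import Data.Integer.Properties
  using ( +-0-commutativeMonoid; +-identityʳ; *-identityˡ; *-zeroˡ
        ; +-assoc; +-inverseˡ)
open import Data.Nat.Base as ℕ
  using (ℕ; zero; suc; _∸_; _≡ᵇ_; _≤_; _<_; s≤s; NonZero)
import Data.Nat.Properties as ℕ
open import Data.Vec.Functional using (Vector; []; _∷_; head)
open import Relation.Binary.PropositionalEquality

open import Algebra.Properties.CommutativeMonoid.Sum +-0-commutativeMonoid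
  using (sum-syntax; sum⁺-syntax; sum-cong-≗; sum-replicate-zero)

-- ℤ[[q]]: a series is its sequence of coefficients, and equality of series
-- is pointwise (_≗_).
PowerSeries : Set
PowerSeries = ℕ → ℤ

q^_ : ℕ → PowerSeries
(q^ j) n = if j ≡ᵇ n then 1ℤ else 0ℤ

infixl 6 _⊖_
infixl 7 _⊛_ _⊘_

_⊖_ : PowerSeries → PowerSeries → PowerSeries
(F ⊖ G) n = F n - G n

_⊛_ : PowerSeries → PowerSeries → PowerSeries
(F ⊛ G) n = ∑[ i ≤ n ] (F (toℕ i) * G (n ∸ toℕ i))

-- The first n coefficients of F / G, the most recent one first, obtained by
-- solving (G ⊛ H) n ≡ F n for H n when G 0 ≡ 1.
quotientCoeffs : PowerSeries → PowerSeries → ∀ n → Vector ℤ n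
quotientCoeffs F G zero    = []
quotientCoeffs F G (suc n) =
  (F n - ∑[ i < n ] (G (suc (toℕ i)) * quotientCoeffs F G n i))
    ∷ quotientCoeffs F G n

-- Only meaningful when the constant term of G is 1; see ⊘-correct.
_⊘_ : PowerSeries → PowerSeries → PowerSeries
(F ⊘ G) n = head (quotientCoeffs F G (suc n))

quotientCoeffs-⊘ : ∀ F G n (i : Fin n) →
                   quotientCoeffs F G n i ≡ (F ⊘ G) (n ∸ suc (toℕ i))
quotientCoeffs-⊘ F G (suc n) zero    = refl
quotientCoeffs-⊘ F G (suc n) (suc i) = quotientCoeffs-⊘ F G n i

⊘-correct : ∀ F G → G 0 ≡ 1ℤ → G ⊛ (F ⊘ G) ≗ F
⊘-correct F G G₀≡1 n = begin
  G 0 * (F n - S) + S′  ≡⟨ cong₂ (λ x y → x * (F n - S) + y) G₀≡1 (sym S≡S′) ⟩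
  1ℤ * (F n - S) + S    ≡⟨ cong (_+ S) (*-identityˡ (F n - S)) ⟩
  F n - S + S           ≡⟨ +-assoc (F n) _ S ⟩
  F n + (- S + S)       ≡⟨ cong (λ x → F n + x) (+-inverseˡ S) ⟩
  F n + 0ℤ              ≡⟨ +-identityʳ (F n) ⟩
  F n                   ∎
  where
  open ≡-Reasoning
  S S′ : ℤ
  S  = ∑[ i < n ] (G (suc (toℕ i)) * quotientCoeffs F G n i)
  S′ = ∑[ i < n ] (G (suc (toℕ i)) * (F ⊘ G) (n ∸ suc (toℕ i)))
  S≡S′ : S ≡ S′
  S≡S′ = sum-cong-≗ λ i →
    cong (λ x → G (suc (toℕ i)) * x) (quotientCoeffs-⊘ F G n i)

-- ∏_{m=1}^{N} (1 - q^{km})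
partialProduct : ℕ → ℕ → PowerSeries
partialProduct k zero    = q^ 0
partialProduct k (suc N) = (q^ 0 ⊖ q^ (k ℕ.* suc N)) ⊛ partialProduct k N

-- ∏_{m≥1} (1 - q^{km}) for k ≥ 1: the factors with m > n do not affect the
-- coefficient of q^n, so it can be read off the n-th partial product; see
-- f-limit.
f : ℕ → PowerSeries
f k n = partialProduct k n n

⊛-unitary : ∀ F G n → F 0 ≡ 1ℤ → (∀ i → i < n → F (suc i) ≡ 0ℤ) →
            (F ⊛ G) n ≡ G n
⊛-unitary F G n F₀≡1 F₊≡0 = begin
  F 0 * G n + ∑[ i < n ] (F (suc (toℕ i)) * G (n ∸ suc (toℕ i)))
    ≡⟨ cong₂ _+_ (trans (cong (_* G n) F₀≡1) (*-identityˡ (G n))) tail≡0 ⟩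
  G n + 0ℤ
    ≡⟨ +-identityʳ (G n) ⟩
  G n ∎
  where
  open ≡-Reasoning
  tail≡0 : ∑[ i < n ] (F (suc (toℕ i)) * G (n ∸ suc (toℕ i))) ≡ 0ℤ
  tail≡0 = trans
    (sum-cong-≗ λ i → trans
      (cong (_* G (n ∸ suc (toℕ i))) (F₊≡0 (toℕ i) (toℕ<n i)))
      (*-zeroˡ (G (n ∸ suc (toℕ i)))))
    (sum-replicate-zero n)

q^-below : ∀ {j n} → n < j → (q^ j) n ≡ 0ℤ
q^-below {suc j} {zero}  _         = refl
q^-below {suc j} {suc n} (s≤s n<j) = q^-below n<j

factor-irrelevant : ∀ j G n → n < j → ((q^ 0 ⊖ q^ j) ⊛ G) n ≡ G n
factor-irrelevant j G n n<j = ⊛-unitary (q^ 0 ⊖ q^ j) G n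
  (cong (λ x → 1ℤ - x) (q^-below (ℕ.≤-<-trans ℕ.z≤n n<j)))
  (λ i i<n → cong (λ x → 0ℤ - x) (q^-below (ℕ.≤-<-trans i<n n<j)))

f-limit : ∀ k .{{_ : NonZero k}} N n → n ≤ N → partialProduct k N n ≡ f k n
f-limit k N n n≤N = go (ℕ.≤⇒≤′ n≤N)
  where
  go : ∀ {N} → n ℕ.≤′ N → partialProduct k N n ≡ f k n
  go ℕ.≤′-refl            = refl
  go (ℕ.≤′-step {N} n≤′N) = trans
    (factor-irrelevant (k ℕ.* suc N) (partialProduct k N) n
      (ℕ.<-≤-trans (s≤s (ℕ.≤′⇒≤ n≤′N)) (ℕ.m≤n*m (suc N) k)))
    (go n≤′N)

a₃ : PowerSeries
a₃ = (f 3 ⊛ f 6) ⊘ (f 1 ⊛ f 2)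

a₃-generatingFunction : (f 1 ⊛ f 2) ⊛ a₃ ≗ f 3 ⊛ f 6
a₃-generatingFunction = ⊘-correct (f 3 ⊛ f 6) (f 1 ⊛ f 2) refl

{-# OPTIONS --safe #-}

-- Let s(q) = q ∑ a₃(n) q^(4n), let U replace ∑ b(n) qⁿ by ∑ b(3n) qⁿ, and put
-- t = 9 s⁴. The congruences are divisibility properties of the coefficients of
-- U^k s. Jacobi's triple product yields a 3-dissection of f₁f₂; together with
-- its norm from ℤ[[q]] to ℤ[[q³]] this gives the modular equation
--   s³ = S + 3 S² s + 9 S³ s²,   S(q) = s(q³),
-- and U s = 3 s³, U s² = 2 s² + 27 s⁶. Since U is linear over series in q³, the
-- modular equation turns these values into a recursion for U on all powers
-- of s, and it follows that U maps s ℤ[t] into 3 s³ (ℤ + 3 ℤ[t]) and s³ ℤ[t] into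
-- s ℤ[t]. So two applications of U gain a factor 3, and the last two
-- congruences hold because s³ ≡ s(q³) modulo 3.
module Submission where

open import Defs
open import Data.Nat.Base using (ℕ; _+_; _*_; _∸_; _^_; _/_)
open import Data.Integer.Base using (+_)
open import Data.Integer.Divisibility using (_∣_)
open import Data.Product.Base using (_×_)

open import Algebra.Bundles using (CommutativeRing)
import Algebra.Properties.Semiring.Exp as Exp
import Algebra.Solver.Ring as RingSolver
import Algebra.Solver.Ring.AlmostCommutativeRing as ACR
open import Data.Integer.Base as ℤ using (ℤ; 0ℤ; 1ℤ)
import Data.Integer.Properties as ℤ
import Data.Integer.Tactic.RingSolver as ℤ-Tactic
open import Data.Maybe.Base using (just; nothing)
open import Data.Nat.Base using (zero; suc; _≤_; _<_; _≤′_; ≤′-refl; ≤′-step; z≤n; s≤s)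
import Data.Nat.Divisibility as ℕ
import Data.Nat.DivMod as ℕ
import Data.Nat.Properties as ℕ
import Data.Nat.Tactic.RingSolver as ℕ-Tactic
open import Data.Product.Base using (_,_; proj₂; ∃-syntax)
open import Function.Base using (_∘_)
open import Level using (0ℓ)
import Relation.Binary.Reasoning.Setoid as SetoidReasoning
open import Relation.Binary.PropositionalEquality
  using (_≡_; refl; sym; trans; cong; cong₂; subst; module ≡-Reasoning)
open import Relation.Nullary.Decidable.Core using (yes; no)

-- The ring of power series

-- Put `F` = (f₁f₂)(q⁴) and `E` = (f₃f₆)(q⁴) = F(q³); then s = qE/F, and dissecting s means
-- rationalising the denominator `F` over series in q³. The cofactor `M` is the product of the
-- conjugates F(ωq) and F(ω²q), ω a primitive cube root of unity. Two facts make it explicit: the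
-- norm F·M is again a quotient of products, F(q³)⁴/E(q³), and the outer components of `F` satisfy α
-- β = E², so that `M` is a quadratic polynomial in `F` and a single series `K` in q³. Dividing by
-- F² gives the modular equation. The exponents in s are 1 modulo 4, and division by 3 exchanges the
-- classes 1 and 3 modulo 4 and fixes 0 and 2; hence `U` exchanges the types s and s³. The obstacle
-- is that no type can be treated alone: multiplication by `t` followed by the modular equation
-- expresses the image of each type through the other three, so all four are carried through one
-- induction. The surplus factor 3 beyond the leading term c s³ is recorded for the last two
-- congruences.

infix 4 _≈_ _≈[_]_

-- A record instead of a synonym for `_≗_`, so that `F` and `G` can be recovered by unification from
-- the type of a proof.
record _≈_ (F G : PowerSeries) : Set where
  constructor mk≈
  field coeff : ∀ n → F n ≡ G n

record _≈[_]_ (F : PowerSeries) (N : ℕ) (G : PowerSeries) : Set where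
  constructor mk≈[]
  field coeff[] : ∀ n → n < N → F n ≡ G n

open _≈_
open _≈[_]_

tail : PowerSeries → PowerSeries
tail F n = F (suc n)

⟨_⟩ : ℤ → PowerSeries
⟨ c ⟩ zero    = c
⟨ c ⟩ (suc n) = 0ℤ

⟨0⟩-coeff : ∀ n → ⟨ 0ℤ ⟩ n ≡ 0ℤ
⟨0⟩-coeff zero    = refl
⟨0⟩-coeff (suc n) = refl

-- The operations are opaque so that comparing two series never unfolds them
-- into sums of coefficients.
infixl 6 _⊕_
infixl 7 _·_
infix  8 ⊝_

opaque
  _⊕_ _·_ : PowerSeries → PowerSeries → PowerSeries
  (F ⊕ G) n = F n ℤ.+ G n
  _·_ = _⊛_

  ⊝_ : PowerSeries → PowerSeries
  (⊝ F) n = ℤ.- F n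

  ⊕-coeff : ∀ F G n → (F ⊕ G) n ≡ F n ℤ.+ G n
  ⊕-coeff F G n = refl

  ⊝-coeff : ∀ F n → (⊝ F) n ≡ ℤ.- F n
  ⊝-coeff F n = refl

  ·-⊛ : ∀ F G n → (F · G) n ≡ (F ⊛ G) n
  ·-⊛ F G n = refl

  ·-zero : ∀ F G → (F · G) 0 ≡ F 0 ℤ.* G 0
  ·-zero F G = ℤ.+-identityʳ _

  ·-suc : ∀ F G n → (F · G) (suc n) ≡ F 0 ℤ.* G (suc n) ℤ.+ (tail F · G) n
  ·-suc F G n = refl

·-cong≤ : ∀ {F F′ G G′} n → (∀ i → i ≤ n → F i ≡ F′ i) → (∀ i → i ≤ n → G i ≡ G′ i) →
          (F · G) n ≡ (F′ · G′) n
·-cong≤ {F} {F′} {G} {G′} zero p r = begin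
  (F · G) 0       ≡⟨ ·-zero F G ⟩
  F 0 ℤ.* G 0     ≡⟨ cong₂ ℤ._*_ (p 0 z≤n) (r 0 z≤n) ⟩
  F′ 0 ℤ.* G′ 0   ≡⟨ ·-zero F′ G′ ⟨
  (F′ · G′) 0     ∎
  where open ≡-Reasoning
·-cong≤ {F} {F′} {G} {G′} (suc n) p r = begin
  (F · G) (suc n)                            ≡⟨ ·-suc F G n ⟩
  F 0 ℤ.* G (suc n) ℤ.+ (tail F · G) n       ≡⟨ cong₂ ℤ._+_ (cong₂ ℤ._*_ (p 0 z≤n) (r (suc n) ℕ.≤-refl))
                                                  (·-cong≤ n (λ i i≤n → p (suc i) (s≤s i≤n))
                                                             (λ i i≤n → r i (ℕ.m≤n⇒m≤1+n i≤n))) ⟩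
  F′ 0 ℤ.* G′ (suc n) ℤ.+ (tail F′ · G′) n   ≡⟨ ·-suc F′ G′ n ⟨
  (F′ · G′) (suc n)                          ∎
  where open ≡-Reasoning

·-zeroˡ-coeff : ∀ {F} G n → (∀ i → F i ≡ 0ℤ) → (F · G) n ≡ 0ℤ
·-zeroˡ-coeff {F} G zero F≡0 = trans (·-zero F G) (trans (cong (ℤ._* G 0) (F≡0 0)) (ℤ.*-zeroˡ (G 0)))
·-zeroˡ-coeff {F} G (suc n) F≡0 = trans (·-suc F G n)
  (cong₂ ℤ._+_ (trans (cong (ℤ._* G (suc n)) (F≡0 0)) (ℤ.*-zeroˡ (G (suc n)))) (·-zeroˡ-coeff G n (F≡0 ∘ suc)))

⟨⟩·-coeff : ∀ c F n → (⟨ c ⟩ · F) n ≡ c ℤ.* F n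
⟨⟩·-coeff c F zero    = ·-zero ⟨ c ⟩ F
⟨⟩·-coeff c F (suc n) = trans (·-suc ⟨ c ⟩ F n)
  (trans (cong (λ z → c ℤ.* F (suc n) ℤ.+ z) (·-zeroˡ-coeff F n (λ _ → refl))) (ℤ.+-identityʳ _))

tail-· : ∀ F G → tail (F · G) ≈ ⟨ F 0 ⟩ · tail G ⊕ tail F · G
tail-· F G = mk≈ λ n → trans (·-suc F G n)
  (trans (cong (ℤ._+ (tail F · G) n) (sym (⟨⟩·-coeff (F 0) (tail G) n))) (sym (⊕-coeff (⟨ F 0 ⟩ · tail G) (tail F · G) n)))

private
  ·-distribʳ-coeff : ∀ F G H n → ((F ⊕ G) · H) n ≡ (F · H) n ℤ.+ (G · H) n
  ·-distribʳ-coeff F G H zero = begin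
    ((F ⊕ G) · H) 0                  ≡⟨ ·-zero (F ⊕ G) H ⟩
    (F ⊕ G) 0 ℤ.* H 0                ≡⟨ cong (ℤ._* H 0) (⊕-coeff F G 0) ⟩
    (F 0 ℤ.+ G 0) ℤ.* H 0            ≡⟨ ℤ.*-distribʳ-+ (H 0) (F 0) (G 0) ⟩
    F 0 ℤ.* H 0 ℤ.+ G 0 ℤ.* H 0      ≡⟨ cong₂ ℤ._+_ (·-zero F H) (·-zero G H) ⟨
    (F · H) 0 ℤ.+ (G · H) 0          ∎
    where open ≡-Reasoning
  ·-distribʳ-coeff F G H (suc n) = begin
    ((F ⊕ G) · H) (suc n)
      ≡⟨ ·-suc (F ⊕ G) H n ⟩
    (F ⊕ G) 0 ℤ.* H (suc n) ℤ.+ (tail (F ⊕ G) · H) n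
      ≡⟨ cong₂ ℤ._+_ (cong (ℤ._* H (suc n)) (⊕-coeff F G 0))
           (trans (·-cong≤ n (λ i _ → trans (⊕-coeff F G (suc i)) (sym (⊕-coeff (tail F) (tail G) i))) (λ _ _ → refl))
                  (·-distribʳ-coeff (tail F) (tail G) H n)) ⟩
    (F 0 ℤ.+ G 0) ℤ.* H (suc n) ℤ.+ ((tail F · H) n ℤ.+ (tail G · H) n)
      ≡⟨ rearrange (F 0) (G 0) (H (suc n)) _ _ ⟩
    (F 0 ℤ.* H (suc n) ℤ.+ (tail F · H) n) ℤ.+ (G 0 ℤ.* H (suc n) ℤ.+ (tail G · H) n)
      ≡⟨ cong₂ ℤ._+_ (·-suc F H n) (·-suc G H n) ⟨
    (F · H) (suc n) ℤ.+ (G · H) (suc n) ∎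
    where
    open ≡-Reasoning
    rearrange : ∀ a b c d e → (a ℤ.+ b) ℤ.* c ℤ.+ (d ℤ.+ e) ≡ (a ℤ.* c ℤ.+ d) ℤ.+ (b ℤ.* c ℤ.+ e)
    rearrange = ℤ-Tactic.solve-∀

  -- The case of a constant left factor has to come before general associativity, because `tail-·`
  -- puts the term `⟨ F 0 ⟩ · tail G` into the tail of `F · G`.
  ⟨⟩·-assoc-coeff : ∀ c G H n → ((⟨ c ⟩ · G) · H) n ≡ c ℤ.* (G · H) n
  ⟨⟩·-assoc-coeff c G H zero = begin
    ((⟨ c ⟩ · G) · H) 0     ≡⟨ ·-zero (⟨ c ⟩ · G) H ⟩
    (⟨ c ⟩ · G) 0 ℤ.* H 0   ≡⟨ cong (ℤ._* H 0) (·-zero ⟨ c ⟩ G) ⟩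
    c ℤ.* G 0 ℤ.* H 0       ≡⟨ ℤ.*-assoc c (G 0) (H 0) ⟩
    c ℤ.* (G 0 ℤ.* H 0)     ≡⟨ cong (c ℤ.*_) (·-zero G H) ⟨
    c ℤ.* (G · H) 0         ∎
    where open ≡-Reasoning
  ⟨⟩·-assoc-coeff c G H (suc n) = begin
    ((⟨ c ⟩ · G) · H) (suc n)
      ≡⟨ ·-suc (⟨ c ⟩ · G) H n ⟩
    (⟨ c ⟩ · G) 0 ℤ.* H (suc n) ℤ.+ (tail (⟨ c ⟩ · G) · H) n
      ≡⟨ cong₂ ℤ._+_ (cong (ℤ._* H (suc n)) (·-zero ⟨ c ⟩ G))
           (·-cong≤ n (λ i _ → trans (⟨⟩·-coeff c G (suc i)) (sym (⟨⟩·-coeff c (tail G) i))) (λ _ _ → refl)) ⟩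
    c ℤ.* G 0 ℤ.* H (suc n) ℤ.+ ((⟨ c ⟩ · tail G) · H) n
      ≡⟨ cong₂ ℤ._+_ (ℤ.*-assoc c (G 0) (H (suc n))) (⟨⟩·-assoc-coeff c (tail G) H n) ⟩
    c ℤ.* (G 0 ℤ.* H (suc n)) ℤ.+ c ℤ.* (tail G · H) n
      ≡⟨ ℤ.*-distribˡ-+ c _ _ ⟨
    c ℤ.* (G 0 ℤ.* H (suc n) ℤ.+ (tail G · H) n)
      ≡⟨ cong (c ℤ.*_) (·-suc G H n) ⟨
    c ℤ.* (G · H) (suc n) ∎
    where open ≡-Reasoning

  ·-assoc-coeff : ∀ F G H n → ((F · G) · H) n ≡ (F · (G · H)) n
  ·-assoc-coeff F G H zero = begin
    ((F · G) · H) 0         ≡⟨ trans (·-zero (F · G) H) (cong (ℤ._* H 0) (·-zero F G)) ⟩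
    F 0 ℤ.* G 0 ℤ.* H 0     ≡⟨ ℤ.*-assoc (F 0) (G 0) (H 0) ⟩
    F 0 ℤ.* (G 0 ℤ.* H 0)   ≡⟨ trans (·-zero F (G · H)) (cong (F 0 ℤ.*_) (·-zero G H)) ⟨
    (F · (G · H)) 0         ∎
    where open ≡-Reasoning
  ·-assoc-coeff F G H (suc n) = begin
    ((F · G) · H) (suc n)
      ≡⟨ ·-suc (F · G) H n ⟩
    (F · G) 0 ℤ.* H (suc n) ℤ.+ (tail (F · G) · H) n
      ≡⟨ cong₂ ℤ._+_ (cong (ℤ._* H (suc n)) (·-zero F G))
           (trans (·-cong≤ n (λ i _ → coeff (tail-· F G) i) (λ _ _ → refl))
                  (·-distribʳ-coeff (⟨ F 0 ⟩ · tail G) (tail F · G) H n)) ⟩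
    F 0 ℤ.* G 0 ℤ.* H (suc n) ℤ.+ (((⟨ F 0 ⟩ · tail G) · H) n ℤ.+ ((tail F · G) · H) n)
      ≡⟨ cong₂ (λ x y → F 0 ℤ.* G 0 ℤ.* H (suc n) ℤ.+ (x ℤ.+ y))
           (⟨⟩·-assoc-coeff (F 0) (tail G) H n) (·-assoc-coeff (tail F) G H n) ⟩
    F 0 ℤ.* G 0 ℤ.* H (suc n) ℤ.+ (F 0 ℤ.* (tail G · H) n ℤ.+ (tail F · (G · H)) n)
      ≡⟨ rearrange (F 0) (G 0) (H (suc n)) _ _ ⟩
    F 0 ℤ.* (G 0 ℤ.* H (suc n) ℤ.+ (tail G · H) n) ℤ.+ (tail F · (G · H)) n
      ≡⟨ cong (λ z → F 0 ℤ.* z ℤ.+ (tail F · (G · H)) n) (·-suc G H n) ⟨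
    F 0 ℤ.* (G · H) (suc n) ℤ.+ (tail F · (G · H)) n
      ≡⟨ ·-suc F (G · H) n ⟨
    (F · (G · H)) (suc n) ∎
    where
    open ≡-Reasoning
    rearrange : ∀ a b c d e → a ℤ.* b ℤ.* c ℤ.+ (a ℤ.* d ℤ.+ e) ≡ a ℤ.* (b ℤ.* c ℤ.+ d) ℤ.+ e
    rearrange = ℤ-Tactic.solve-∀

  -- The mirror image of `·-suc`, peeling the right factor; commutativity is the comparison of the
  -- two recursions.
  ·-sucʳ : ∀ F G n → (F · G) (suc n) ≡ F (suc n) ℤ.* G 0 ℤ.+ (F · tail G) n
  ·-sucʳ F G zero = begin
    (F · G) 1                          ≡⟨ trans (·-suc F G 0) (cong (λ z → F 0 ℤ.* G 1 ℤ.+ z) (·-zero (tail F) G)) ⟩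
    F 0 ℤ.* G 1 ℤ.+ F 1 ℤ.* G 0        ≡⟨ ℤ.+-comm (F 0 ℤ.* G 1) (F 1 ℤ.* G 0) ⟩
    F 1 ℤ.* G 0 ℤ.+ F 0 ℤ.* G 1        ≡⟨ cong (λ z → F 1 ℤ.* G 0 ℤ.+ z) (·-zero F (tail G)) ⟨
    F 1 ℤ.* G 0 ℤ.+ (F · tail G) 0     ∎
    where open ≡-Reasoning
  ·-sucʳ F G (suc n) = begin
    (F · G) (2 + n)
      ≡⟨ ·-suc F G (suc n) ⟩
    F 0 ℤ.* G (2 + n) ℤ.+ (tail F · G) (suc n)
      ≡⟨ cong (λ z → F 0 ℤ.* G (2 + n) ℤ.+ z) (·-sucʳ (tail F) G n) ⟩
    F 0 ℤ.* G (2 + n) ℤ.+ (F (2 + n) ℤ.* G 0 ℤ.+ (tail F · tail G) n)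
      ≡⟨ rearrange (F 0 ℤ.* G (2 + n)) (F (2 + n) ℤ.* G 0) _ ⟩
    F (2 + n) ℤ.* G 0 ℤ.+ (F 0 ℤ.* G (2 + n) ℤ.+ (tail F · tail G) n)
      ≡⟨ cong (λ z → F (2 + n) ℤ.* G 0 ℤ.+ z) (·-suc F (tail G) n) ⟨
    F (2 + n) ℤ.* G 0 ℤ.+ (F · tail G) (suc n) ∎
    where
    open ≡-Reasoning
    rearrange : ∀ a b c → a ℤ.+ (b ℤ.+ c) ≡ b ℤ.+ (a ℤ.+ c)
    rearrange = ℤ-Tactic.solve-∀

  ·-comm-coeff : ∀ F G n → (F · G) n ≡ (G · F) n
  ·-comm-coeff F G zero    = trans (·-zero F G) (trans (ℤ.*-comm (F 0) (G 0)) (sym (·-zero G F)))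
  ·-comm-coeff F G (suc n) = begin
    (F · G) (suc n)                        ≡⟨ ·-suc F G n ⟩
    F 0 ℤ.* G (suc n) ℤ.+ (tail F · G) n   ≡⟨ cong₂ ℤ._+_ (ℤ.*-comm (F 0) (G (suc n))) (·-comm-coeff (tail F) G n) ⟩
    G (suc n) ℤ.* F 0 ℤ.+ (G · tail F) n   ≡⟨ ·-sucʳ G F n ⟨
    (G · F) (suc n)                        ∎
    where open ≡-Reasoning

≈-refl : ∀ {F} → F ≈ F
≈-refl = mk≈ λ _ → refl

≈-sym : ∀ {F G} → F ≈ G → G ≈ F
≈-sym p = mk≈ λ n → sym (coeff p n)

≈-trans : ∀ {F G H} → F ≈ G → G ≈ H → F ≈ H
≈-trans p r = mk≈ λ n → trans (coeff p n) (coeff r n)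

powerSeriesRing : CommutativeRing 0ℓ 0ℓ
powerSeriesRing = record
  { Carrier = PowerSeries
  ; _≈_ = _≈_
  ; _+_ = _⊕_
  ; _*_ = _·_
  ; -_  = ⊝_
  ; 0#  = ⟨ 0ℤ ⟩
  ; 1#  = ⟨ 1ℤ ⟩
  ; isCommutativeRing = record
    { isRing = record
      { +-isAbelianGroup = record
        { isGroup = record
          { isMonoid = record
            { isSemigroup = record
              { isMagma = record
                { isEquivalence = record { refl = ≈-refl ; sym = ≈-sym ; trans = ≈-trans }
                ; ∙-cong = λ p r → mk≈ λ n → trans (⊕-coeff _ _ n)
                    (trans (cong₂ ℤ._+_ (coeff p n) (coeff r n)) (sym (⊕-coeff _ _ n)))
                }
              ; assoc = λ F G H → mk≈ (+-assoc F G H)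
              }
            ; identity = (λ F → mk≈ λ n → trans (⊕-coeff _ _ n) (trans (cong (ℤ._+ F n) (⟨0⟩-coeff n)) (ℤ.+-identityˡ (F n))))
                       , (λ F → mk≈ λ n → trans (⊕-coeff _ _ n) (trans (cong (ℤ._+_ (F n)) (⟨0⟩-coeff n)) (ℤ.+-identityʳ (F n))))
            }
          ; inverse = (λ F → mk≈ λ n → trans (⊕-coeff _ _ n) (trans (cong (ℤ._+ F n) (⊝-coeff F n))
                        (trans (ℤ.+-inverseˡ (F n)) (sym (⟨0⟩-coeff n)))))
                    , (λ F → mk≈ λ n → trans (⊕-coeff _ _ n) (trans (cong (ℤ._+_ (F n)) (⊝-coeff F n))
                        (trans (ℤ.+-inverseʳ (F n)) (sym (⟨0⟩-coeff n)))))
          ; ⁻¹-cong = λ p → mk≈ λ n → trans (⊝-coeff _ n) (trans (cong ℤ.-_ (coeff p n)) (sym (⊝-coeff _ n)))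
          }
        ; comm = λ F G → mk≈ λ n → trans (⊕-coeff F G n) (trans (ℤ.+-comm (F n) (G n)) (sym (⊕-coeff G F n)))
        }
      ; *-cong = λ p r → mk≈ λ n → ·-cong≤ n (λ i _ → coeff p i) (λ i _ → coeff r i)
      ; *-assoc = λ F G H → mk≈ (·-assoc-coeff F G H)
      ; *-identity = (λ F → mk≈ (identity F)) , (λ F → mk≈ λ n → trans (·-comm-coeff F ⟨ 1ℤ ⟩ n) (identity F n))
      ; distrib = (λ F G H → mk≈ λ n → trans (·-comm-coeff F (G ⊕ H) n) (trans (distribʳ F G H n)
                    (trans (cong₂ ℤ._+_ (·-comm-coeff G F n) (·-comm-coeff H F n)) (sym (⊕-coeff _ _ n)))))
                , (λ F G H → mk≈ λ n → trans (distribʳ F G H n) (sym (⊕-coeff _ _ n)))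
      }
    ; *-comm = λ F G → mk≈ (·-comm-coeff F G)
    }
  }
  where
  +-assoc : ∀ F G H n → ((F ⊕ G) ⊕ H) n ≡ (F ⊕ (G ⊕ H)) n
  +-assoc F G H n = begin
    ((F ⊕ G) ⊕ H) n            ≡⟨ trans (⊕-coeff _ _ n) (cong (ℤ._+ H n) (⊕-coeff F G n)) ⟩
    (F n ℤ.+ G n) ℤ.+ H n      ≡⟨ ℤ.+-assoc (F n) (G n) (H n) ⟩
    F n ℤ.+ (G n ℤ.+ H n)      ≡⟨ trans (⊕-coeff _ _ n) (cong (ℤ._+_ (F n)) (⊕-coeff G H n)) ⟨
    (F ⊕ (G ⊕ H)) n            ∎
    where open ≡-Reasoning
  identity : ∀ F n → (⟨ 1ℤ ⟩ · F) n ≡ F n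
  identity F n = trans (⟨⟩·-coeff 1ℤ F n) (ℤ.*-identityˡ (F n))
  distribʳ : ∀ F G H n → ((G ⊕ H) · F) n ≡ (G · F) n ℤ.+ (H · F) n
  distribʳ F G H n = ·-distribʳ-coeff G H F n

module R = CommutativeRing powerSeriesRing
open Exp R.semiring using () renaming (_^_ to _↑_; ^-homo-* to ↑-homo-·)
module ≈-Reasoning = SetoidReasoning R.setoid

⟨⟩-+ : ∀ c d → ⟨ c ℤ.+ d ⟩ ≈ ⟨ c ⟩ ⊕ ⟨ d ⟩
⟨⟩-+ c d = mk≈ λ { zero → sym (⊕-coeff ⟨ c ⟩ ⟨ d ⟩ 0) ; (suc n) → sym (⊕-coeff ⟨ c ⟩ ⟨ d ⟩ (suc n)) }

⟨⟩-* : ∀ c d → ⟨ c ℤ.* d ⟩ ≈ ⟨ c ⟩ · ⟨ d ⟩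
⟨⟩-* c d = mk≈ λ { zero → sym (⟨⟩·-coeff c ⟨ d ⟩ 0) ; (suc n) → sym (trans (⟨⟩·-coeff c ⟨ d ⟩ (suc n)) (ℤ.*-zeroʳ c)) }

⟨⟩-neg : ∀ c → ⟨ ℤ.- c ⟩ ≈ ⊝ ⟨ c ⟩
⟨⟩-neg c = mk≈ λ { zero → sym (⊝-coeff ⟨ c ⟩ 0) ; (suc n) → sym (⊝-coeff ⟨ c ⟩ (suc n)) }

private
  acRing : ACR.AlmostCommutativeRing 0ℓ 0ℓ
  acRing = ACR.fromCommutativeRing powerSeriesRing

  scalars : CommutativeRing.rawRing ℤ.+-*-commutativeRing ACR.-Raw-AlmostCommutative⟶ acRing
  scalars = record
    { ⟦_⟧    = ⟨_⟩
    ; +-homo = ⟨⟩-+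
    ; *-homo = ⟨⟩-*
    ; -‿homo = ⟨⟩-neg
    ; 0-homo = ≈-refl
    ; 1-homo = ≈-refl
    }

  _≟⟨⟩_ : ∀ c d → _
  c ≟⟨⟩ d with c ℤ.≟ d
  ... | yes c≡d = just (R.reflexive (cong ⟨_⟩ c≡d))
  ... | no  _   = nothing

open RingSolver (CommutativeRing.rawRing ℤ.+-*-commutativeRing) acRing scalars _≟⟨⟩_
  using (Polynomial; solve; _:=_; _:+_; _:*_; :-_; _:-_; _:^_; con)

-- Congruence modulo q^N and limits

≈⇒≈[] : ∀ {F G N} → F ≈ G → F ≈[ N ] G
≈⇒≈[] p = mk≈[] λ n _ → coeff p n

≈[]-refl : ∀ {F N} → F ≈[ N ] F
≈[]-refl = mk≈[] λ _ _ → refl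

≈[]-sym : ∀ {F G N} → F ≈[ N ] G → G ≈[ N ] F
≈[]-sym p = mk≈[] λ n n<N → sym (coeff[] p n n<N)

≈[]-trans : ∀ {F G H N} → F ≈[ N ] G → G ≈[ N ] H → F ≈[ N ] H
≈[]-trans p r = mk≈[] λ n n<N → trans (coeff[] p n n<N) (coeff[] r n n<N)

≈[]-weaken : ∀ {F G M N} → M ≤ N → F ≈[ N ] G → F ≈[ M ] G
≈[]-weaken M≤N p = mk≈[] λ n n<M → coeff[] p n (ℕ.≤-trans n<M M≤N)

⊕-cong[] : ∀ {F F′ G G′ N} → F ≈[ N ] F′ → G ≈[ N ] G′ → F ⊕ G ≈[ N ] F′ ⊕ G′
⊕-cong[] p r = mk≈[] λ n n<N → trans (⊕-coeff _ _ n)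
  (trans (cong₂ ℤ._+_ (coeff[] p n n<N) (coeff[] r n n<N)) (sym (⊕-coeff _ _ n)))

⊝-cong[] : ∀ {F F′ N} → F ≈[ N ] F′ → ⊝ F ≈[ N ] ⊝ F′
⊝-cong[] p = mk≈[] λ n n<N → trans (⊝-coeff _ n) (trans (cong ℤ.-_ (coeff[] p n n<N)) (sym (⊝-coeff _ n)))

·-cong[] : ∀ {F F′ G G′ N} → F ≈[ N ] F′ → G ≈[ N ] G′ → F · G ≈[ N ] F′ · G′
·-cong[] p r = mk≈[] λ n n<N → ·-cong≤ n (λ i i≤n → coeff[] p i (ℕ.≤-<-trans i≤n n<N))
                                           (λ i i≤n → coeff[] r i (ℕ.≤-<-trans i≤n n<N))

≈[0] : ∀ {F G} → F ≈[ 0 ] G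
≈[0] = mk≈[] λ _ ()

≈[]⇒≈ : ∀ {F G} → (∀ N → F ≈[ N ] G) → F ≈ G
≈[]⇒≈ p = mk≈ λ n → coeff[] (p (suc n)) n ℕ.≤-refl

·-order : ∀ {F G} M {N} → F ≈[ M ] ⟨ 0ℤ ⟩ → G ≈[ N ] ⟨ 0ℤ ⟩ → F · G ≈[ M + N ] ⟨ 0ℤ ⟩
·-order {F} zero p r = ≈[]-trans (·-cong[] {F} ≈[]-refl r) (≈⇒≈[] (R.zeroʳ F))
·-order {F} {G} (suc M) {N} p r = mk≈[] go
  where
  go : ∀ n → n < suc M + N → (F · G) n ≡ ⟨ 0ℤ ⟩ n
  go zero    _         = trans (·-zero F G) (trans (cong (ℤ._* G 0) (coeff[] p 0 (s≤s z≤n))) (ℤ.*-zeroˡ (G 0)))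
  go (suc n) (s≤s n<) = trans (·-suc F G n)
    (trans (cong₂ ℤ._+_ (trans (cong (ℤ._* G (suc n)) (coeff[] p 0 (s≤s z≤n))) (ℤ.*-zeroˡ (G (suc n))))
                        (coeff[] (·-order {tail F} M (mk≈[] λ i i<M → trans (coeff[] p (suc i) (s≤s i<M)) (sym (⟨0⟩-coeff i))) r) n n<))
           (trans (ℤ.+-identityˡ _) (⟨0⟩-coeff n)))

·-orderʳ : ∀ {F G N} → G ≈[ N ] ⟨ 0ℤ ⟩ → F · G ≈[ N ] ⟨ 0ℤ ⟩
·-orderʳ r = ·-order 0 ≈[0] r

infix 4 _⟶_

-- Convergence at a fixed rate: term `N` is already right modulo q^N. The limit laws then hold
-- separately for each `N`, and no modulus of convergence is carried along; `Summable` and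
-- `Multipliable` ask for exactly the decay that yields this rate.
_⟶_ : (ℕ → PowerSeries) → PowerSeries → Set
s ⟶ F = ∀ N → s N ≈[ N ] F

⟶-unique : ∀ {s F G} → s ⟶ F → s ⟶ G → F ≈ G
⟶-unique p r = ≈[]⇒≈ λ N → ≈[]-trans (≈[]-sym (p N)) (r N)

⟶-resp : ∀ {s t F} → (∀ N → s N ≈ t N) → s ⟶ F → t ⟶ F
⟶-resp s≈t p N = ≈[]-trans (≈⇒≈[] (≈-sym (s≈t N))) (p N)

-- The way in which every identity between infinite sums or products is obtained from its finite
-- truncations.
⟶-unique′ : ∀ {s t F G} → (∀ N → s N ≈ t N) → s ⟶ F → t ⟶ G → F ≈ G
⟶-unique′ s≈t p r = ⟶-unique (⟶-resp s≈t p) r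

⟶-const : ∀ F → (λ _ → F) ⟶ F
⟶-const F N = ≈[]-refl

⟶-⊕ : ∀ {s t F G} → s ⟶ F → t ⟶ G → (λ N → s N ⊕ t N) ⟶ F ⊕ G
⟶-⊕ p r N = ⊕-cong[] (p N) (r N)

⟶-· : ∀ {s t F G} → s ⟶ F → t ⟶ G → (λ N → s N · t N) ⟶ F · G
⟶-· p r N = ·-cong[] (p N) (r N)

⟶-subsequence : ∀ {s F} (φ : ℕ → ℕ) → (∀ N → N ≤ φ N) → s ⟶ F → s ∘ φ ⟶ F
⟶-subsequence φ φ≥ p N = ≈[]-weaken (φ≥ N) (p (φ N))

-- Coefficient n is read from term n + 1, the first one that is reliable modulo q^(n+1).
lim : (ℕ → PowerSeries) → PowerSeries
lim s n = s (suc n) n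

Cauchy : (ℕ → PowerSeries) → Set
Cauchy s = ∀ N → s (suc N) ≈[ N ] s N

lim-⟶ : ∀ {s} → Cauchy s → s ⟶ lim s
lim-⟶ {s} c N = mk≈[] λ n n<N → go n (ℕ.≤⇒≤′ n<N)
  where
  go : ∀ n {N} → suc n ≤′ N → s N n ≡ s (suc n) n
  go n ≤′-refl = refl
  go n (≤′-step {N} l) = trans (coeff[] (c N) n (ℕ.≤′⇒≤ l)) (go n l)

lim-cong : ∀ {s t} → (∀ N → s N ≈ t N) → lim s ≈ lim t
lim-cong p = mk≈ λ n → coeff (p (suc n)) n

-- Infinite sums

Summable : (ℕ → PowerSeries) → Set
Summable h = ∀ k → h k ≈[ k ] ⟨ 0ℤ ⟩

∑< : ℕ → (ℕ → PowerSeries) → PowerSeries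
∑< zero    h = ⟨ 0ℤ ⟩
∑< (suc N) h = ∑< N h ⊕ h N

∑∞ : (ℕ → PowerSeries) → PowerSeries
∑∞ h = lim (λ N → ∑< N h)

∑∞-⟶ : ∀ {h} → Summable h → (λ N → ∑< N h) ⟶ ∑∞ h
∑∞-⟶ {h} sh = lim-⟶ λ N →
  ≈[]-trans (⊕-cong[] {∑< N h} ≈[]-refl (sh N)) (≈⇒≈[] (R.+-identityʳ (∑< N h)))

∑<-cong : ∀ {h h′} N → (∀ k → h k ≈ h′ k) → ∑< N h ≈ ∑< N h′
∑<-cong zero    p = ≈-refl
∑<-cong (suc N) p = R.+-cong (∑<-cong N p) (p N)

∑∞-cong : ∀ {h h′} → (∀ k → h k ≈ h′ k) → ∑∞ h ≈ ∑∞ h′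
∑∞-cong p = lim-cong λ N → ∑<-cong N p

∑<-⊕ : ∀ h h′ N → ∑< N (λ k → h k ⊕ h′ k) ≈ ∑< N h ⊕ ∑< N h′
∑<-⊕ h h′ zero    = ≈-sym (R.+-identityˡ _)
∑<-⊕ h h′ (suc N) = ≈-trans (R.+-congʳ (∑<-⊕ h h′ N))
  (solve 4 (λ a b c d → (a :+ b) :+ (c :+ d) := (a :+ c) :+ (b :+ d)) ≈-refl _ _ _ _)

∑∞-⊕ : ∀ h h′ → ∑∞ (λ k → h k ⊕ h′ k) ≈ ∑∞ h ⊕ ∑∞ h′
∑∞-⊕ h h′ = mk≈ λ n → trans (coeff (∑<-⊕ h h′ (suc n)) n) (trans (⊕-coeff _ _ n) (sym (⊕-coeff _ _ n)))

∑<-· : ∀ c h N → ∑< N (λ k → c · h k) ≈ c · ∑< N h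
∑<-· c h zero    = ≈-sym (R.zeroʳ c)
∑<-· c h (suc N) = ≈-trans (R.+-congʳ (∑<-· c h N)) (≈-sym (R.distribˡ c _ _))

∑∞-· : ∀ c {h} → Summable h → ∑∞ (λ k → c · h k) ≈ c · ∑∞ h
∑∞-· c {h} sh = ⟶-unique′ (∑<-· c h) (∑∞-⟶ λ k → ·-orderʳ (sh k)) (⟶-· (⟶-const c) (∑∞-⟶ sh))

Summable-suc : ∀ {h} → Summable h → Summable (h ∘ suc)
Summable-suc sh k = ≈[]-weaken (ℕ.n≤1+n k) (sh (suc k))

∑<-shift : ∀ h N → ∑< (suc N) h ≈ h 0 ⊕ ∑< N (h ∘ suc)
∑<-shift h zero    = R.+-comm _ _
∑<-shift h (suc N) = ≈-trans (R.+-congʳ (∑<-shift h N)) (R.+-assoc _ _ _)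

∑∞-shift : ∀ {h} → Summable h → ∑∞ h ≈ h 0 ⊕ ∑∞ (h ∘ suc)
∑∞-shift {h} sh = ⟶-unique′ (∑<-shift h) (⟶-subsequence suc ℕ.n≤1+n (∑∞-⟶ sh))
  (⟶-⊕ (⟶-const (h 0)) (∑∞-⟶ (Summable-suc sh)))

Summable-∘ : ∀ {h} φ → (∀ k → k ≤ φ k) → Summable h → Summable (h ∘ φ)
Summable-∘ φ φ≥ sh k = ≈[]-weaken (φ≥ k) (sh (φ k))

∑<-split₂ : ∀ h N → ∑< (N * 2) h ≈ ∑< N (λ k → h (k * 2)) ⊕ ∑< N (λ k → h (1 + k * 2))
∑<-split₂ h zero    = ≈-sym (R.+-identityˡ _)
∑<-split₂ h (suc N) = ≈-trans (R.+-congʳ (R.+-congʳ (∑<-split₂ h N)))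
  (solve 4 (λ a b c d → (a :+ b) :+ c :+ d := (a :+ c) :+ (b :+ d)) ≈-refl _ _ _ _)

∑<-split₃ : ∀ h N → ∑< (N * 3) h ≈ ∑< N (λ k → h (k * 3)) ⊕ ∑< N (λ k → h (1 + k * 3)) ⊕ ∑< N (λ k → h (2 + k * 3))
∑<-split₃ h zero    = ≈-sym (≈-trans (R.+-identityʳ _) (R.+-identityʳ _))
∑<-split₃ h (suc N) = ≈-trans (R.+-congʳ (R.+-congʳ (R.+-congʳ (∑<-split₃ h N))))
  (solve 6 (λ a b e c d f → (a :+ b :+ e) :+ c :+ d :+ f := (a :+ c) :+ (b :+ d) :+ (e :+ f)) ≈-refl _ _ _ _ _ _)

private
  m≤c+m*n : ∀ m c n → m ≤ c + m * suc n
  m≤c+m*n m c n = ℕ.≤-trans (ℕ.m≤m*n m (suc n)) (ℕ.m≤n+m _ c)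

∑∞-split₂ : ∀ {h} → Summable h → ∑∞ h ≈ ∑∞ (λ k → h (k * 2)) ⊕ ∑∞ (λ k → h (1 + k * 2))
∑∞-split₂ {h} sh = ⟶-unique′ (∑<-split₂ h) (⟶-subsequence (_* 2) (λ N → m≤c+m*n N 0 1) (∑∞-⟶ sh))
  (⟶-⊕ (∑∞-⟶ (Summable-∘ (_* 2) (λ N → m≤c+m*n N 0 1) sh))
       (∑∞-⟶ (Summable-∘ (λ k → 1 + k * 2) (λ N → m≤c+m*n N 1 1) sh)))

∑∞-split₃ : ∀ {h} → Summable h →
            ∑∞ h ≈ ∑∞ (λ k → h (k * 3)) ⊕ ∑∞ (λ k → h (1 + k * 3)) ⊕ ∑∞ (λ k → h (2 + k * 3))
∑∞-split₃ {h} sh = ⟶-unique′ (∑<-split₃ h) (⟶-subsequence (_* 3) (λ N → m≤c+m*n N 0 2) (∑∞-⟶ sh))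
  (⟶-⊕ (⟶-⊕ (∑∞-⟶ (Summable-∘ (_* 3) (λ N → m≤c+m*n N 0 2) sh))
             (∑∞-⟶ (Summable-∘ (λ k → 1 + k * 3) (λ N → m≤c+m*n N 1 2) sh)))
       (∑∞-⟶ (Summable-∘ (λ k → 2 + k * 3) (λ N → m≤c+m*n N 2 2) sh)))

-- Infinite products

Multipliable : (ℕ → PowerSeries) → Set
Multipliable g = ∀ m → g m ≈[ m ] ⟨ 1ℤ ⟩

∏< : ℕ → (ℕ → PowerSeries) → PowerSeries
∏< zero    g = ⟨ 1ℤ ⟩
∏< (suc N) g = g N · ∏< N g

∏∞ : (ℕ → PowerSeries) → PowerSeries
∏∞ g = lim (λ N → ∏< N g)

∏∞-⟶ : ∀ {g} → Multipliable g → (λ N → ∏< N g) ⟶ ∏∞ g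
∏∞-⟶ {g} mg = lim-⟶ λ N →
  ≈[]-trans (·-cong[] {G = ∏< N g} (mg N) ≈[]-refl) (≈⇒≈[] (R.*-identityˡ (∏< N g)))

∏<-cong : ∀ {g g′} N → (∀ m → g m ≈ g′ m) → ∏< N g ≈ ∏< N g′
∏<-cong zero    p = ≈-refl
∏<-cong (suc N) p = R.*-cong (p N) (∏<-cong N p)

∏∞-cong : ∀ {g g′} → (∀ m → g m ≈ g′ m) → ∏∞ g ≈ ∏∞ g′
∏∞-cong p = lim-cong λ N → ∏<-cong N p

∏<-· : ∀ g g′ N → ∏< N (λ m → g m · g′ m) ≈ ∏< N g · ∏< N g′
∏<-· g g′ zero    = ≈-sym (R.*-identityˡ _)
∏<-· g g′ (suc N) = ≈-trans (R.*-congˡ (∏<-· g g′ N))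
  (solve 4 (λ a b c d → (a :* b) :* (c :* d) := (a :* c) :* (b :* d)) ≈-refl _ _ _ _)

Multipliable-· : ∀ {g g′} → Multipliable g → Multipliable g′ → Multipliable (λ m → g m · g′ m)
Multipliable-· mg mg′ m = ≈[]-trans (·-cong[] (mg m) (mg′ m)) (≈⇒≈[] (R.*-identityˡ _))

∏∞-· : ∀ {g g′} → Multipliable g → Multipliable g′ → ∏∞ (λ m → g m · g′ m) ≈ ∏∞ g · ∏∞ g′
∏∞-· {g} {g′} mg mg′ = ⟶-unique′ (∏<-· g g′) (∏∞-⟶ (Multipliable-· mg mg′)) (⟶-· (∏∞-⟶ mg) (∏∞-⟶ mg′))

∏<-shift : ∀ g N → ∏< (suc N) g ≈ g 0 · ∏< N (g ∘ suc)
∏<-shift g zero    = ≈-refl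
∏<-shift g (suc N) = ≈-trans (R.*-congˡ (∏<-shift g N))
  (solve 3 (λ a b c → a :* (b :* c) := b :* (a :* c)) ≈-refl _ _ _)

Multipliable-∘ : ∀ {g} φ → (∀ k → k ≤ φ k) → Multipliable g → Multipliable (g ∘ φ)
Multipliable-∘ φ φ≥ mg k = ≈[]-weaken (φ≥ k) (mg (φ k))

∏∞-shift : ∀ {g} → Multipliable g → ∏∞ g ≈ g 0 · ∏∞ (g ∘ suc)
∏∞-shift {g} mg = ⟶-unique′ (∏<-shift g) (⟶-subsequence suc ℕ.n≤1+n (∏∞-⟶ mg))
  (⟶-· (⟶-const (g 0)) (∏∞-⟶ (Multipliable-∘ suc ℕ.n≤1+n mg)))

∏<-split₂ : ∀ g N → ∏< (N * 2) g ≈ ∏< N (λ m → g (m * 2) · g (1 + m * 2))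
∏<-split₂ g zero    = ≈-refl
∏<-split₂ g (suc N) = ≈-trans (R.*-congˡ (R.*-congˡ (∏<-split₂ g N)))
  (solve 3 (λ a b c → a :* (b :* c) := (b :* a) :* c) ≈-refl _ _ _)

∏∞-split₂ : ∀ {g} → Multipliable g → ∏∞ g ≈ ∏∞ (λ m → g (m * 2) · g (1 + m * 2))
∏∞-split₂ {g} mg = ⟶-unique′ (∏<-split₂ g) (⟶-subsequence (_* 2) (λ N → m≤c+m*n N 0 1) (∏∞-⟶ mg))
  (∏∞-⟶ (Multipliable-· (Multipliable-∘ (_* 2) (λ N → m≤c+m*n N 0 1) mg)
                         (Multipliable-∘ (λ m → 1 + m * 2) (λ N → m≤c+m*n N 1 1) mg)))

-- Identities between quotients are stated with their denominators cleared, and this removes the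
-- common factor; the inverse of `H` comes from `⊘-correct`.
·-cancelˡ : ∀ {F G} H → H 0 ≡ 1ℤ → H · F ≈ H · G → F ≈ G
·-cancelˡ {F} {G} H H₀≡1 HF≈HG = begin
  F                    ≈⟨ undo F ⟨
  H⁻¹ · (H · F)        ≈⟨ R.*-congˡ HF≈HG ⟩
  H⁻¹ · (H · G)        ≈⟨ undo G ⟩
  G                    ∎
  where
  open ≈-Reasoning
  H⁻¹ = ⟨ 1ℤ ⟩ ⊘ H
  inverse : H · H⁻¹ ≈ ⟨ 1ℤ ⟩
  inverse = mk≈ λ n → trans (·-⊛ H H⁻¹ n) (⊘-correct ⟨ 1ℤ ⟩ H H₀≡1 n)
  undo : ∀ X → H⁻¹ · (H · X) ≈ X
  undo X = begin
    H⁻¹ · (H · X)  ≈⟨ solve 3 (λ a b c → a :* (b :* c) := (b :* a) :* c) ≈-refl H⁻¹ H X ⟩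
    (H · H⁻¹) · X  ≈⟨ R.*-congʳ inverse ⟩
    ⟨ 1ℤ ⟩ · X     ≈⟨ R.*-identityˡ X ⟩
    X              ∎

-- Powers of q

q^0≈1 : q^ 0 ≈ ⟨ 1ℤ ⟩
q^0≈1 = mk≈ λ { zero → refl ; (suc n) → refl }

q^·-suc : ∀ j F n → (q^ suc j · F) (suc n) ≡ (q^ j · F) n
q^·-suc j F n = trans (·-suc (q^ suc j) F n)
  (trans (cong (ℤ._+ (q^ j · F) n) (ℤ.*-zeroˡ (F (suc n)))) (ℤ.+-identityˡ _))

q^·-zero : ∀ j F → (q^ suc j · F) 0 ≡ 0ℤ
q^·-zero j F = trans (·-zero (q^ suc j) F) (ℤ.*-zeroˡ (F 0))

q^0· : ∀ F → q^ 0 · F ≈ F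
q^0· F = ≈-trans (R.*-congʳ q^0≈1) (R.*-identityˡ F)

q^-+ : ∀ i j → q^ (i + j) ≈ q^ i · q^ j
q^-+ i j = mk≈ (go i)
  where
  go : ∀ i n → (q^ (i + j)) n ≡ (q^ i · q^ j) n
  go zero    n       = sym (coeff (q^0· (q^ j)) n)
  go (suc i) zero    = sym (q^·-zero i (q^ j))
  go (suc i) (suc n) = trans (go i n) (sym (q^·-suc i (q^ j) n))

q^-cong : ∀ {i j} → i ≡ j → q^ i ≈ q^ j
q^-cong i≡j = R.reflexive (cong q^_ i≡j)

q^-↑ : ∀ i k → (q^ i) ↑ k ≈ q^ (k * i)
q^-↑ i zero    = ≈-sym q^0≈1
q^-↑ i (suc k) = ≈-trans (R.*-congˡ (q^-↑ i k)) (≈-sym (q^-+ i (k * i)))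

q^-order : ∀ j → q^ j ≈[ j ] ⟨ 0ℤ ⟩
q^-order j = mk≈[] λ n n<j → trans (q^-below n<j) (sym (⟨0⟩-coeff n))

-- A positive power of q gains one order of precision. This is the induction step whenever an
-- identity is proved modulo q^N for all `N`.
q^·-cong[] : ∀ {F G N} j → F ≈[ N ] G → q^ suc j · F ≈[ suc N ] q^ suc j · G
q^·-cong[] {F} {G} {N} j p = mk≈[] go
  where
  go : ∀ n → n < suc N → (q^ suc j · F) n ≡ (q^ suc j · G) n
  go zero    _         = trans (q^·-zero j F) (sym (q^·-zero j G))
  go (suc n) (s≤s n<N) = trans (q^·-suc j F n)
    (trans (coeff[] (·-cong[] {q^ j} ≈[]-refl p) n n<N) (sym (q^·-suc j G n)))

-- The substitution q ↦ q^k; spread k i F is q^i F(q^k).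

spread : ℕ → ℕ → PowerSeries → PowerSeries
spread k zero    F zero    = F 0
spread k zero    F (suc n) = spread k (k ∸ 1) (tail F) n
spread k (suc i) F zero    = 0ℤ
spread k (suc i) F (suc n) = spread k i F n

θ : ℕ → PowerSeries → PowerSeries
θ k = spread k 0

spread≈ : ∀ k i F → spread k i F ≈ q^ i · θ k F
spread≈ k i F = mk≈ (go i)
  where
  go : ∀ i n → spread k i F n ≡ (q^ i · θ k F) n
  go zero    n       = sym (coeff (q^0· (θ k F)) n)
  go (suc i) zero    = sym (q^·-zero i (θ k F))
  go (suc i) (suc n) = trans (go i n) (sym (q^·-suc i (θ k F) n))

spread-cong≤ : ∀ k i {F G} n → (∀ m → m ≤ n → F m ≡ G m) → spread k i F n ≡ spread k i G n
spread-cong≤ k zero    zero    p = p 0 z≤n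
spread-cong≤ k zero    (suc n) p = spread-cong≤ k (k ∸ 1) n (λ m m≤n → p (suc m) (s≤s m≤n))
spread-cong≤ k (suc i) zero    p = refl
spread-cong≤ k (suc i) (suc n) p = spread-cong≤ k i n (λ m m≤n → p m (ℕ.m≤n⇒m≤1+n m≤n))

spread-⊕ : ∀ k i F G n → spread k i (F ⊕ G) n ≡ spread k i F n ℤ.+ spread k i G n
spread-⊕ k zero    F G zero    = ⊕-coeff F G 0
spread-⊕ k zero    F G (suc n) = trans (spread-cong≤ k (k ∸ 1) n λ m _ → trans (⊕-coeff F G (suc m)) (sym (⊕-coeff (tail F) (tail G) m)))
                                       (spread-⊕ k (k ∸ 1) (tail F) (tail G) n)
spread-⊕ k (suc i) F G zero    = refl
spread-⊕ k (suc i) F G (suc n) = spread-⊕ k i F G n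

spread-scale : ∀ k i c F n → spread k i (⟨ c ⟩ · F) n ≡ c ℤ.* spread k i F n
spread-scale k zero    c F zero    = ⟨⟩·-coeff c F 0
spread-scale k zero    c F (suc n) = trans (spread-cong≤ k (k ∸ 1) n λ m _ → trans (⟨⟩·-coeff c F (suc m)) (sym (⟨⟩·-coeff c (tail F) m)))
                                           (spread-scale k (k ∸ 1) c (tail F) n)
spread-scale k (suc i) c F zero    = sym (ℤ.*-zeroʳ c)
spread-scale k (suc i) c F (suc n) = spread-scale k i c F n

θ-cong : ∀ k {F G} → F ≈ G → θ k F ≈ θ k G
θ-cong k p = mk≈ λ n → spread-cong≤ k 0 n λ m _ → coeff p m

θ-cong[] : ∀ k {F G N} → F ≈[ N ] G → θ k F ≈[ N ] θ k G
θ-cong[] k p = mk≈[] λ n n<N → spread-cong≤ k 0 n λ m m≤n → coeff[] p m (ℕ.≤-<-trans m≤n n<N)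

θ-⊕ : ∀ k F G → θ k (F ⊕ G) ≈ θ k F ⊕ θ k G
θ-⊕ k F G = mk≈ λ n → trans (spread-⊕ k 0 F G n) (sym (⊕-coeff _ _ n))

θ-scale : ∀ k c F → θ k (⟨ c ⟩ · F) ≈ ⟨ c ⟩ · θ k F
θ-scale k c F = mk≈ λ n → trans (spread-scale k 0 c F n) (sym (⟨⟩·-coeff c (θ k F) n))

θ-⊝ : ∀ k F → θ k (⊝ F) ≈ ⊝ θ k F
θ-⊝ k F = ≈-trans (θ-cong k (neg F)) (≈-trans (θ-scale k (ℤ.- 1ℤ) F) (≈-sym (neg (θ k F))))
  where
  neg : ∀ X → ⊝ X ≈ ⟨ ℤ.- 1ℤ ⟩ · X
  neg = solve 1 (λ x → :- x := con (ℤ.- 1ℤ) :* x) ≈-refl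

-- The functional equation F(q^k) = F(0) + q^k (tail F)(q^k). It determines the substitution
-- completely (`θ-unique`), since the unknown on the right carries a positive power of q.
θ-step : ∀ j F → θ (suc j) F ≈ ⟨ F 0 ⟩ ⊕ q^ suc j · θ (suc j) (tail F)
θ-step j F = mk≈ λ
  { zero    → sym (trans (⊕-coeff _ _ 0) (trans (cong (ℤ._+_ (F 0)) (q^·-zero j _)) (ℤ.+-identityʳ (F 0))))
  ; (suc n) → sym (trans (⊕-coeff _ _ (suc n)) (trans (ℤ.+-identityˡ _)
                (trans (q^·-suc j _ n) (sym (coeff (spread≈ (suc j) j (tail F)) n))))) }

θ-⟨⟩ : ∀ k c → θ k ⟨ c ⟩ ≈ ⟨ c ⟩
θ-⟨⟩ k c = mk≈ λ { zero → refl ; (suc n) → vanishes (k ∸ 1) n }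
  where
  vanishes : ∀ i n → spread k i (λ _ → 0ℤ) n ≡ 0ℤ
  vanishes zero    zero    = refl
  vanishes zero    (suc n) = vanishes (k ∸ 1) n
  vanishes (suc i) zero    = refl
  vanishes (suc i) (suc n) = vanishes i n

-- Induction on the precision: once the constant terms are peeled off, the only product still to be
-- compared, that of `tail F` and `G`, is multiplied by `Q`, so knowing it modulo q^N suffices
-- modulo q^(N+1).
θ-· : ∀ j F G → θ (suc j) (F · G) ≈ θ (suc j) F · θ (suc j) G
θ-· j F G = ≈[]⇒≈ λ N → go N F G
  where
  Θ = θ (suc j)
  Q = q^ suc j
  go : ∀ N F G → Θ (F · G) ≈[ N ] Θ F · Θ G
  go zero    F G = ≈[0]
  go (suc N) F G = ≈[]-trans (≈⇒≈[] expandˡ)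
    (≈[]-trans (⊕-cong[] ≈[]-refl (⊕-cong[] ≈[]-refl (q^·-cong[] j (go N (tail F) G)))) (≈⇒≈[] expandʳ))
    where
    open ≈-Reasoning
    expandˡ : Θ (F · G) ≈ ⟨ F 0 ⟩ · ⟨ G 0 ⟩ ⊕ (Q · (⟨ F 0 ⟩ · Θ (tail G)) ⊕ Q · Θ (tail F · G))
    expandˡ = begin
      Θ (F · G)
        ≈⟨ θ-step j (F · G) ⟩
      ⟨ (F · G) 0 ⟩ ⊕ Q · Θ (tail (F · G))
        ≈⟨ R.+-cong (≈-trans (R.reflexive (cong ⟨_⟩ (·-zero F G))) (⟨⟩-* (F 0) (G 0)))
             (R.*-congˡ (≈-trans (θ-cong (suc j) (tail-· F G)) (≈-trans (θ-⊕ (suc j) _ _) (R.+-congʳ (θ-scale (suc j) (F 0) (tail G)))))) ⟩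
      ⟨ F 0 ⟩ · ⟨ G 0 ⟩ ⊕ Q · (⟨ F 0 ⟩ · Θ (tail G) ⊕ Θ (tail F · G))
        ≈⟨ R.+-congˡ (R.distribˡ Q _ _) ⟩
      ⟨ F 0 ⟩ · ⟨ G 0 ⟩ ⊕ (Q · (⟨ F 0 ⟩ · Θ (tail G)) ⊕ Q · Θ (tail F · G)) ∎
    expandʳ : ⟨ F 0 ⟩ · ⟨ G 0 ⟩ ⊕ (Q · (⟨ F 0 ⟩ · Θ (tail G)) ⊕ Q · (Θ (tail F) · Θ G)) ≈ Θ F · Θ G
    expandʳ = begin
      ⟨ F 0 ⟩ · ⟨ G 0 ⟩ ⊕ (Q · (⟨ F 0 ⟩ · Θ (tail G)) ⊕ Q · (Θ (tail F) · Θ G))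
        ≈⟨ solve 6 (λ a b q c d e → a :* b :+ (q :* (a :* c) :+ q :* (d :* e)) := a :* (b :+ q :* c) :+ q :* d :* e)
             ≈-refl ⟨ F 0 ⟩ ⟨ G 0 ⟩ Q (Θ (tail G)) (Θ (tail F)) (Θ G) ⟩
      ⟨ F 0 ⟩ · (⟨ G 0 ⟩ ⊕ Q · Θ (tail G)) ⊕ Q · Θ (tail F) · Θ G
        ≈⟨ R.+-congʳ (R.*-congˡ (θ-step j G)) ⟨
      ⟨ F 0 ⟩ · Θ G ⊕ Q · Θ (tail F) · Θ G
        ≈⟨ R.distribʳ (Θ G) _ _ ⟨
      (⟨ F 0 ⟩ ⊕ Q · Θ (tail F)) · Θ G
        ≈⟨ R.*-congʳ (θ-step j F) ⟨
      Θ F · Θ G ∎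

θ-↑ : ∀ j F k → θ (suc j) (F ↑ k) ≈ θ (suc j) F ↑ k
θ-↑ j F zero    = θ-⟨⟩ (suc j) 1ℤ
θ-↑ j F (suc k) = ≈-trans (θ-· j F (F ↑ k)) (R.*-congˡ (θ-↑ j F k))

θ-q^ : ∀ j i → θ (suc j) (q^ i) ≈ q^ (i * suc j)
θ-q^ j zero    = ≈-trans (θ-cong (suc j) q^0≈1) (≈-trans (θ-⟨⟩ (suc j) 1ℤ) (≈-sym q^0≈1))
θ-q^ j (suc i) = begin
  θ (suc j) (q^ suc i)                       ≈⟨ θ-step j (q^ suc i) ⟩
  ⟨ 0ℤ ⟩ ⊕ q^ suc j · θ (suc j) (q^ i)       ≈⟨ R.+-identityˡ _ ⟩
  q^ suc j · θ (suc j) (q^ i)                ≈⟨ R.*-congˡ (θ-q^ j i) ⟩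
  q^ suc j · q^ (i * suc j)                  ≈⟨ q^-+ (suc j) (i * suc j) ⟨
  q^ (suc i * suc j)                         ∎
  where open ≈-Reasoning

θ-unique : ∀ j (X : PowerSeries → PowerSeries) →
           (∀ F → X F ≈ ⟨ F 0 ⟩ ⊕ q^ suc j · X (tail F)) → ∀ F → X F ≈ θ (suc j) F
θ-unique j X step F = ≈[]⇒≈ λ N → go N F
  where
  go : ∀ N F → X F ≈[ N ] θ (suc j) F
  go zero    F = ≈[0]
  go (suc N) F = ≈[]-trans (≈⇒≈[] (step F))
    (≈[]-trans (⊕-cong[] ≈[]-refl (q^·-cong[] j (go N (tail F)))) (≈⇒≈[] (≈-sym (θ-step j F))))

θ-θ : ∀ i j F → θ (suc i) (θ (suc j) F) ≈ θ (suc j * suc i) F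
-- `suc (i + j * suc i)` computes to `suc j * suc i`, the exponent of the composite substitution.
θ-θ i j = θ-unique (i + j * suc i) (λ F → θ (suc i) (θ (suc j) F)) λ F → begin
  θ (suc i) (θ (suc j) F)
    ≈⟨ θ-cong (suc i) (θ-step j F) ⟩
  θ (suc i) (⟨ F 0 ⟩ ⊕ q^ suc j · θ (suc j) (tail F))
    ≈⟨ θ-⊕ (suc i) _ _ ⟩
  θ (suc i) ⟨ F 0 ⟩ ⊕ θ (suc i) (q^ suc j · θ (suc j) (tail F))
    ≈⟨ R.+-cong (θ-⟨⟩ (suc i) (F 0)) (θ-· i _ _) ⟩
  ⟨ F 0 ⟩ ⊕ θ (suc i) (q^ suc j) · θ (suc i) (θ (suc j) (tail F))
    ≈⟨ R.+-congˡ (R.*-congʳ (θ-q^ i (suc j))) ⟩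
  ⟨ F 0 ⟩ ⊕ q^ (suc j * suc i) · θ (suc i) (θ (suc j) (tail F)) ∎
  where open ≈-Reasoning

⟶-θ : ∀ k {s F} → s ⟶ F → (λ N → θ k (s N)) ⟶ θ k F
⟶-θ k p N = θ-cong[] k (p N)

θ-∑< : ∀ k h N → θ k (∑< N h) ≈ ∑< N (λ i → θ k (h i))
θ-∑< k h zero    = θ-⟨⟩ k 0ℤ
θ-∑< k h (suc N) = ≈-trans (θ-⊕ k _ _) (R.+-congʳ (θ-∑< k h N))

θ-∑∞ : ∀ k {h} → Summable h → θ k (∑∞ h) ≈ ∑∞ (λ i → θ k (h i))
θ-∑∞ k {h} sh = ⟶-unique′ (θ-∑< k h) (⟶-θ k (∑∞-⟶ sh))
  (∑∞-⟶ λ i → ≈[]-trans (θ-cong[] k (sh i)) (≈⇒≈[] (θ-⟨⟩ k 0ℤ)))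

θ-∏< : ∀ j g N → θ (suc j) (∏< N g) ≈ ∏< N (λ i → θ (suc j) (g i))
θ-∏< j g zero    = θ-⟨⟩ (suc j) 1ℤ
θ-∏< j g (suc N) = ≈-trans (θ-· j _ _) (R.*-congˡ (θ-∏< j g N))

θ-∏∞ : ∀ j {g} → Multipliable g → θ (suc j) (∏∞ g) ≈ ∏∞ (λ i → θ (suc j) (g i))
θ-∏∞ j {g} mg = ⟶-unique′ (θ-∏< j g) (⟶-θ (suc j) (∏∞-⟶ mg))
  (∏∞-⟶ λ i → ≈[]-trans (θ-cong[] (suc j) (mg i)) (≈⇒≈[] (θ-⟨⟩ (suc j) 1ℤ)))

-- Trisection

U : PowerSeries → PowerSeries
U F n = F (n * 3)

U-cong : ∀ {F G} → F ≈ G → U F ≈ U G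
U-cong p = mk≈ λ n → coeff p (n * 3)

U-⊕ : ∀ F G → U (F ⊕ G) ≈ U F ⊕ U G
U-⊕ F G = mk≈ λ n → trans (⊕-coeff F G (n * 3)) (sym (⊕-coeff (U F) (U G) n))

U-θ : ∀ F → U (θ 3 F) ≈ F
U-θ F = mk≈ (go F)
  where
  go : ∀ F n → θ 3 F (n * 3) ≡ F n
  go F zero    = refl
  go F (suc n) = go (tail F) n

U-θ· : ∀ F G → U (θ 3 F · G) ≈ F · U G
U-θ· F G = mk≈ (go F)
  where
  open ≡-Reasoning
  -- Two of every three coefficients of `θ 3 F` are zero and are skipped by `drop`, so three steps
  -- of the convolution use up one coefficient of `F`.
  step : ∀ F n → (θ 3 F · G) (3 + n) ≡ F 0 ℤ.* G (3 + n) ℤ.+ (θ 3 (tail F) · G) n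
  step F n = trans (·-suc (θ 3 F) G (2 + n)) (cong (λ z → F 0 ℤ.* G (3 + n) ℤ.+ z)
    (trans (drop (spread 3 2 (tail F)) (1 + n) refl) (drop (spread 3 1 (tail F)) n refl)))
    where
    drop : ∀ X n → X 0 ≡ 0ℤ → (X · G) (suc n) ≡ (tail X · G) n
    drop X n X₀≡0 = trans (·-suc X G n) (trans (cong (λ z → z ℤ.* G (suc n) ℤ.+ (tail X · G) n) X₀≡0)
      (trans (cong (ℤ._+ (tail X · G) n) (ℤ.*-zeroˡ (G (suc n)))) (ℤ.+-identityˡ _)))
  go : ∀ F n → (θ 3 F · G) (n * 3) ≡ (F · U G) n
  go F zero    = trans (·-zero (θ 3 F) G) (sym (·-zero F (U G)))
  go F (suc n) = trans (step F (n * 3)) (trans (cong (λ z → F 0 ℤ.* G (3 + n * 3) ℤ.+ z) (go (tail F) n)) (sym (·-suc F (U G) n)))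

U-spread₁ : ∀ F → U (spread 3 1 F) ≈ ⟨ 0ℤ ⟩
U-spread₁ F = mk≈ λ n → trans (go F n) (sym (⟨0⟩-coeff n))
  where
  go : ∀ F n → spread 3 1 F (n * 3) ≡ 0ℤ
  go F zero    = refl
  go F (suc n) = go (tail F) n

U-spread₂ : ∀ F → U (spread 3 2 F) ≈ ⟨ 0ℤ ⟩
U-spread₂ F = mk≈ λ n → trans (go F n) (sym (⟨0⟩-coeff n))
  where
  go : ∀ F n → spread 3 2 F (n * 3) ≡ 0ℤ
  go F zero    = refl
  go F (suc n) = go (tail F) n

U-cong[] : ∀ {F G N} → F ≈[ N * 3 ] G → U F ≈[ N ] U G
U-cong[] p = mk≈[] λ n n<N → coeff[] p (n * 3) (ℕ.*-monoˡ-< 3 n<N)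

⊕-coeff₃ : ∀ F G H n → (F ⊕ G ⊕ H) n ≡ F n ℤ.+ G n ℤ.+ H n
⊕-coeff₃ F G H n = trans (⊕-coeff (F ⊕ G) H n) (cong (ℤ._+ H n) (⊕-coeff F G n))

trisect : ∀ F → F ≈ θ 3 (U F) ⊕ q^ 1 · θ 3 (U (tail F)) ⊕ q^ 2 · θ 3 (U (tail (tail F)))
trisect F = ≈-trans (mk≈ λ n → trans (go F n) (sym (⊕-coeff₃ (θ 3 (U F)) (spread 3 1 (U (tail F))) (spread 3 2 (U (tail (tail F)))) n)))
  (R.+-cong (R.+-congˡ (spread≈ 3 1 _)) (spread≈ 3 2 _))
  where
  go : ∀ F n → F n ≡ θ 3 (U F) n ℤ.+ spread 3 1 (U (tail F)) n ℤ.+ spread 3 2 (U (tail (tail F))) n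
  go F 0 = sym (trans (ℤ.+-identityʳ _) (ℤ.+-identityʳ _))
  go F 1 = sym (trans (ℤ.+-identityʳ _) (ℤ.+-identityˡ _))
  go F 2 = sym (ℤ.+-identityˡ _)
  go F (suc (suc (suc n))) = go (tail (tail (tail F))) n

U-trisected : ∀ X Y Z → U (θ 3 X ⊕ q^ 1 · θ 3 Y ⊕ q^ 2 · θ 3 Z) ≈ X
U-trisected X Y Z = begin
  U (θ 3 X ⊕ q^ 1 · θ 3 Y ⊕ q^ 2 · θ 3 Z)
    ≈⟨ U-cong (R.+-cong (R.+-congˡ (spread≈ 3 1 Y)) (spread≈ 3 2 Z)) ⟨
  U (θ 3 X ⊕ spread 3 1 Y ⊕ spread 3 2 Z)
    ≈⟨ ≈-trans (U-⊕ _ _) (R.+-congʳ (U-⊕ _ _)) ⟩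
  U (θ 3 X) ⊕ U (spread 3 1 Y) ⊕ U (spread 3 2 Z)
    ≈⟨ R.+-cong (R.+-cong (U-θ X) (U-spread₁ Y)) (U-spread₂ Z) ⟩
  X ⊕ ⟨ 0ℤ ⟩ ⊕ ⟨ 0ℤ ⟩
    ≈⟨ ≈-trans (R.+-identityʳ _) (R.+-identityʳ _) ⟩
  X ∎
  where open ≈-Reasoning

private
  -- Removing the leading coefficient rotates the three components and shortens the first one, so
  -- `U-trisected` alone suffices to read off all of them.
  tail-trisected : ∀ X Y Z → tail (θ 3 X ⊕ q^ 1 · θ 3 Y ⊕ q^ 2 · θ 3 Z) ≈ θ 3 Y ⊕ q^ 1 · θ 3 Z ⊕ q^ 2 · θ 3 (tail X)
  tail-trisected X Y Z = mk≈ λ n → begin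
    (θ 3 X ⊕ q^ 1 · θ 3 Y ⊕ q^ 2 · θ 3 Z) (suc n)
      ≡⟨ ⊕-coeff₃ (θ 3 X) (q^ 1 · θ 3 Y) (q^ 2 · θ 3 Z) (suc n) ⟩
    spread 3 2 (tail X) n ℤ.+ (q^ 1 · θ 3 Y) (suc n) ℤ.+ (q^ 2 · θ 3 Z) (suc n)
      ≡⟨ cong₂ ℤ._+_ (cong₂ ℤ._+_ (coeff (spread≈ 3 2 (tail X)) n)
           (trans (q^·-suc 0 (θ 3 Y) n) (coeff (q^0· (θ 3 Y)) n))) (q^·-suc 1 (θ 3 Z) n) ⟩
    (q^ 2 · θ 3 (tail X)) n ℤ.+ θ 3 Y n ℤ.+ (q^ 1 · θ 3 Z) n
      ≡⟨ rotate ((q^ 2 · θ 3 (tail X)) n) (θ 3 Y n) ((q^ 1 · θ 3 Z) n) ⟩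
    θ 3 Y n ℤ.+ (q^ 1 · θ 3 Z) n ℤ.+ (q^ 2 · θ 3 (tail X)) n
      ≡⟨ ⊕-coeff₃ (θ 3 Y) (q^ 1 · θ 3 Z) (q^ 2 · θ 3 (tail X)) n ⟨
    (θ 3 Y ⊕ q^ 1 · θ 3 Z ⊕ q^ 2 · θ 3 (tail X)) n ∎
    where
    open ≡-Reasoning
    rotate : ∀ a b c → a ℤ.+ b ℤ.+ c ≡ b ℤ.+ c ℤ.+ a
    rotate = ℤ-Tactic.solve-∀

U-tail-trisected : ∀ X Y Z → U (tail (θ 3 X ⊕ q^ 1 · θ 3 Y ⊕ q^ 2 · θ 3 Z)) ≈ Y
U-tail-trisected X Y Z = ≈-trans (U-cong (tail-trisected X Y Z)) (U-trisected Y Z (tail X))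

U-tail²-trisected : ∀ X Y Z → U (tail (tail (θ 3 X ⊕ q^ 1 · θ 3 Y ⊕ q^ 2 · θ 3 Z))) ≈ Z
U-tail²-trisected X Y Z =
  ≈-trans (U-cong (mk≈ λ n → coeff (tail-trisected X Y Z) (suc n))) (U-tail-trisected Y Z (tail X))

-- Jacobi's triple product

infix 8 𝟏+_ 𝟏-_

𝟏+_ 𝟏-_ : PowerSeries → PowerSeries
𝟏+ F = ⟨ 1ℤ ⟩ ⊕ F
𝟏- F = ⟨ 1ℤ ⟩ ⊕ ⊝ F

𝟏+-cong : ∀ {F G} → F ≈ G → 𝟏+ F ≈ 𝟏+ G
𝟏+-cong = R.+-congˡ

𝟏--cong : ∀ {F G} → F ≈ G → 𝟏- F ≈ 𝟏- G
𝟏--cong p = R.+-congˡ (R.-‿cong p)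

𝟏+-cong[] : ∀ {F N} → F ≈[ N ] ⟨ 0ℤ ⟩ → 𝟏+ F ≈[ N ] ⟨ 1ℤ ⟩
𝟏+-cong[] p = ≈[]-trans (⊕-cong[] ≈[]-refl p) (≈⇒≈[] (R.+-identityʳ _))

𝟏--cong[] : ∀ {F N} → F ≈[ N ] ⟨ 0ℤ ⟩ → 𝟏- F ≈[ N ] ⟨ 1ℤ ⟩
𝟏--cong[] p = 𝟏+-cong[] (≈[]-trans (⊝-cong[] p) (≈⇒≈[] (solve 0 (:- con 0ℤ := con 0ℤ) ≈-refl)))

∑∞-cong[] : ∀ {h h′ N} → (∀ k → h k ≈[ N ] h′ k) → ∑∞ h ≈[ N ] ∑∞ h′
∑∞-cong[] {h} {h′} {N} p = mk≈[] λ n n<N → coeff[] (go (suc n)) n n<N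
  where
  go : ∀ M → ∑< M h ≈[ N ] ∑< M h′
  go zero    = ≈[]-refl
  go (suc M) = ⊕-cong[] (go M) (p M)

∏∞-cong[] : ∀ {g N} → (∀ m → g m ≈[ N ] ⟨ 1ℤ ⟩) → ∏∞ g ≈[ N ] ⟨ 1ℤ ⟩
∏∞-cong[] {g} {N} p = mk≈[] λ n n<N → coeff[] (go (suc n)) n n<N
  where
  go : ∀ M → ∏< M g ≈[ N ] ⟨ 1ℤ ⟩
  go zero    = ≈[]-refl
  go (suc M) = ≈[]-trans (·-cong[] (p M) (go M)) (≈⇒≈[] (R.*-identityˡ _))

↑-order : ∀ {F} → F ≈[ 1 ] ⟨ 0ℤ ⟩ → ∀ k → F ↑ k ≈[ k ] ⟨ 0ℤ ⟩
↑-order p zero    = ≈[0]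
↑-order p (suc k) = ·-order 1 p (↑-order p k)

-- The error `G - G′` is multiplied by `F`, so the order of `F` adds to the precision.
·-congʳ-order : ∀ {F G G′} M {N} → F ≈[ M ] ⟨ 0ℤ ⟩ → G ≈[ N ] G′ → F · G ≈[ M + N ] F · G′
·-congʳ-order {F} {G} {G′} M {N} p r = ≈[]-trans (≈⇒≈[] split)
  (≈[]-trans (⊕-cong[] {F · G′} ≈[]-refl (·-order M p difference)) (≈⇒≈[] (R.+-identityʳ _)))
  where
  split : F · G ≈ F · G′ ⊕ F · (G ⊕ ⊝ G′)
  split = solve 3 (λ f g g′ → f :* g := f :* g′ :+ f :* (g :- g′)) ≈-refl F G G′
  difference : G ⊕ ⊝ G′ ≈[ N ] ⟨ 0ℤ ⟩
  difference = ≈[]-trans (⊕-cong[] r ≈[]-refl) (≈⇒≈[] (R.-‿inverseʳ G′))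

-- This is z^k p^(k(k-1)/2), one half of a bilateral theta series with base p.
thetaTerm : PowerSeries → PowerSeries → ℕ → PowerSeries
thetaTerm p z zero    = ⟨ 1ℤ ⟩
thetaTerm p z (suc k) = z · p ↑ k · thetaTerm p z k

-- Ramanujan's f(x, y), the sum of x^(n(n+1)/2) y^(n(n-1)/2) over all integers n.
theta : PowerSeries → PowerSeries → PowerSeries
theta x y = ∑∞ (thetaTerm (x · y) x) ⊕ ∑∞ (λ k → thetaTerm (x · y) y (suc k))

thetaTerm-order : ∀ {p z} → z ≈[ 1 ] ⟨ 0ℤ ⟩ → Summable (thetaTerm p z)
thetaTerm-order z₀ zero    = ≈[0]
thetaTerm-order z₀ (suc k) = ·-order 1 (·-order 1 {0} z₀ ≈[0]) (thetaTerm-order z₀ k)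

-- Two independent series of positive order replace the usual z and 1/z, so negative powers never
-- occur. The sum over n ≥ 0, weighted by `r`, is evaluated by Euler's expansion; each factor 1 + y
-- p^N then adds one term of negative index, and in the limit the weights tend to 1.
module TripleProduct (x y : PowerSeries) (x₀ : x ≈[ 1 ] ⟨ 0ℤ ⟩) (y₀ : y ≈[ 1 ] ⟨ 0ℤ ⟩) where

  p : PowerSeries
  p = x · y

  t : PowerSeries → ℕ → PowerSeries
  t = thetaTerm p

  p₀ : p ≈[ 1 ] ⟨ 0ℤ ⟩
  p₀ = ·-order 1 {0} x₀ ≈[0]

  factor : ℕ → ℕ → PowerSeries
  factor k m = 𝟏- (p ↑ suc (m + k))

  factor≈1 : ∀ k m → factor k m ≈[ suc (m + k) ] ⟨ 1ℤ ⟩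
  factor≈1 k m = 𝟏--cong[] (↑-order p₀ (suc (m + k)))

  -- (p^(k+1); p)_∞, that is (p; p)_∞ / (p; p)_k written without a division.
  r : ℕ → PowerSeries
  r k = ∏∞ (factor k)

  r-order : ∀ k → r k ≈[ k ] ⟨ 1ℤ ⟩
  r-order k = ∏∞-cong[] λ m → ≈[]-weaken (ℕ.≤-trans (ℕ.m≤n+m k m) (ℕ.n≤1+n _)) (factor≈1 k m)

  r-step : ∀ k → r k ⊕ p ↑ suc k · r (suc k) ≈ r (suc k)
  r-step k = begin
    r k ⊕ p ↑ suc k · r (suc k)
      ≈⟨ R.+-congʳ (∏∞-shift λ m → ≈[]-weaken (ℕ.≤-trans (ℕ.m≤m+n m k) (ℕ.n≤1+n _)) (factor≈1 k m)) ⟩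
    𝟏- (p ↑ suc k) · ∏∞ (factor k ∘ suc) ⊕ p ↑ suc k · r (suc k)
      ≈⟨ R.+-congʳ (R.*-congˡ (∏∞-cong λ m → R.reflexive (cong (λ i → 𝟏- (p ↑ suc i)) (sym (ℕ.+-suc m k))))) ⟩
    𝟏- (p ↑ suc k) · r (suc k) ⊕ p ↑ suc k · r (suc k)
      ≈⟨ solve 2 (λ a b → (con 1ℤ :- a) :* b :+ a :* b := b) ≈-refl (p ↑ suc k) (r (suc k)) ⟩
    r (suc k) ∎
    where open ≈-Reasoning

  weight-suc : ∀ M k → (p ↑ suc M) ↑ k ≈ p ↑ k · (p ↑ M) ↑ k
  weight-suc M zero    = ≈-sym (R.*-identityˡ _)
  weight-suc M (suc k) = ≈-trans (R.*-congˡ (weight-suc M k))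
    (solve 4 (λ a b c d → (a :* b) :* (c :* d) := (a :* c) :* (b :* d)) ≈-refl p (p ↑ M) (p ↑ k) ((p ↑ M) ↑ k))

  -- ∑∞ (eulerTerm M) is (p; p)_∞ times Euler's expansion of ∏ (1 + x p^(M+i)).
  eulerTerm : ℕ → ℕ → PowerSeries
  eulerTerm M k = (p ↑ M) ↑ k · (t x k · r k)

  eulerTerm-summable : ∀ M → Summable (eulerTerm M)
  eulerTerm-summable M k = ·-orderʳ {(p ↑ M) ↑ k}
    (≈[]-weaken (ℕ.m≤m+n k 0) (·-order k (thetaTerm-order x₀ k) ≈[0]))

  -- `eulerTerm M` is `eulerTerm 0` with x replaced by x p^M, so this is the q-difference equation
  -- of Euler's series. The terms of index 0 agree; term k + 1 of the first sum combines with term k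
  -- of the second by `r-step`.
  euler-step : ∀ M → 𝟏+ (x · p ↑ M) · ∑∞ (eulerTerm (suc M)) ≈ ∑∞ (eulerTerm M)
  euler-step M = begin
    𝟏+ (x · p ↑ M) · ∑∞ (eulerTerm (suc M))
      ≈⟨ solve 2 (λ a b → (con 1ℤ :+ a) :* b := b :+ a :* b) ≈-refl (x · p ↑ M) (∑∞ (eulerTerm (suc M))) ⟩
    ∑∞ (eulerTerm (suc M)) ⊕ x · p ↑ M · ∑∞ (eulerTerm (suc M))
      ≈⟨ R.+-cong (∑∞-shift (eulerTerm-summable (suc M))) (≈-sym (∑∞-· (x · p ↑ M) (eulerTerm-summable (suc M)))) ⟩
    eulerTerm M 0 ⊕ ∑∞ (eulerTerm (suc M) ∘ suc) ⊕ ∑∞ (λ k → x · p ↑ M · eulerTerm (suc M) k)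
      ≈⟨ R.+-assoc _ _ _ ⟩
    eulerTerm M 0 ⊕ (∑∞ (eulerTerm (suc M) ∘ suc) ⊕ ∑∞ (λ k → x · p ↑ M · eulerTerm (suc M) k))
      ≈⟨ R.+-congˡ (≈-trans (≈-sym (∑∞-⊕ _ _)) (∑∞-cong termwise)) ⟩
    eulerTerm M 0 ⊕ ∑∞ (eulerTerm M ∘ suc)
      ≈⟨ ∑∞-shift (eulerTerm-summable M) ⟨
    ∑∞ (eulerTerm M) ∎
    where
    open ≈-Reasoning
    termwise : ∀ k → eulerTerm (suc M) (suc k) ⊕ x · p ↑ M · eulerTerm (suc M) k ≈ eulerTerm M (suc k)
    termwise k = begin
      p ↑ suc M · (p ↑ suc M) ↑ k · (t x (suc k) · r (suc k)) ⊕ x · p ↑ M · ((p ↑ suc M) ↑ k · (t x k · r k))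
        ≈⟨ R.+-cong (R.*-congʳ (R.*-congˡ (weight-suc M k))) (R.*-congˡ (R.*-congʳ (weight-suc M k))) ⟩
      p ↑ suc M · (p ↑ k · W) · (t x (suc k) · r (suc k)) ⊕ x · p ↑ M · (p ↑ k · W · (t x k · r k))
        ≈⟨ solve 8 (λ p pM pk W x t r r′ →
             p :* pM :* (pk :* W) :* (x :* pk :* t :* r′) :+ x :* pM :* (pk :* W :* (t :* r))
               := pM :* W :* (x :* pk :* t :* (r :+ p :* pk :* r′))) ≈-refl
             p (p ↑ M) (p ↑ k) W x (t x k) (r k) (r (suc k)) ⟩
      p ↑ M · W · (t x (suc k) · (r k ⊕ p ↑ suc k · r (suc k)))
        ≈⟨ R.*-congˡ (R.*-congˡ (r-step k)) ⟩
      eulerTerm M (suc k) ∎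
      where W = (p ↑ M) ↑ k

  factorˣ factorʸ : ℕ → PowerSeries
  factorˣ m = 𝟏+ (x · p ↑ m)
  factorʸ m = 𝟏+ (y · p ↑ m)

  factorˣ-multipliable : Multipliable factorˣ
  factorˣ-multipliable m = 𝟏+-cong[] (·-orderʳ (↑-order p₀ m))

  factorʸ-multipliable : Multipliable factorʸ
  factorʸ-multipliable m = 𝟏+-cong[] (·-orderʳ (↑-order p₀ m))

  euler : ∑∞ (λ k → t x k · r k) ≈ ∏∞ factorˣ · r 0
  euler = ⟶-unique (⟶-const _) (⟶-resp (≈-sym ∘ finite) (⟶-· (∏∞-⟶ factorˣ-multipliable) limit))
    where
    open ≈-Reasoning
    finite : ∀ M → ∑∞ (λ k → t x k · r k) ≈ ∏< M factorˣ · ∑∞ (eulerTerm M)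
    finite zero    = ≈-trans (∑∞-cong λ k → ≈-sym (≈-trans (R.*-congʳ (1↑ k)) (R.*-identityˡ _))) (≈-sym (R.*-identityˡ _))
      where
      1↑ : ∀ k → ⟨ 1ℤ ⟩ ↑ k ≈ ⟨ 1ℤ ⟩
      1↑ zero    = ≈-refl
      1↑ (suc k) = ≈-trans (R.*-identityˡ _) (1↑ k)
    finite (suc M) = begin
      ∑∞ (λ k → t x k · r k)                                 ≈⟨ finite M ⟩
      ∏< M factorˣ · ∑∞ (eulerTerm M)                        ≈⟨ R.*-congˡ (euler-step M) ⟨
      ∏< M factorˣ · (factorˣ M · ∑∞ (eulerTerm (suc M)))    ≈⟨ solve 3 (λ a b c → a :* (b :* c)
             := b :* a :* c) ≈-refl _ _ _ ⟩
      ∏< (suc M) factorˣ · ∑∞ (eulerTerm (suc M))            ∎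
    -- Every term of positive index contains p^M, hence vanishes modulo q^M, and only the term of
    -- index 0 is left.
    limit : (λ M → ∑∞ (eulerTerm M)) ⟶ r 0
    limit M = ≈[]-trans (≈⇒≈[] (∑∞-shift (eulerTerm-summable M)))
      (≈[]-trans (⊕-cong[] {eulerTerm M 0} ≈[]-refl (∑∞-cong[] {h′ = λ _ → ⟨ 0ℤ ⟩} λ k →
          ≈[]-weaken (ℕ.m≤m+n M 0) (·-order M (≈[]-weaken (ℕ.m≤m+n M 0) (·-order M (↑-order p₀ M) ≈[0])) ≈[0])))
        (≈⇒≈[] (≈-trans (R.+-congˡ zeros) (solve 1 (λ a → con 1ℤ :* (con 1ℤ :* a) :+ con 0ℤ := a) ≈-refl (r 0)))))
      where
      zeros : ∑∞ (λ _ → ⟨ 0ℤ ⟩) ≈ ⟨ 0ℤ ⟩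
      zeros = lim-cong {t = λ _ → ⟨ 0ℤ ⟩} go
        where
        go : ∀ N → ∑< N (λ _ → ⟨ 0ℤ ⟩) ≈ ⟨ 0ℤ ⟩
        go zero    = ≈-refl
        go (suc N) = ≈-trans (R.+-identityʳ _) (go N)

  -- The sum of T_{k-N} ρ_k over k ≥ 0, where T_n is the term of theta x y of
  -- index n.
  S : ℕ → (ℕ → PowerSeries) → PowerSeries
  S zero    ρ = ∑∞ (λ k → t x k · ρ k)
  S (suc N) ρ = t y (suc N) · ρ 0 ⊕ S N (ρ ∘ suc)

  S₀-summable : ∀ (ρ : ℕ → PowerSeries) → Summable (λ k → t x k · ρ k)
  S₀-summable ρ k = ≈[]-weaken (ℕ.m≤m+n k 0) (·-order k (thetaTerm-order x₀ k) ≈[0])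

  -- For c = 0 the right side is S (N + 1) ρ, so one more factor 1 + y p^N extends the sum by one
  -- negative index: x y = p lets neighbouring terms combine through the recursion of the weights.
  -- The offset `c` is forced by the induction, in which `S` recurses into the shifted weights
  -- `ρ ∘ suc`.
  S-step : ∀ N c (ρ : ℕ → PowerSeries) → (∀ k → ρ k ⊕ p ↑ suc (k + c) · ρ (suc k) ≈ ρ (suc k)) →
           𝟏+ (y · p ↑ (N + c)) · S N ρ ≈ p ↑ c · t y (suc N) · ρ 0 ⊕ S N (ρ ∘ suc)
  S-step zero c ρ ρ-step = begin
    𝟏+ (y · p ↑ c) · ∑∞ (λ k → t x k · ρ k)
      ≈⟨ solve 2 (λ a b → (con 1ℤ :+ a) :* b := b :+ a :* b) ≈-refl (y · p ↑ c) (∑∞ (λ k → t x k · ρ k)) ⟩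
    ∑∞ (λ k → t x k · ρ k) ⊕ y · p ↑ c · ∑∞ (λ k → t x k · ρ k)
      ≈⟨ R.+-congˡ (R.*-congˡ (∑∞-shift (S₀-summable ρ))) ⟩
    ∑∞ (λ k → t x k · ρ k) ⊕ y · p ↑ c · (⟨ 1ℤ ⟩ · ρ 0 ⊕ ∑∞ (λ k → t x (suc k) · ρ (suc k)))
      ≈⟨ solve 5 (λ a y pc r b → a :+ y :* pc :* (con 1ℤ :* r :+ b)
                    := pc :* (y :* con 1ℤ :* con 1ℤ) :* r :+ (a :+ y :* pc :* b)) ≈-refl _ y (p ↑ c) (ρ 0) _ ⟩
    p ↑ c · t y 1 · ρ 0 ⊕ (∑∞ (λ k → t x k · ρ k) ⊕ y · p ↑ c · ∑∞ (λ k → t x (suc k) · ρ (suc k)))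
      ≈⟨ R.+-congˡ (R.+-congˡ (∑∞-· (y · p ↑ c) (Summable-suc (S₀-summable ρ)))) ⟨
    p ↑ c · t y 1 · ρ 0 ⊕ (∑∞ (λ k → t x k · ρ k) ⊕ ∑∞ (λ k → y · p ↑ c · (t x (suc k) · ρ (suc k))))
      ≈⟨ R.+-congˡ (≈-trans (≈-sym (∑∞-⊕ _ _)) (∑∞-cong termwise)) ⟩
    p ↑ c · t y 1 · ρ 0 ⊕ ∑∞ (λ k → t x k · ρ (suc k)) ∎
    where
    open ≈-Reasoning
    termwise : ∀ k → t x k · ρ k ⊕ y · p ↑ c · (t x (suc k) · ρ (suc k)) ≈ t x k · ρ (suc k)
    termwise k = begin
      t x k · ρ k ⊕ y · p ↑ c · (x · p ↑ k · t x k · ρ (suc k))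
        ≈⟨ solve 7 (λ t r y pc x pk r′ → t :* r :+ y :* pc :* (x :* pk :* t :* r′)
                      := t :* (r :+ x :* y :* (pk :* pc) :* r′)) ≈-refl
             (t x k) (ρ k) y (p ↑ c) x (p ↑ k) (ρ (suc k)) ⟩
      t x k · (ρ k ⊕ p · (p ↑ k · p ↑ c) · ρ (suc k))
        ≈⟨ R.*-congˡ (R.+-congˡ (R.*-congʳ (R.*-congˡ (↑-homo-· p k c)))) ⟨
      t x k · (ρ k ⊕ p ↑ suc (k + c) · ρ (suc k))
        ≈⟨ R.*-congˡ (ρ-step k) ⟩
      t x k · ρ (suc k) ∎
  S-step (suc N) c ρ ρ-step = begin
    𝟏+ (y · p ↑ suc (N + c)) · (t y (suc N) · ρ 0 ⊕ S N (ρ ∘ suc))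
      ≈⟨ R.distribˡ _ _ _ ⟩
    𝟏+ (y · p ↑ suc (N + c)) · (t y (suc N) · ρ 0) ⊕ 𝟏+ (y · p ↑ suc (N + c)) · S N (ρ ∘ suc)
      ≈⟨ R.+-cong (R.*-congʳ (𝟏+-cong (R.*-congˡ (R.*-congˡ (↑-homo-· p N c)))))
           (≈-trans (R.*-congʳ (𝟏+-cong (R.*-congˡ (R.reflexive (cong (p ↑_) (sym (ℕ.+-suc N c)))))))
             (S-step N (suc c) (ρ ∘ suc) λ k → ≈-trans (R.+-congˡ (R.*-congʳ
               (R.reflexive (cong (λ i → p ↑ suc i) (ℕ.+-suc k c))))) (ρ-step (suc k)))) ⟩
    𝟏+ (y · (p · (p ↑ N · p ↑ c))) · (t y (suc N) · ρ 0) ⊕ (p ↑ suc c · t y (suc N) · ρ 1 ⊕ S N (ρ ∘ suc ∘ suc))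
      ≈⟨ solve 8 (λ y p pN pc t r r′ s → (con 1ℤ :+ y :* (p :* (pN :* pc))) :* (t :* r) :+ (p :* pc :* t :* r′ :+ s)
                    := pc :* (y :* (p :* pN) :* t) :* r :+ (t :* (r :+ p :* pc :* r′) :+ s)) ≈-refl
           y p (p ↑ N) (p ↑ c) (t y (suc N)) (ρ 0) (ρ 1) (S N (ρ ∘ suc ∘ suc)) ⟩
    p ↑ c · t y (2 + N) · ρ 0 ⊕ (t y (suc N) · (ρ 0 ⊕ p ↑ suc c · ρ 1) ⊕ S N (ρ ∘ suc ∘ suc))
      ≈⟨ R.+-congˡ (R.+-congʳ (R.*-congˡ (ρ-step 0))) ⟩
    p ↑ c · t y (2 + N) · ρ 0 ⊕ S (suc N) (ρ ∘ suc) ∎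
    where open ≈-Reasoning

  S-product : ∀ N → S N r ≈ ∏< N factorʸ · (∏∞ factorˣ · r 0)
  S-product zero    = ≈-trans euler (≈-sym (R.*-identityˡ _))
  S-product (suc N) = begin
    t y (suc N) · r 0 ⊕ S N (r ∘ suc)
      ≈⟨ R.+-congʳ (R.*-congʳ (R.*-identityˡ _)) ⟨
    p ↑ 0 · t y (suc N) · r 0 ⊕ S N (r ∘ suc)
      ≈⟨ S-step N 0 r (λ k → ≈-trans (R.+-congˡ (R.*-congʳ (R.reflexive (cong (λ i → p ↑ suc i) (ℕ.+-identityʳ k))))) (r-step k)) ⟨
    𝟏+ (y · p ↑ (N + 0)) · S N r
      ≈⟨ R.*-cong (𝟏+-cong (R.*-congˡ (R.reflexive (cong (p ↑_) (ℕ.+-identityʳ N))))) (S-product N) ⟩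
    factorʸ N · (∏< N factorʸ · (∏∞ factorˣ · r 0))
      ≈⟨ R.*-assoc _ _ _ ⟨
    ∏< (suc N) factorʸ · (∏∞ factorˣ · r 0) ∎
    where open ≈-Reasoning

  -- The weight of the term of index -N is only known to be 1 modulo q^c; the missing N orders come
  -- from the term itself, which is divisible by q^N.
  S-limit : ∀ N c ρ → (∀ k → ρ k ≈[ k + c ] ⟨ 1ℤ ⟩) → S N ρ ≈[ N + c ] ∑∞ (t x) ⊕ ∑< N (t y ∘ suc)
  S-limit zero c ρ ρ≈1 = ≈[]-trans
    (∑∞-cong[] {h′ = t x} λ k → ≈[]-trans (·-cong[] {t x k} ≈[]-refl (≈[]-weaken (ℕ.m≤n+m c k) (ρ≈1 k))) (≈⇒≈[] (R.*-identityʳ _)))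
    (≈⇒≈[] (≈-sym (R.+-identityʳ _)))
  S-limit (suc N) c ρ ρ≈1 = ≈[]-trans
    (⊕-cong[] (≈[]-trans (·-congʳ-order (suc N) (thetaTerm-order y₀ (suc N)) (ρ≈1 0)) (≈⇒≈[] (R.*-identityʳ _)))
              (subst (λ i → S N (ρ ∘ suc) ≈[ i ] ∑∞ (t x) ⊕ ∑< N (t y ∘ suc)) (ℕ.+-suc N c)
                (S-limit N (suc c) (ρ ∘ suc) λ k → subst (λ i → ρ (suc k) ≈[ i ] ⟨ 1ℤ ⟩) (sym (ℕ.+-suc k c)) (ρ≈1 (suc k)))))
    (≈⇒≈[] (solve 3 (λ a b c → a :+ (b :+ c) := b :+ (c :+ a)) ≈-refl _ _ _))

  tripleProduct : theta x y ≈ ∏∞ (λ m → 𝟏- (p ↑ suc m)) · ∏∞ factorˣ · ∏∞ factorʸ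
  tripleProduct = begin
    theta x y
      ≈⟨ ⟶-unique sums (⟶-resp (≈-sym ∘ S-product) (⟶-· (∏∞-⟶ factorʸ-multipliable) (⟶-const _))) ⟩
    ∏∞ factorʸ · (∏∞ factorˣ · r 0)
      ≈⟨ solve 3 (λ a b c → a :* (b :* c) := c :* b :* a) ≈-refl _ _ _ ⟩
    r 0 · ∏∞ factorˣ · ∏∞ factorʸ
      ≈⟨ R.*-congʳ (R.*-congʳ (∏∞-cong λ m → R.reflexive (cong (λ i → 𝟏- (p ↑ suc i)) (ℕ.+-identityʳ m)))) ⟩
    ∏∞ (λ m → 𝟏- (p ↑ suc m)) · ∏∞ factorˣ · ∏∞ factorʸ ∎
    where
    open ≈-Reasoning
    sums : (λ N → S N r) ⟶ theta x y
    sums N = ≈[]-trans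
      (≈[]-weaken (ℕ.m≤m+n N 0) (S-limit N 0 r λ k → subst (λ i → r k ≈[ i ] ⟨ 1ℤ ⟩) (sym (ℕ.+-identityʳ k)) (r-order k)))
      (⊕-cong[] {∑∞ (t x)} ≈[]-refl (∑∞-⟶ (Summable-suc (thetaTerm-order y₀)) N))

open TripleProduct using (tripleProduct)

-- Theta functions of signed powers of q

mono : ℤ → ℕ → PowerSeries
mono c e = ⟨ c ⟩ · q^ e

mono-cong : ∀ {c d e g} → c ≡ d → e ≡ g → mono c e ≈ mono d g
mono-cong refl refl = ≈-refl

mono-· : ∀ c d e g → mono c e · mono d g ≈ mono (c ℤ.* d) (e + g)
mono-· c d e g = begin
  ⟨ c ⟩ · q^ e · (⟨ d ⟩ · q^ g)     ≈⟨ solve 4 (λ a b c d → a :* b :* (c :* d) := a :* c :* (b :* d)) ≈-refl _ _ _ _ ⟩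
  ⟨ c ⟩ · ⟨ d ⟩ · (q^ e · q^ g)     ≈⟨ R.*-cong (⟨⟩-* c d) (q^-+ e g) ⟨
  mono (c ℤ.* d) (e + g)            ∎
  where open ≈-Reasoning

mono-1 : ∀ e → mono 1ℤ e ≈ q^ e
mono-1 e = R.*-identityˡ (q^ e)

mono-order : ∀ c e → mono c e ≈[ e ] ⟨ 0ℤ ⟩
mono-order c e = ·-orderʳ (q^-order e)

θ-mono : ∀ j c e → θ (suc j) (mono c e) ≈ mono c (e * suc j)
θ-mono j c e = ≈-trans (θ-scale (suc j) c (q^ e)) (R.*-congˡ (θ-q^ j e))

-- The binomial coefficient k(k-1)/2, not the k-th triangular number k(k+1)/2.
triangle : ℕ → ℕ
triangle zero    = 0
triangle (suc k) = k + triangle k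

↑-congˡ : ∀ {F G} k → F ≈ G → F ↑ k ≈ G ↑ k
↑-congˡ zero    p = ≈-refl
↑-congˡ (suc k) p = R.*-cong p (↑-congˡ k p)

thetaTerm-mono : ∀ {p} σ a s → p ≈ q^ s → ∀ k →
                 thetaTerm p (mono σ a) k ≈ mono (σ ℤ.^ k) (k * a + triangle k * s)
thetaTerm-mono σ a s p≈ zero    = ≈-sym (≈-trans (mono-1 0) q^0≈1)
thetaTerm-mono {p} σ a s p≈ (suc k) = begin
  mono σ a · p ↑ k · thetaTerm p (mono σ a) k
    ≈⟨ R.*-cong (R.*-congˡ (≈-trans (↑-congˡ k p≈) (≈-trans (q^-↑ s k) (≈-sym (mono-1 (k * s)))))) (thetaTerm-mono σ a s p≈ k) ⟩
  mono σ a · mono 1ℤ (k * s) · mono (σ ℤ.^ k) (k * a + triangle k * s)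
    ≈⟨ ≈-trans (R.*-congʳ (mono-· σ 1ℤ a (k * s))) (mono-· (σ ℤ.* 1ℤ) (σ ℤ.^ k) (a + k * s) _) ⟩
  mono (σ ℤ.* 1ℤ ℤ.* σ ℤ.^ k) (a + k * s + (k * a + triangle k * s))
    ≈⟨ mono-cong (cong (ℤ._* σ ℤ.^ k) (ℤ.*-identityʳ σ)) (exponents a k s (triangle k)) ⟩
  mono (σ ℤ.^ suc k) (suc k * a + triangle (suc k) * s) ∎
  where
  open ≈-Reasoning
  exponents : ∀ a k s t → a + k * s + (k * a + t * s) ≡ suc k * a + (k + t) * s
  exponents = ℕ-Tactic.solve-∀

ϑ : ℤ → ℕ → ℕ → PowerSeries
ϑ σ a b = theta (mono σ a) (mono σ b)

ϑ-term : ℤ → ℕ → ℕ → ℕ → PowerSeries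
ϑ-term σ a s k = mono (σ ℤ.^ k) (k * a + triangle k * s)

mono²≈ : ∀ σ a b → σ ℤ.* σ ≡ 1ℤ → mono σ a · mono σ b ≈ q^ (a + b)
mono²≈ σ a b σ²≡1 = ≈-trans (mono-· σ σ a b) (≈-trans (mono-cong {e = a + b} σ²≡1 refl) (mono-1 (a + b)))

ϑ-series : ∀ σ a b → σ ℤ.* σ ≡ 1ℤ →
           ϑ σ a b ≈ ∑∞ (ϑ-term σ a (a + b)) ⊕ ∑∞ (λ k → ϑ-term σ b (a + b) (suc k))
ϑ-series σ a b σ²≡1 = R.+-cong (∑∞-cong (thetaTerm-mono σ a (a + b) p≈)) (∑∞-cong (thetaTerm-mono σ b (a + b) p≈ ∘ suc))
  where p≈ = mono²≈ σ a b σ²≡1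

ϑ-term-summable : ∀ σ a s → Summable (ϑ-term σ (suc a) s)
ϑ-term-summable σ a s k = ≈[]-weaken (ℕ.≤-trans (ℕ.m≤m*n k (suc a)) (ℕ.m≤m+n (k * suc a) (triangle k * s))) (mono-order (σ ℤ.^ k) (k * suc a + triangle k * s))

θ-ϑ : ∀ j σ a b → σ ℤ.* σ ≡ 1ℤ → θ (suc j) (ϑ σ (suc a) (suc b)) ≈
      ∑∞ (λ k → mono (σ ℤ.^ k) ((k * suc a + triangle k * (suc a + suc b)) * suc j)) ⊕
      ∑∞ (λ k → mono (σ ℤ.^ suc k) ((suc k * suc b + triangle (suc k) * (suc a + suc b)) * suc j))
θ-ϑ j σ a b σ²≡1 = begin
  θ (suc j) (ϑ σ (suc a) (suc b))
    ≈⟨ ≈-trans (θ-cong (suc j) (ϑ-series σ (suc a) (suc b) σ²≡1)) (θ-⊕ (suc j) _ _) ⟩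
  θ (suc j) (∑∞ (ϑ-term σ (suc a) s)) ⊕ θ (suc j) (∑∞ (λ k → ϑ-term σ (suc b) s (suc k)))
    ≈⟨ R.+-cong (θ-∑∞ (suc j) (ϑ-term-summable σ a s)) (θ-∑∞ (suc j) (Summable-suc (ϑ-term-summable σ b s))) ⟩
  ∑∞ (λ k → θ (suc j) (ϑ-term σ (suc a) s k)) ⊕ ∑∞ (λ k → θ (suc j) (ϑ-term σ (suc b) s (suc k)))
    ≈⟨ R.+-cong (∑∞-cong λ k → θ-mono j (σ ℤ.^ k) (k * suc a + triangle k * s))
         (∑∞-cong λ k → θ-mono j (σ ℤ.^ suc k) (suc k * suc b + triangle (suc k) * s)) ⟩
  ∑∞ (λ k → mono (σ ℤ.^ k) ((k * suc a + triangle k * s) * suc j)) ⊕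
  ∑∞ (λ k → mono (σ ℤ.^ suc k) ((suc k * suc b + triangle (suc k) * s) * suc j)) ∎
  where
  open ≈-Reasoning
  s = suc a + suc b

-- Products over arithmetic progressions

∏[1-q^_+ℕ·_] ∏[1+q^_+ℕ·_] : ℕ → ℕ → PowerSeries
∏[1-q^ a +ℕ· s ] = ∏∞ (λ m → 𝟏- q^ (a + m * s))
∏[1+q^ a +ℕ· s ] = ∏∞ (λ m → 𝟏+ q^ (a + m * s))

∏-factor-multipliable : ∀ a s → Multipliable (λ m → 𝟏- q^ (a + m * suc s))
∏-factor-multipliable a s m = 𝟏--cong[] (≈[]-weaken (ℕ.≤-trans (ℕ.m≤m*n m (suc s)) (ℕ.m≤n+m _ a)) (q^-order (a + m * suc s)))

∏+factor-multipliable : ∀ a s → Multipliable (λ m → 𝟏+ q^ (a + m * suc s))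
∏+factor-multipliable a s m = 𝟏+-cong[] (≈[]-weaken (ℕ.≤-trans (ℕ.m≤m*n m (suc s)) (ℕ.m≤n+m _ a)) (q^-order (a + m * suc s)))

∏[1-q^]-constant : ∀ a s → ∏[1-q^ suc a +ℕ· suc s ] 0 ≡ 1ℤ
∏[1-q^]-constant a s = coeff[] (∏∞-cong[] λ m → 𝟏--cong[] (≈[]-weaken (s≤s z≤n) (q^-order (suc a + m * suc s)))) 0 (s≤s z≤n)

∏[1-q^]-split : ∀ a s → ∏[1-q^ a +ℕ· suc s ] ≈ ∏[1-q^ a +ℕ· (suc s + suc s) ] · ∏[1-q^ a + suc s +ℕ· (suc s + suc s) ]
∏[1-q^]-split a s = begin
  ∏[1-q^ a +ℕ· suc s ]
    ≈⟨ ∏∞-split₂ (∏-factor-multipliable a s) ⟩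
  ∏∞ (λ m → 𝟏- q^ (a + m * 2 * suc s) · 𝟏- q^ (a + (1 + m * 2) * suc s))
    ≈⟨ ∏∞-cong (λ m → R.*-cong (𝟏--cong (q^-cong (even a m (suc s)))) (𝟏--cong (q^-cong (odd a m (suc s))))) ⟩
  ∏∞ (λ m → 𝟏- q^ (a + m * (suc s + suc s)) · 𝟏- q^ (a + suc s + m * (suc s + suc s)))
    ≈⟨ ∏∞-· (∏-factor-multipliable a _) (∏-factor-multipliable (a + suc s) _) ⟩
  ∏[1-q^ a +ℕ· (suc s + suc s) ] · ∏[1-q^ a + suc s +ℕ· (suc s + suc s) ] ∎
  where
  open ≈-Reasoning
  even : ∀ a m s → a + m * 2 * s ≡ a + m * (s + s)
  even = ℕ-Tactic.solve-∀
  odd : ∀ a m s → a + (1 + m * 2) * s ≡ a + s + m * (s + s)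
  odd = ℕ-Tactic.solve-∀

∏[1+q^]·∏[1-q^] : ∀ a s → ∏[1+q^ a +ℕ· suc s ] · ∏[1-q^ a +ℕ· suc s ] ≈ ∏[1-q^ a + a +ℕ· (suc s + suc s) ]
∏[1+q^]·∏[1-q^] a s = ≈-trans (≈-sym (∏∞-· (∏+factor-multipliable a s) (∏-factor-multipliable a s))) (∏∞-cong λ m → begin
  𝟏+ q^ (a + m * suc s) · 𝟏- q^ (a + m * suc s)
    ≈⟨ solve 1 (λ x → (con 1ℤ :+ x) :* (con 1ℤ :- x) := con 1ℤ :- x :* x) ≈-refl (q^ (a + m * suc s)) ⟩
  𝟏- (q^ (a + m * suc s) · q^ (a + m * suc s))
    ≈⟨ 𝟏--cong (≈-sym (q^-+ (a + m * suc s) (a + m * suc s))) ⟩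
  𝟏- q^ (a + m * suc s + (a + m * suc s))
    ≈⟨ 𝟏--cong (q^-cong (double a m (suc s))) ⟩
  𝟏- q^ (a + a + m * (suc s + suc s)) ∎)
  where
  open ≈-Reasoning
  double : ∀ a m s → a + m * s + (a + m * s) ≡ a + a + m * (s + s)
  double = ℕ-Tactic.solve-∀

θ-∏[1-q^] : ∀ j a s → θ (suc j) ∏[1-q^ a +ℕ· suc s ] ≈ ∏[1-q^ a * suc j +ℕ· suc s * suc j ]
θ-∏[1-q^] j a s = ≈-trans (θ-∏∞ j (∏-factor-multipliable a s)) (∏∞-cong λ m → begin
  θ (suc j) (𝟏- q^ (a + m * suc s))
    ≈⟨ ≈-trans (θ-⊕ (suc j) _ _) (R.+-cong (θ-⟨⟩ (suc j) 1ℤ) (θ-⊝ (suc j) (q^ (a + m * suc s)))) ⟩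
  𝟏- θ (suc j) (q^ (a + m * suc s))
    ≈⟨ 𝟏--cong (≈-trans (θ-q^ j (a + m * suc s)) (q^-cong (scale a m (suc s) (suc j)))) ⟩
  𝟏- q^ (a * suc j + m * (suc s * suc j)) ∎)
  where
  open ≈-Reasoning
  scale : ∀ a m s j → (a + m * s) * j ≡ a * j + m * (s * j)
  scale = ℕ-Tactic.solve-∀

private
  theta-product : ∀ σ a b → σ ℤ.* σ ≡ 1ℤ → ϑ σ (suc a) (suc b) ≈
                  ∏[1-q^ suc a + suc b +ℕ· (suc a + suc b) ] ·
                  ∏∞ (λ m → 𝟏+ (⟨ σ ⟩ · q^ (suc a + m * (suc a + suc b)))) ·
                  ∏∞ (λ m → 𝟏+ (⟨ σ ⟩ · q^ (suc b + m * (suc a + suc b))))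
  theta-product σ a b σ²≡1 = ≈-trans
    (tripleProduct (mono σ (suc a)) (mono σ (suc b)) (order a) (order b))
    (R.*-cong (R.*-cong (∏∞-cong λ m → 𝟏--cong (p↑ (suc m))) (∏∞-cong (factor (suc a)))) (∏∞-cong (factor (suc b))))
    where
    order : ∀ a → mono σ (suc a) ≈[ 1 ] ⟨ 0ℤ ⟩
    order a = ≈[]-weaken (s≤s z≤n) (mono-order σ (suc a))
    p↑ : ∀ k → (mono σ (suc a) · mono σ (suc b)) ↑ k ≈ q^ (k * (suc a + suc b))
    p↑ k = ≈-trans (↑-congˡ k (mono²≈ σ (suc a) (suc b) σ²≡1)) (q^-↑ (suc a + suc b) k)
    factor : ∀ e m → 𝟏+ (mono σ e · (mono σ (suc a) · mono σ (suc b)) ↑ m) ≈ 𝟏+ (⟨ σ ⟩ · q^ (e + m * (suc a + suc b)))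
    factor e m = 𝟏+-cong (≈-trans (R.*-congˡ (p↑ m)) (≈-trans (R.*-assoc _ _ _) (R.*-congˡ (≈-sym (q^-+ e (m * (suc a + suc b)))))))

ϑ₊-product : ∀ a b → ϑ 1ℤ (suc a) (suc b) ≈
             ∏[1-q^ suc a + suc b +ℕ· (suc a + suc b) ] · ∏[1+q^ suc a +ℕ· (suc a + suc b) ] · ∏[1+q^ suc b +ℕ· (suc a + suc b) ]
ϑ₊-product a b = ≈-trans (theta-product 1ℤ a b refl)
  (R.*-cong (R.*-congˡ (∏∞-cong (factor (suc a)))) (∏∞-cong (factor (suc b))))
  where
  factor : ∀ e m → 𝟏+ mono 1ℤ (e + m * (suc a + suc b)) ≈ 𝟏+ q^ (e + m * (suc a + suc b))
  factor e m = 𝟏+-cong (mono-1 (e + m * (suc a + suc b)))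

ϑ₋-product : ∀ a b → ϑ (ℤ.- 1ℤ) (suc a) (suc b) ≈
             ∏[1-q^ suc a + suc b +ℕ· (suc a + suc b) ] · ∏[1-q^ suc a +ℕ· (suc a + suc b) ] · ∏[1-q^ suc b +ℕ· (suc a + suc b) ]
ϑ₋-product a b = ≈-trans (theta-product (ℤ.- 1ℤ) a b refl)
  (R.*-cong (R.*-congˡ (∏∞-cong (factor (suc a)))) (∏∞-cong (factor (suc b))))
  where
  factor : ∀ e m → 𝟏+ mono (ℤ.- 1ℤ) (e + m * (suc a + suc b)) ≈ 𝟏- q^ (e + m * (suc a + suc b))
  factor e m = 𝟏+-cong (solve 1 (λ x → con (ℤ.- 1ℤ) :* x := :- x) ≈-refl (q^ (e + m * (suc a + suc b))))

-- f₁f₂ and f₃f₆ as products of theta functions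

partialProduct-⟶ : ∀ k → partialProduct (suc k) ⟶ f (suc k)
partialProduct-⟶ k N = mk≈[] λ n n<N → f-limit (suc k) N n (ℕ.<⇒≤ n<N)

partialProduct-suc : ∀ k N → partialProduct k (suc N) ≈ 𝟏- q^ (k * suc N) · partialProduct k N
partialProduct-suc k N = ≈-trans (mk≈ λ n → sym (·-⊛ _ _ n)) (R.*-congʳ (mk≈ λ n →
  sym (trans (⊕-coeff _ _ n) (cong₂ ℤ._+_ (sym (coeff q^0≈1 n)) (⊝-coeff _ n)))))

f≈∏ : ∀ k → f (suc k) ≈ ∏[1-q^ suc k +ℕ· suc k ]
f≈∏ k = ⟶-unique′ go (partialProduct-⟶ k) (∏∞-⟶ (∏-factor-multipliable (suc k) k))
  where
  go : ∀ N → partialProduct (suc k) N ≈ ∏< N (λ m → 𝟏- q^ (suc k + m * suc k))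
  go zero    = q^0≈1
  go (suc N) = ≈-trans (partialProduct-suc (suc k) N)
    (R.*-cong (𝟏--cong (q^-cong (ℕ.*-comm (suc k) (suc N)))) (go N))

θ-f : ∀ j k → θ (suc j) (f (suc k)) ≈ f (suc k * suc j)
θ-f j k = ≈-trans (θ-cong (suc j) (f≈∏ k)) (≈-trans (θ-∏[1-q^] j (suc k) k) (≈-sym (f≈∏ _)))

-- In classical terms `φ` is Ramanujan's φ(-q) = f₁²/f₂ and `ψ` is ψ(q) = f₂²/f₁, while `Ω` =
-- f₁f₆²/(f₂f₃) and `Ψ` = f₂f₃²/(f₁f₆) are the functions that appear in their 3-dissections.
φ ψ Ω Ψ : PowerSeries
φ = ϑ (ℤ.- 1ℤ) 1 1
ψ = ϑ 1ℤ 3 1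
Ω = ϑ (ℤ.- 1ℤ) 5 1
Ψ = ϑ 1ℤ 2 1

-- Instead of multiplying quotients, the exponents are sorted by residue classes: the factors 1 +
-- q^m with m odd pair with 1 - q^m into factors 1 - q^(2m), which restore the missing class 2
-- modulo 4.
φψ≈f₁f₂ : φ · ψ ≈ f 1 · f 2
φψ≈f₁f₂ = begin
  φ · ψ
    ≈⟨ R.*-cong (ϑ₋-product 0 0) (ϑ₊-product 2 0) ⟩
  L 2 2 · L 1 2 · L 1 2 · (L 4 4 · K 3 4 · K 1 4)
    ≈⟨ R.*-congʳ (R.*-congˡ (∏[1-q^]-split 1 1)) ⟩
  L 2 2 · L 1 2 · (L 1 4 · L 3 4) · (L 4 4 · K 3 4 · K 1 4)
    ≈⟨ solve 7 (λ a b c d e f g → a :* b :* (c :* d) :* (e :* f :* g)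
           := b :* a :* (g :* c :* (f :* d) :* e)) ≈-refl _ _ _ _ _ _ _ ⟩
  L 1 2 · L 2 2 · (K 1 4 · L 1 4 · (K 3 4 · L 3 4) · L 4 4)
    ≈⟨ R.*-congˡ (R.*-congʳ (R.*-cong (∏[1+q^]·∏[1-q^] 1 3) (∏[1+q^]·∏[1-q^] 3 3))) ⟩
  L 1 2 · L 2 2 · (L 2 8 · L 6 8 · L 4 4)
    ≈⟨ R.*-congˡ (R.*-congʳ (∏[1-q^]-split 2 3)) ⟨
  L 1 2 · L 2 2 · (L 2 4 · L 4 4)
    ≈⟨ R.*-cong (≈-trans (f≈∏ 0) (∏[1-q^]-split 1 0)) (≈-trans (f≈∏ 1) (∏[1-q^]-split 2 1)) ⟨
  f 1 · f 2 ∎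
  where
  open ≈-Reasoning
  L K : ℕ → ℕ → PowerSeries
  L a s = ∏[1-q^ a +ℕ· s ]
  K a s = ∏[1+q^ a +ℕ· s ]

-- The inserted factors complete the classes 1 and 5 modulo 6 of `Ω` to the classes 1 and 2 modulo
-- 3. Pairing these with the factors 1 + q^m of `Ψ` reproduces the inserted factors, which then
-- cancel.
ΩΨ≈f₃f₆ : Ω · Ψ ≈ f 3 · f 6
ΩΨ≈f₃f₆ = ·-cancelˡ (L 2 6 · L 4 6)
  (trans (·-zero (L 2 6) (L 4 6)) (cong₂ ℤ._*_ (∏[1-q^]-constant 1 5) (∏[1-q^]-constant 3 5))) (begin
  L 2 6 · L 4 6 · (Ω · Ψ)
    ≈⟨ R.*-congˡ (R.*-cong (ϑ₋-product 4 0) (ϑ₊-product 1 0)) ⟩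
  L 2 6 · L 4 6 · (L 6 6 · L 5 6 · L 1 6 · (L 3 3 · K 2 3 · K 1 3))
    ≈⟨ solve 8 (λ a b c d e f g h → a :* b :* (c :* d :* e :* (f :* g :* h))
           := h :* (e :* b) :* (g :* (a :* d)) :* (f :* c)) ≈-refl _ _ _ _ _ _ _ _ ⟩
  K 1 3 · (L 1 6 · L 4 6) · (K 2 3 · (L 2 6 · L 5 6)) · (L 3 3 · L 6 6)
    ≈⟨ R.*-congʳ (R.*-cong (R.*-congˡ (∏[1-q^]-split 1 2)) (R.*-congˡ (∏[1-q^]-split 2 2))) ⟨
  K 1 3 · L 1 3 · (K 2 3 · L 2 3) · (L 3 3 · L 6 6)
    ≈⟨ R.*-cong (R.*-cong (∏[1+q^]·∏[1-q^] 1 2) (∏[1+q^]·∏[1-q^] 2 2)) (≈-sym (R.*-cong (f≈∏ 2) (f≈∏ 5))) ⟩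
  L 2 6 · L 4 6 · (f 3 · f 6) ∎)
  where
  open ≈-Reasoning
  L K : ℕ → ℕ → PowerSeries
  L a s = ∏[1-q^ a +ℕ· s ]
  K a s = ∏[1+q^ a +ℕ· s ]

-- The 3-dissection of f₁ f₂

mono·θ-ϑ : ∀ d e j σ a b → σ ℤ.* σ ≡ 1ℤ → mono d e · θ (suc j) (ϑ σ (suc a) (suc b)) ≈
           ∑∞ (λ k → mono (d ℤ.* σ ℤ.^ k) (e + (k * suc a + triangle k * (suc a + suc b)) * suc j)) ⊕
           ∑∞ (λ k → mono (d ℤ.* σ ℤ.^ suc k) (e + (suc k * suc b + triangle (suc k) * (suc a + suc b)) * suc j))
mono·θ-ϑ d e j σ a b σ²≡1 = begin
  mono d e · θ (suc j) (ϑ σ (suc a) (suc b))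
    ≈⟨ R.*-congˡ (θ-ϑ j σ a b σ²≡1) ⟩
  mono d e · (∑∞ (term a) ⊕ ∑∞ (term b ∘ suc))
    ≈⟨ R.distribˡ _ _ _ ⟩
  mono d e · ∑∞ (term a) ⊕ mono d e · ∑∞ (term b ∘ suc)
    ≈⟨ R.+-cong (∑∞-· (mono d e) (term-summable a)) (∑∞-· (mono d e) (Summable-suc (term-summable b))) ⟨
  ∑∞ (λ k → mono d e · term a k) ⊕ ∑∞ (λ k → mono d e · term b (suc k))
    ≈⟨ R.+-cong (∑∞-cong (mono·term a)) (∑∞-cong (mono·term b ∘ suc)) ⟩
  ∑∞ (λ k → mono (d ℤ.* σ ℤ.^ k) (e + exponent a k)) ⊕ ∑∞ (λ k → mono (d ℤ.* σ ℤ.^ suc k) (e + exponent b (suc k))) ∎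
  where
  open ≈-Reasoning
  exponent : ℕ → ℕ → ℕ
  exponent a′ k = (k * suc a′ + triangle k * (suc a + suc b)) * suc j
  term : ℕ → ℕ → PowerSeries
  term a′ k = mono (σ ℤ.^ k) (exponent a′ k)
  term-summable : ∀ a′ → Summable (term a′)
  term-summable a′ k = ≈[]-weaken (ℕ.≤-trans (ℕ.m≤m*n k (suc a′))
    (ℕ.≤-trans (ℕ.m≤m+n (k * suc a′) _) (ℕ.m≤m*n _ (suc j)))) (mono-order (σ ℤ.^ k) (exponent a′ k))
  mono·term : ∀ a′ k → mono d e · term a′ k ≈ mono (d ℤ.* σ ℤ.^ k) (e + exponent a′ k)
  mono·term a′ k = mono-· d (σ ℤ.^ k) e (exponent a′ k)

triangle-*2 : ∀ k → triangle (k * 2) ≡ triangle k * 4 + k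
triangle-*2 zero    = refl
triangle-*2 (suc k) = trans (cong (λ t → 1 + k * 2 + (k * 2 + t)) (triangle-*2 k)) (lemma k (triangle k))
  where
  lemma : ∀ k t → 1 + k * 2 + (k * 2 + (t * 4 + k)) ≡ (k + t) * 4 + suc k
  lemma = ℕ-Tactic.solve-∀

triangle-*3 : ∀ k → triangle (k * 3) ≡ triangle k * 9 + k * 3
triangle-*3 zero    = refl
triangle-*3 (suc k) = trans (cong (λ t → 2 + k * 3 + (1 + k * 3 + (k * 3 + t))) (triangle-*3 k)) (lemma k (triangle k))
  where
  lemma : ∀ k t → 2 + k * 3 + (1 + k * 3 + (k * 3 + (t * 9 + k * 3))) ≡ (k + t) * 9 + suc k * 3
  lemma = ℕ-Tactic.solve-∀

-1^[k*3] : ∀ k → (ℤ.- 1ℤ) ℤ.^ (k * 3) ≡ (ℤ.- 1ℤ) ℤ.^ k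
-1^[k*3] zero    = refl
-1^[k*3] (suc k) = trans (cong (λ z → ℤ.- 1ℤ ℤ.* (ℤ.- 1ℤ ℤ.* (ℤ.- 1ℤ ℤ.* z))) (-1^[k*3] k)) (lemma ((ℤ.- 1ℤ) ℤ.^ k))
  where
  lemma : ∀ z → ℤ.- 1ℤ ℤ.* (ℤ.- 1ℤ ℤ.* (ℤ.- 1ℤ ℤ.* z)) ≡ ℤ.- 1ℤ ℤ.* z
  lemma = ℤ-Tactic.solve-∀

-- In the sum of (-1)^n q^(n²) the multiples of 3 give φ(q⁹). The classes 1 and -1 modulo 3 are
-- exchanged by n ↦ -n and give the same sum, `W ⊕ X`, whence the coefficient 2.
φ-dissection : φ ≈ θ 9 φ ⊕ ⟨ ℤ.- ℤ.+ 2 ⟩ · (q^ 1 · θ 3 Ω)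
φ-dissection = begin
  φ
    ≈⟨ ϑ-series (ℤ.- 1ℤ) 1 1 refl ⟩
  ∑∞ u ⊕ ∑∞ (u ∘ suc)
    ≈⟨ R.+-cong (∑∞-split₃ u-summable) (∑∞-split₃ (Summable-suc u-summable)) ⟩
  -- The half over negative n starts at index 1, so its three classes are those of 1, 2 and 3; `Y`
  -- is `V` without its first term.
  (V ⊕ W ⊕ X) ⊕ (W ⊕ X ⊕ Y)
    ≈⟨ solve 4 (λ v w x y → v :+ w :+ x :+ (w :+ x :+ y) := v :+ y :+ con (ℤ.+ 2) :* (w :+ x)) ≈-refl V W X Y ⟩
  V ⊕ Y ⊕ ⟨ ℤ.+ 2 ⟩ · (W ⊕ X)
    ≈⟨ R.+-cong θφ (R.*-congˡ θΩ) ⟨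
  θ 9 φ ⊕ ⟨ ℤ.+ 2 ⟩ · (mono (ℤ.- 1ℤ) 1 · θ 3 Ω)
    ≈⟨ R.+-congˡ (solve 2 (λ x y → con (ℤ.+ 2) :* (con (ℤ.- 1ℤ) :* x :* y)
           := con (ℤ.- ℤ.+ 2) :* (x :* y)) ≈-refl (q^ 1) (θ 3 Ω)) ⟩
  θ 9 φ ⊕ ⟨ ℤ.- ℤ.+ 2 ⟩ · (q^ 1 · θ 3 Ω) ∎
  where
  open ≈-Reasoning
  u : ℕ → PowerSeries
  u = ϑ-term (ℤ.- 1ℤ) 1 2
  u-summable : Summable u
  u-summable = ϑ-term-summable (ℤ.- 1ℤ) 0 2
  V W X Y : PowerSeries
  V = ∑∞ (λ k → u (k * 3))
  W = ∑∞ (λ k → u (1 + k * 3))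
  X = ∑∞ (λ k → u (2 + k * 3))
  Y = ∑∞ (λ k → u (suc k * 3))
  exponent₀ : ∀ k → (k * 1 + triangle k * 2) * 9 ≡ k * 3 * 1 + triangle (k * 3) * 2
  exponent₀ k = trans (lemma k (triangle k)) (cong (λ t → k * 3 * 1 + t * 2) (sym (triangle-*3 k)))
    where
    lemma : ∀ k t → (k * 1 + t * 2) * 9 ≡ k * 3 * 1 + (t * 9 + k * 3) * 2
    lemma = ℕ-Tactic.solve-∀
  exponent₁ : ∀ k → 1 + (k * 5 + triangle k * 6) * 3 ≡ (1 + k * 3) * 1 + triangle (1 + k * 3) * 2
  exponent₁ k = trans (lemma k (triangle k)) (cong (λ t → (1 + k * 3) * 1 + (k * 3 + t) * 2) (sym (triangle-*3 k)))
    where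
    lemma : ∀ k t → 1 + (k * 5 + t * 6) * 3 ≡ (1 + k * 3) * 1 + (k * 3 + (t * 9 + k * 3)) * 2
    lemma = ℕ-Tactic.solve-∀
  exponent₂ : ∀ k → 1 + (suc k * 1 + triangle (suc k) * 6) * 3 ≡ (2 + k * 3) * 1 + triangle (2 + k * 3) * 2
  exponent₂ k = trans (lemma k (triangle k)) (cong (λ t → (2 + k * 3) * 1 + (1 + k * 3 + (k * 3 + t)) * 2) (sym (triangle-*3 k)))
    where
    lemma : ∀ k t → 1 + (suc k * 1 + (k + t) * 6) * 3 ≡ (2 + k * 3) * 1 + (1 + k * 3 + (k * 3 + (t * 9 + k * 3))) * 2
    lemma = ℕ-Tactic.solve-∀
  θφ : θ 9 φ ≈ V ⊕ Y
  θφ = ≈-trans (θ-ϑ 8 (ℤ.- 1ℤ) 0 0 refl) (R.+-cong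
    (∑∞-cong λ k → mono-cong (sym (-1^[k*3] k)) (exponent₀ k))
    (∑∞-cong λ k → mono-cong (sym (-1^[k*3] (suc k))) (exponent₀ (suc k))))
  θΩ : mono (ℤ.- 1ℤ) 1 · θ 3 Ω ≈ W ⊕ X
  θΩ = ≈-trans (mono·θ-ϑ (ℤ.- 1ℤ) 1 2 (ℤ.- 1ℤ) 4 0 refl) (R.+-cong
    (∑∞-cong λ k → mono-cong (cong (ℤ._*_ (ℤ.- 1ℤ)) (sym (-1^[k*3] k))) (exponent₁ k))
    (∑∞-cong λ k → mono-cong (cong (λ z → ℤ.- 1ℤ ℤ.* (ℤ.- 1ℤ ℤ.* z)) (sym (-1^[k*3] k))) (exponent₂ k)))

-- Here `ψ` is the sum of q^(2n²+n) over all integers n. The class n ≡ 2 modulo 3 gives q ψ(q⁹). The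
-- other two classes merge into the sum of q^(3m(3m+1)/2): even m come from n ≡ 0 and odd m from n ≡
-- 1, which is why the two halves of Ψ(q³) are split by parity.
ψ-dissection : ψ ≈ θ 3 Ψ ⊕ q^ 1 · θ 9 ψ
ψ-dissection = begin
  ψ
    ≈⟨ ϑ-series 1ℤ 3 1 refl ⟩
  ∑∞ v ⊕ ∑∞ (w ∘ suc)
    ≈⟨ R.+-cong (∑∞-split₃ v-summable) (∑∞-split₃ (Summable-suc w-summable)) ⟩
  (V₀ ⊕ V₁ ⊕ V₂) ⊕ (W₁ ⊕ W₂ ⊕ W₃)
    ≈⟨ solve 6 (λ a b c d e g → a :+ b :+ c :+ (d :+ e :+ g) := a :+ e :+ (b :+ g) :+ (d :+ c)) ≈-refl V₀ V₁ V₂ W₁ W₂ W₃ ⟩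
  V₀ ⊕ W₂ ⊕ (V₁ ⊕ W₃) ⊕ (W₁ ⊕ V₂)
    ≈⟨ R.+-cong θΨ θψ ⟨
  θ 3 Ψ ⊕ mono 1ℤ 1 · θ 9 ψ
    ≈⟨ R.+-congˡ (R.*-congʳ (mono-1 1)) ⟩
  θ 3 Ψ ⊕ q^ 1 · θ 9 ψ ∎
  where
  open ≈-Reasoning
  v w x y : ℕ → PowerSeries
  v = ϑ-term 1ℤ 3 4
  w = ϑ-term 1ℤ 1 4
  v-summable : Summable v
  v-summable = ϑ-term-summable 1ℤ 2 4
  w-summable : Summable w
  w-summable = ϑ-term-summable 1ℤ 0 4
  V₀ V₁ V₂ W₁ W₂ W₃ : PowerSeries
  V₀ = ∑∞ (λ k → v (k * 3))
  V₁ = ∑∞ (λ k → v (1 + k * 3))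
  V₂ = ∑∞ (λ k → v (2 + k * 3))
  W₁ = ∑∞ (λ k → w (1 + k * 3))
  W₂ = ∑∞ (λ k → w (2 + k * 3))
  W₃ = ∑∞ (λ k → w (suc k * 3))
  1^ : ∀ k l → 1ℤ ℤ.^ k ≡ 1ℤ ℤ.^ l
  1^ k l = trans (ℤ.^-zeroˡ k) (sym (ℤ.^-zeroˡ l))
  1*1^ : ∀ k l → 1ℤ ℤ.* 1ℤ ℤ.^ k ≡ 1ℤ ℤ.^ l
  1*1^ k l = trans (ℤ.*-identityˡ _) (1^ k l)
  x k = mono (1ℤ ℤ.^ k) ((k * 2 + triangle k * 3) * 3)
  y k = mono (1ℤ ℤ.^ k) ((k * 1 + triangle k * 3) * 3)
  term-summable : ∀ a → Summable (λ k → mono (1ℤ ℤ.^ k) ((k * suc a + triangle k * 3) * 3))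
  term-summable a k = ≈[]-weaken (ℕ.≤-trans (ℕ.m≤m*n k (suc a)) (ℕ.≤-trans (ℕ.m≤m+n (k * suc a) _) (ℕ.m≤m*n _ 3)))
    (mono-order (1ℤ ℤ.^ k) ((k * suc a + triangle k * 3) * 3))
  xe : ∀ k → (k * 2 * 2 + triangle (k * 2) * 3) * 3 ≡ k * 3 * 3 + triangle (k * 3) * 4
  xe k = trans (cong (λ t → (k * 2 * 2 + t * 3) * 3) (triangle-*2 k))
    (trans (lemma k (triangle k)) (cong (λ t → k * 3 * 3 + t * 4) (sym (triangle-*3 k))))
    where
    lemma : ∀ k t → (k * 2 * 2 + (t * 4 + k) * 3) * 3 ≡ k * 3 * 3 + (t * 9 + k * 3) * 4
    lemma = ℕ-Tactic.solve-∀
  xo : ∀ k → ((1 + k * 2) * 2 + triangle (1 + k * 2) * 3) * 3 ≡ (2 + k * 3) * 1 + triangle (2 + k * 3) * 4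
  xo k = trans (cong (λ t → ((1 + k * 2) * 2 + (k * 2 + t) * 3) * 3) (triangle-*2 k))
    (trans (lemma k (triangle k)) (cong (λ t → (2 + k * 3) * 1 + (1 + k * 3 + (k * 3 + t)) * 4) (sym (triangle-*3 k))))
    where
    lemma : ∀ k t → ((1 + k * 2) * 2 + (k * 2 + (t * 4 + k)) * 3) * 3 ≡ (2 + k * 3) * 1 + (1 + k * 3 + (k * 3 + (t * 9 + k * 3))) * 4
    lemma = ℕ-Tactic.solve-∀
  yo : ∀ k → ((1 + k * 2) * 1 + triangle (1 + k * 2) * 3) * 3 ≡ (1 + k * 3) * 3 + triangle (1 + k * 3) * 4
  yo k = trans (cong (λ t → ((1 + k * 2) * 1 + (k * 2 + t) * 3) * 3) (triangle-*2 k))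
    (trans (lemma k (triangle k)) (cong (λ t → (1 + k * 3) * 3 + (k * 3 + t) * 4) (sym (triangle-*3 k))))
    where
    lemma : ∀ k t → ((1 + k * 2) * 1 + (k * 2 + (t * 4 + k)) * 3) * 3 ≡ (1 + k * 3) * 3 + (k * 3 + (t * 9 + k * 3)) * 4
    lemma = ℕ-Tactic.solve-∀
  ye : ∀ k → (k * 2 * 1 + triangle (k * 2) * 3) * 3 ≡ k * 3 * 1 + triangle (k * 3) * 4
  ye k = trans (cong (λ t → (k * 2 * 1 + t * 3) * 3) (triangle-*2 k))
    (trans (lemma k (triangle k)) (cong (λ t → k * 3 * 1 + t * 4) (sym (triangle-*3 k))))
    where
    lemma : ∀ k t → (k * 2 * 1 + (t * 4 + k) * 3) * 3 ≡ k * 3 * 1 + (t * 9 + k * 3) * 4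
    lemma = ℕ-Tactic.solve-∀
  θΨ : θ 3 Ψ ≈ V₀ ⊕ W₂ ⊕ (V₁ ⊕ W₃)
  θΨ = begin
    θ 3 Ψ
      ≈⟨ θ-ϑ 2 1ℤ 1 0 refl ⟩
    ∑∞ x ⊕ ∑∞ (y ∘ suc)
      ≈⟨ R.+-cong (∑∞-split₂ (term-summable 1)) (∑∞-split₂ (Summable-suc (term-summable 0))) ⟩
    ∑∞ (λ k → x (k * 2)) ⊕ ∑∞ (λ k → x (1 + k * 2)) ⊕ (∑∞ (λ k → y (1 + k * 2)) ⊕ ∑∞ (λ k → y (suc k * 2)))
      ≈⟨ R.+-cong (R.+-cong (∑∞-cong λ k → mono-cong (1^ (k * 2) (k * 3)) (xe k))
                            (∑∞-cong λ k → mono-cong (1^ (1 + k * 2) (2 + k * 3)) (xo k)))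
                  (R.+-cong (∑∞-cong λ k → mono-cong (1^ (1 + k * 2) (1 + k * 3)) (yo k))
                            (∑∞-cong λ k → mono-cong (1^ (suc k * 2) (suc k * 3)) (ye (suc k)))) ⟩
    V₀ ⊕ W₂ ⊕ (V₁ ⊕ W₃) ∎
  z₁ : ∀ k → 1 + (k * 3 + triangle k * 4) * 9 ≡ (1 + k * 3) * 1 + triangle (1 + k * 3) * 4
  z₁ k = trans (lemma k (triangle k)) (cong (λ t → (1 + k * 3) * 1 + (k * 3 + t) * 4) (sym (triangle-*3 k)))
    where
    lemma : ∀ k t → 1 + (k * 3 + t * 4) * 9 ≡ (1 + k * 3) * 1 + (k * 3 + (t * 9 + k * 3)) * 4
    lemma = ℕ-Tactic.solve-∀
  z₂ : ∀ k → 1 + (suc k * 1 + triangle (suc k) * 4) * 9 ≡ (2 + k * 3) * 3 + triangle (2 + k * 3) * 4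
  z₂ k = trans (lemma k (triangle k)) (cong (λ t → (2 + k * 3) * 3 + (1 + k * 3 + (k * 3 + t)) * 4) (sym (triangle-*3 k)))
    where
    lemma : ∀ k t → 1 + (suc k * 1 + (k + t) * 4) * 9 ≡ (2 + k * 3) * 3 + (1 + k * 3 + (k * 3 + (t * 9 + k * 3))) * 4
    lemma = ℕ-Tactic.solve-∀
  θψ : mono 1ℤ 1 · θ 9 ψ ≈ W₁ ⊕ V₂
  θψ = ≈-trans (mono·θ-ϑ 1ℤ 1 8 1ℤ 2 0 refl) (R.+-cong
    (∑∞-cong λ k → mono-cong (1*1^ k (1 + k * 3)) (z₁ k))
    (∑∞-cong λ k → mono-cong (1*1^ (suc k) (2 + k * 3)) (z₂ k)))

-- The norm of ℤ[[q]] over ℤ[[q³]]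

q₁ : PowerSeries
q₁ = q^ 1

q₁↑ : ∀ k → q^ k ≈ q₁ ↑ k
q₁↑ k = ≈-trans (q^-cong (sym (ℕ.*-identityʳ k))) (≈-sym (q^-↑ 1 k))

-- The element of ℤ[[q]] with coordinates X(q³), Y(q³), Z(q³) in the basis 1, q, q² over ℤ[[q³]].
T : PowerSeries → PowerSeries → PowerSeries → PowerSeries
T X Y Z = θ 3 X ⊕ q₁ · θ 3 Y ⊕ q₁ · q₁ · θ 3 Z

T-cong : ∀ {X X′ Y Y′ Z Z′} → X ≈ X′ → Y ≈ Y′ → Z ≈ Z′ → T X Y Z ≈ T X′ Y′ Z′
T-cong p r s = R.+-cong (R.+-cong (θ-cong 3 p) (R.*-congˡ (θ-cong 3 r))) (R.*-congˡ (θ-cong 3 s))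

T≈trisected : ∀ X Y Z → T X Y Z ≈ θ 3 X ⊕ q^ 1 · θ 3 Y ⊕ q^ 2 · θ 3 Z
T≈trisected X Y Z = R.+-congˡ (R.*-congʳ (≈-sym (q^-+ 1 1)))

U-T : ∀ X Y Z → U (T X Y Z) ≈ X
U-T X Y Z = ≈-trans (U-cong (T≈trisected X Y Z)) (U-trisected X Y Z)

U-tail-T : ∀ X Y Z → U (tail (T X Y Z)) ≈ Y
U-tail-T X Y Z = ≈-trans (U-cong (mk≈ λ n → coeff (T≈trisected X Y Z) (suc n))) (U-tail-trisected X Y Z)

U-tail²-T : ∀ X Y Z → U (tail (tail (T X Y Z))) ≈ Z
U-tail²-T X Y Z = ≈-trans (U-cong (mk≈ λ n → coeff (T≈trisected X Y Z) (2 + n))) (U-tail²-trisected X Y Z)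

T-trisect : ∀ F → F ≈ T (U F) (U (tail F)) (U (tail (tail F)))
T-trisect F = ≈-trans (trisect F) (≈-sym (T≈trisected _ _ _))

θ-q₁ : θ 3 q₁ ≈ q₁ · q₁ · q₁
θ-q₁ = ≈-trans (θ-q^ 2 1) (≈-trans (q^-+ 2 1) (R.*-congʳ (q^-+ 1 1)))

private
  θ-q₁· : ∀ F → θ 3 (q₁ · F) ≈ q₁ · q₁ · q₁ · θ 3 F
  θ-q₁· F = ≈-trans (θ-· 2 q₁ F) (R.*-congʳ θ-q₁)

T-⊕ : ∀ X Y Z X′ Y′ Z′ → T X Y Z ⊕ T X′ Y′ Z′ ≈ T (X ⊕ X′) (Y ⊕ Y′) (Z ⊕ Z′)
T-⊕ X Y Z X′ Y′ Z′ = ≈-trans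
  (solve 7 (λ q x y z x′ y′ z′ → x :+ q :* y :+ q :* q :* z :+ (x′ :+ q :* y′ :+ q :* q :* z′)
      := x :+ x′ :+ q :* (y :+ y′) :+ q :* q :* (z :+ z′)) ≈-refl q₁ _ _ _ _ _ _)
  (≈-sym (R.+-cong (R.+-cong (θ-⊕ 3 X X′) (R.*-congˡ (θ-⊕ 3 Y Y′))) (R.*-congˡ (θ-⊕ 3 Z Z′))))

θ·T : ∀ P X Y Z → θ 3 P · T X Y Z ≈ T (P · X) (P · Y) (P · Z)
θ·T P X Y Z = ≈-trans
  (solve 5 (λ q p x y z → p :* (x :+ q :* y :+ q :* q :* z)
         := p :* x :+ q :* (p :* y) :+ q :* q :* (p :* z)) ≈-refl q₁ _ _ _ _)
  (≈-sym (R.+-cong (R.+-cong (θ-· 2 P X) (R.*-congˡ (θ-· 2 P Y))) (R.*-congˡ (θ-· 2 P Z))))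

⟨⟩·T : ∀ c X Y Z → ⟨ c ⟩ · T X Y Z ≈ T (⟨ c ⟩ · X) (⟨ c ⟩ · Y) (⟨ c ⟩ · Z)
⟨⟩·T c X Y Z = ≈-trans (R.*-congʳ (≈-sym (θ-⟨⟩ 3 c))) (θ·T ⟨ c ⟩ X Y Z)

q₁·T : ∀ X Y Z → q₁ · T X Y Z ≈ T (q₁ · Z) X Y
q₁·T X Y Z = ≈-trans
  (solve 4 (λ q x y z → q :* (x :+ q :* y :+ q :* q :* z) := q :* q :* q :* z :+ q :* x :+ q :* q :* y) ≈-refl q₁ _ _ _)
  (≈-sym (R.+-congʳ (R.+-congʳ (θ-q₁· Z))))

-- A product of basis elements that reaches q³ or q⁴ wraps around; the q³ that it leaves appears as
-- `q₁` in the coordinates.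
T-· : ∀ X Y Z X′ Y′ Z′ → T X Y Z · T X′ Y′ Z′ ≈
      T (X · X′ ⊕ q₁ · (Y · Z′ ⊕ Z · Y′)) (X · Y′ ⊕ Y · X′ ⊕ q₁ · (Z · Z′)) (X · Z′ ⊕ Y · Y′ ⊕ Z · X′)
T-· X Y Z X′ Y′ Z′ = begin
  T X Y Z · T X′ Y′ Z′
    ≈⟨ solve 5 (λ q x y z t → (x :+ q :* y :+ q :* q :* z) :* t
           := x :* t :+ y :* (q :* t) :+ z :* (q :* (q :* t))) ≈-refl q₁ _ _ _ _ ⟩
  θ 3 X · T X′ Y′ Z′ ⊕ θ 3 Y · (q₁ · T X′ Y′ Z′) ⊕ θ 3 Z · (q₁ · (q₁ · T X′ Y′ Z′))
    ≈⟨ R.+-cong (R.+-congˡ (R.*-congˡ (q₁·T X′ Y′ Z′)))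
         (R.*-congˡ (≈-trans (R.*-congˡ (q₁·T X′ Y′ Z′)) (q₁·T (q₁ · Z′) X′ Y′))) ⟩
  θ 3 X · T X′ Y′ Z′ ⊕ θ 3 Y · T (q₁ · Z′) X′ Y′ ⊕ θ 3 Z · T (q₁ · Y′) (q₁ · Z′) X′
    ≈⟨ R.+-cong (R.+-cong (θ·T X _ _ _) (θ·T Y _ _ _)) (θ·T Z _ _ _) ⟩
  T (X · X′) (X · Y′) (X · Z′) ⊕ T (Y · (q₁ · Z′)) (Y · X′) (Y · Y′) ⊕ T (Z · (q₁ · Y′)) (Z · (q₁ · Z′)) (Z · X′)
    ≈⟨ ≈-trans (R.+-congʳ (T-⊕ _ _ _ _ _ _)) (T-⊕ _ _ _ _ _ _) ⟩
  T (X · X′ ⊕ Y · (q₁ · Z′) ⊕ Z · (q₁ · Y′)) (X · Y′ ⊕ Y · X′ ⊕ Z · (q₁ · Z′)) (X · Z′ ⊕ Y · Y′ ⊕ Z · X′)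
    ≈⟨ T-cong
         (solve 7 (λ q x y z x′ y′ z′ → x :* x′ :+ y :* (q :* z′) :+ z :* (q :* y′)
                := x :* x′ :+ q :* (y :* z′ :+ z :* y′)) ≈-refl q₁ X Y Z X′ Y′ Z′)
         (solve 7 (λ q x y z x′ y′ z′ → x :* y′ :+ y :* x′ :+ z :* (q :* z′)
                := x :* y′ :+ y :* x′ :+ q :* (z :* z′)) ≈-refl q₁ X Y Z X′ Y′ Z′)
         ≈-refl ⟩
  T (X · X′ ⊕ q₁ · (Y · Z′ ⊕ Z · Y′)) (X · Y′ ⊕ Y · X′ ⊕ q₁ · (Z · Z′)) (X · Z′ ⊕ Y · Y′ ⊕ Z · X′) ∎
  where open ≈-Reasoning

-- The product of θ 3 X ⊕ ω q θ 3 Y ⊕ ω² q² θ 3 Z over the cube roots of unity ω,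
-- with q³ replaced by q.
normForm : PowerSeries → PowerSeries → PowerSeries → PowerSeries
normForm X Y Z = X ↑ 3 ⊕ q₁ · Y ↑ 3 ⊕ q₁ ↑ 2 · Z ↑ 3 ⊕ ⟨ ℤ.- ℤ.+ 3 ⟩ · (q₁ · (X · Y · Z))

norm : PowerSeries → PowerSeries
norm F = normForm (U F) (U (tail F)) (U (tail (tail F)))

normForm-cong : ∀ {X X′ Y Y′ Z Z′} → X ≈ X′ → Y ≈ Y′ → Z ≈ Z′ → normForm X Y Z ≈ normForm X′ Y′ Z′
normForm-cong p r s = R.+-cong (R.+-cong (R.+-cong (↑-congˡ 3 p) (R.*-congˡ (↑-congˡ 3 r))) (R.*-congˡ (↑-congˡ 3 s)))
  (R.*-congˡ (R.*-congˡ (R.*-cong (R.*-cong p r) s)))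

norm-cong : ∀ {F G} → F ≈ G → norm F ≈ norm G
norm-cong p = normForm-cong (U-cong p) (U-cong (mk≈ λ n → coeff p (suc n))) (U-cong (mk≈ λ n → coeff p (2 + n)))

norm-T : ∀ X Y Z → norm (T X Y Z) ≈ normForm X Y Z
norm-T X Y Z = normForm-cong (U-T X Y Z) (U-tail-T X Y Z) (U-tail²-T X Y Z)

-- With both factors in coordinates this is a polynomial identity with integer coefficients, so it
-- is verified without adjoining a cube root of unity.
norm-· : ∀ F G → norm (F · G) ≈ norm F · norm G
norm-· F G = begin
  norm (F · G)
    ≈⟨ norm-cong (≈-trans (R.*-cong (T-trisect F) (T-trisect G)) (T-· _ _ _ _ _ _)) ⟩
  norm (T _ _ _)
    ≈⟨ norm-T _ _ _ ⟩
  normForm (X · X′ ⊕ q₁ · (Y · Z′ ⊕ Z · Y′)) (X · Y′ ⊕ Y · X′ ⊕ q₁ · (Z · Z′)) (X · Z′ ⊕ Y · Y′ ⊕ Z · X′)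
    ≈⟨ solve 7 (λ q x y z x′ y′ z′ →
         nf q (x :* x′ :+ q :* (y :* z′ :+ z :* y′)) (x :* y′ :+ y :* x′ :+ q :* (z :* z′)) (x :* z′ :+ y :* y′ :+ z :* x′)
           := nf q x y z :* nf q x′ y′ z′) ≈-refl q₁ X Y Z X′ Y′ Z′ ⟩
  norm F · norm G ∎
  where
  open ≈-Reasoning
  X Y Z X′ Y′ Z′ : PowerSeries
  X = U F
  Y = U (tail F)
  Z = U (tail (tail F))
  X′ = U G
  Y′ = U (tail G)
  Z′ = U (tail (tail G))
  nf : ∀ {n} (q x y z : Polynomial n) → Polynomial n
  nf q x y z = x :^ 3 :+ q :* y :^ 3 :+ q :^ 2 :* z :^ 3 :+ con (ℤ.- ℤ.+ 3) :* (q :* (x :* y :* z))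

norm-cong[] : ∀ {F G N} → F ≈[ N * 3 ] G → norm F ≈[ N ] norm G
norm-cong[] {F} {G} {N} p = ⊕-cong[] (⊕-cong[] (⊕-cong[] (↑-cong[] 3 X≈) (·-cong[] {q₁} ≈[]-refl (↑-cong[] 3 Y≈)))
    (·-cong[] {q₁ ↑ 2} ≈[]-refl (↑-cong[] 3 Z≈)))
  (·-cong[] {⟨ ℤ.- ℤ.+ 3 ⟩} ≈[]-refl (·-cong[] {q₁} ≈[]-refl (·-cong[] (·-cong[] X≈ Y≈) Z≈)))
  where
  ↑-cong[] : ∀ {F G} k → F ≈[ N ] G → F ↑ k ≈[ N ] G ↑ k
  ↑-cong[] zero    r = ≈[]-refl
  ↑-cong[] (suc k) r = ·-cong[] r (↑-cong[] k r)
  bound : ∀ {n} → n < N → 3 + n * 3 ≤ N * 3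
  bound n<N = ℕ.*-monoˡ-≤ 3 n<N
  X≈ : U F ≈[ N ] U G
  X≈ = U-cong[] p
  Y≈ : U (tail F) ≈[ N ] U (tail G)
  Y≈ = mk≈[] λ n n<N → coeff[] p _ (ℕ.≤-trans (ℕ.n≤1+n _) (bound n<N))
  Z≈ : U (tail (tail F)) ≈[ N ] U (tail (tail G))
  Z≈ = mk≈[] λ n n<N → coeff[] p _ (bound n<N)

θ-0 : θ 3 ⟨ 0ℤ ⟩ ≈ ⟨ 0ℤ ⟩
θ-0 = θ-⟨⟩ 3 0ℤ

θ-1 : θ 3 ⟨ 1ℤ ⟩ ≈ ⟨ 1ℤ ⟩
θ-1 = θ-⟨⟩ 3 1ℤ

θ⊝q^ : ∀ i → θ 3 (⊝ q^ i) ≈ ⊝ q^ (i * 3)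
θ⊝q^ i = ≈-trans (θ-⊝ 3 (q^ i)) (R.-‿cong (θ-q^ 2 i))

q^-*3 : ∀ i → q^ i ↑ 3 ≈ q^ (i * 3)
q^-*3 i = ≈-trans (q^-↑ i 3) (q^-cong (ℕ.*-comm 3 i))

-- The factor lies in ℤ[[q³]], so its three conjugates coincide.
norm-𝟏-q^[3i] : ∀ i → norm (𝟏- q^ (i * 3)) ≈ (𝟏- q^ i) ↑ 3
norm-𝟏-q^[3i] i = begin
  norm (𝟏- q^ (i * 3))
    ≈⟨ norm-cong (≈-trans (solve 2 (λ q x → con 1ℤ :- x
           := con 1ℤ :- x :+ q :* con 0ℤ :+ q :* q :* con 0ℤ) ≈-refl q₁ (q^ (i * 3)))
         (≈-sym (R.+-cong (R.+-cong (≈-trans (θ-⊕ 3 _ _) (R.+-cong θ-1 (θ⊝q^ i))) (R.*-congˡ θ-0)) (R.*-congˡ θ-0)))) ⟩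
  norm (T (𝟏- q^ i) ⟨ 0ℤ ⟩ ⟨ 0ℤ ⟩)
    ≈⟨ norm-T _ _ _ ⟩
  normForm (𝟏- q^ i) ⟨ 0ℤ ⟩ ⟨ 0ℤ ⟩
    ≈⟨ solve 2 (λ q x → x :^ 3 :+ q :* con 0ℤ :^ 3 :+ q :^ 2 :* con 0ℤ :^ 3 :+ con (ℤ.- ℤ.+ 3) :* (q :* (x :* con 0ℤ :* con 0ℤ))
         := x :^ 3) ≈-refl q₁ (𝟏- q^ i) ⟩
  (𝟏- q^ i) ↑ 3 ∎
  where open ≈-Reasoning

-- For an exponent e prime to 3 the conjugates are 1 - ω^j q^e, with product 1 - q^(3e); replacing
-- q³ by q returns the original factor.
norm-𝟏-q^[1+3i] : ∀ i → norm (𝟏- q^ (1 + i * 3)) ≈ 𝟏- q^ (1 + i * 3)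
norm-𝟏-q^[1+3i] i = begin
  norm (𝟏- q^ (1 + i * 3))
    ≈⟨ norm-cong (≈-trans (𝟏--cong (q^-+ 1 (i * 3)))
         (≈-trans (solve 2 (λ q x → con 1ℤ :- q :* x := con 1ℤ :+ q :* (:- x) :+ q :* q :* con 0ℤ) ≈-refl q₁ (q^ (i * 3)))
         (≈-sym (R.+-cong (R.+-cong θ-1 (R.*-congˡ (θ⊝q^ i))) (R.*-congˡ θ-0))))) ⟩
  norm (T ⟨ 1ℤ ⟩ (⊝ q^ i) ⟨ 0ℤ ⟩)
    ≈⟨ norm-T _ _ _ ⟩
  normForm ⟨ 1ℤ ⟩ (⊝ q^ i) ⟨ 0ℤ ⟩
    ≈⟨ solve 2 (λ q x → con 1ℤ :^ 3 :+ q :* (:- x) :^ 3 :+ q :^ 2 :* con 0ℤ :^ 3 :+ con (ℤ.- ℤ.+ 3) :* (q :* (con 1ℤ :* (:- x) :* con 0ℤ))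
         := con 1ℤ :- q :* x :^ 3) ≈-refl q₁ (q^ i) ⟩
  𝟏- (q₁ · q^ i ↑ 3)
    ≈⟨ 𝟏--cong (≈-trans (R.*-congˡ (q^-*3 i)) (≈-sym (q^-+ 1 (i * 3)))) ⟩
  𝟏- q^ (1 + i * 3) ∎
  where open ≈-Reasoning

norm-𝟏-q^[2+3i] : ∀ i → norm (𝟏- q^ (2 + i * 3)) ≈ 𝟏- q^ (2 + i * 3)
norm-𝟏-q^[2+3i] i = begin
  norm (𝟏- q^ (2 + i * 3))
    ≈⟨ norm-cong (≈-trans (𝟏--cong (≈-trans (q^-+ 2 (i * 3)) (R.*-congʳ (q^-+ 1 1))))
         (≈-trans (solve 2 (λ q x → con 1ℤ :- q :* q :* x
                := con 1ℤ :+ q :* con 0ℤ :+ q :* q :* (:- x)) ≈-refl q₁ (q^ (i * 3)))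
         (≈-sym (R.+-cong (R.+-cong θ-1 (R.*-congˡ θ-0)) (R.*-congˡ (θ⊝q^ i)))))) ⟩
  norm (T ⟨ 1ℤ ⟩ ⟨ 0ℤ ⟩ (⊝ q^ i))
    ≈⟨ norm-T _ _ _ ⟩
  normForm ⟨ 1ℤ ⟩ ⟨ 0ℤ ⟩ (⊝ q^ i)
    ≈⟨ solve 2 (λ q x → con 1ℤ :^ 3 :+ q :* con 0ℤ :^ 3 :+ q :^ 2 :* (:- x) :^ 3 :+ con (ℤ.- ℤ.+ 3) :* (q :* (con 1ℤ :* con 0ℤ :* (:- x)))
         := con 1ℤ :- q :* q :* x :^ 3) ≈-refl q₁ (q^ i) ⟩
  𝟏- (q₁ · q₁ · q^ i ↑ 3)
    ≈⟨ 𝟏--cong (≈-trans (R.*-cong (≈-sym (q^-+ 1 1)) (q^-*3 i)) (≈-sym (q^-+ 2 (i * 3)))) ⟩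
  𝟏- q^ (2 + i * 3) ∎
  where open ≈-Reasoning

-- Write k for the index of f. The factors 1 - q^(km) with 3 not dividing m are fixed by the norm
-- and multiply to f_k / f_(3k); those with m = 3l become (1 - q^(kl))³ and multiply to f_k³. The
-- two hypotheses express that 3 does not divide k.
norm-f : ∀ k → (∀ m → norm (𝟏- q^ (suc k * (1 + m * 3))) ≈ 𝟏- q^ (suc k * (1 + m * 3))) →
               (∀ m → norm (𝟏- q^ (suc k * (2 + m * 3))) ≈ 𝟏- q^ (suc k * (2 + m * 3))) →
         norm (f (suc k)) · f (suc k * 3) ≈ f (suc k) ↑ 4
norm-f k fix₁ fix₂ = ⟶-unique′ finite
  (⟶-· (λ N → norm-cong[] (partialProduct-⟶ k (N * 3))) (partialProduct-⟶ (2 + k * 3)))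
  (⟶-· (⟶-subsequence (_* 3) (λ N → ℕ.m≤m*n N 3) P⟶) (⟶-· P⟶ (⟶-· P⟶ (⟶-· P⟶ (⟶-const ⟨ 1ℤ ⟩)))))
  where
  open ≈-Reasoning
  P : ℕ → PowerSeries
  P = partialProduct (suc k)
  P⟶ : P ⟶ f (suc k)
  P⟶ = partialProduct-⟶ k
  -- Truncation after 3M factors keeps complete blocks of the three residue classes of m.
  finite : ∀ M → norm (P (M * 3)) · partialProduct (suc k * 3) M ≈ P (M * 3) · P M ↑ 3
  finite zero = begin
    norm (q^ 0) · q^ 0          ≈⟨ R.*-cong (norm-cong (≈-trans q^0≈1 (≈-sym T1))) q^0≈1 ⟩
    norm (T ⟨ 1ℤ ⟩ ⟨ 0ℤ ⟩ ⟨ 0ℤ ⟩) · ⟨ 1ℤ ⟩   ≈⟨ R.*-congʳ (norm-T _ _ _) ⟩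
    normForm ⟨ 1ℤ ⟩ ⟨ 0ℤ ⟩ ⟨ 0ℤ ⟩ · ⟨ 1ℤ ⟩
      ≈⟨ solve 1 (λ q → (con 1ℤ :^ 3 :+ q :* con 0ℤ :^ 3 :+ q :^ 2 :* con 0ℤ :^ 3
           :+ con (ℤ.- ℤ.+ 3) :* (q :* (con 1ℤ :* con 0ℤ :* con 0ℤ))) :* con 1ℤ := con 1ℤ :* con 1ℤ :^ 3) ≈-refl q₁ ⟩
    ⟨ 1ℤ ⟩ · ⟨ 1ℤ ⟩ ↑ 3         ≈⟨ R.*-cong q^0≈1 (↑-congˡ 3 q^0≈1) ⟨
    q^ 0 · (q^ 0) ↑ 3           ∎
    where
    T1 : T ⟨ 1ℤ ⟩ ⟨ 0ℤ ⟩ ⟨ 0ℤ ⟩ ≈ ⟨ 1ℤ ⟩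
    T1 = ≈-trans (R.+-cong (R.+-cong θ-1 (R.*-congˡ θ-0)) (R.*-congˡ θ-0))
      (solve 1 (λ q → con 1ℤ :+ q :* con 0ℤ :+ q :* q :* con 0ℤ := con 1ℤ) ≈-refl q₁)
  finite (suc M) = begin
    norm (P (suc M * 3)) · partialProduct (suc k * 3) (suc M)
      ≈⟨ R.*-cong (≈-trans (norm-cong expand) (≈-trans (norm-· _ _) (R.*-cong norm-c
           (≈-trans (norm-· _ _) (R.*-cong (fix₂ M) (≈-trans (norm-· _ _) (R.*-congʳ (fix₁ M))))))))
           (≈-trans (partialProduct-suc (suc k * 3) M) (R.*-congʳ (𝟏--cong (q^-cong (assoc₁ (suc k) M))))) ⟩
    H ↑ 3 · (B · (A · norm (P (M * 3)))) · (C · partialProduct (suc k * 3) M)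
      ≈⟨ solve 6 (λ h b a c n p → h :^ 3 :* (b :* (a :* n)) :* (c :* p)
             := c :* (b :* a) :* h :^ 3 :* (n :* p)) ≈-refl H B A C _ _ ⟩
    C · (B · A) · H ↑ 3 · (norm (P (M * 3)) · partialProduct (suc k * 3) M)
      ≈⟨ R.*-congˡ (finite M) ⟩
    C · (B · A) · H ↑ 3 · (P (M * 3) · P M ↑ 3)
      ≈⟨ solve 6 (λ h b a c n p → c :* (b :* a) :* h :^ 3 :* (n :* p :^ 3)
             := c :* (b :* (a :* n)) :* (h :* p) :^ 3) ≈-refl H B A C _ _ ⟩
    C · (B · (A · P (M * 3))) · (H · P M) ↑ 3
      ≈⟨ R.*-cong (≈-sym expand) (↑-congˡ 3 (≈-sym (partialProduct-suc (suc k) M))) ⟩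
    P (suc M * 3) · P (suc M) ↑ 3 ∎
    where
    A B C H : PowerSeries
    A = 𝟏- q^ (suc k * (1 + M * 3))
    B = 𝟏- q^ (suc k * (2 + M * 3))
    C = 𝟏- q^ (suc k * (3 + M * 3))
    H = 𝟏- q^ (suc k * suc M)
    assoc₁ : ∀ k M → k * 3 * suc M ≡ k * (3 + M * 3)
    assoc₁ = ℕ-Tactic.solve-∀
    assoc₂ : ∀ k M → k * (3 + M * 3) ≡ k * suc M * 3
    assoc₂ = ℕ-Tactic.solve-∀
    norm-c : norm C ≈ H ↑ 3
    norm-c = ≈-trans (norm-cong (𝟏--cong (q^-cong (assoc₂ (suc k) M)))) (norm-𝟏-q^[3i] (suc k * suc M))
    expand : P (suc M * 3) ≈ C · (B · (A · P (M * 3)))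
    expand = ≈-trans (partialProduct-suc (suc k) (2 + M * 3)) (R.*-congˡ
      (≈-trans (partialProduct-suc (suc k) (1 + M * 3)) (R.*-congˡ (partialProduct-suc (suc k) (M * 3)))))

norm-f₁ : norm (f 1) · f 3 ≈ f 1 ↑ 4
norm-f₁ = norm-f 0
  (λ m → fix (1 + m * 3) (norm-𝟏-q^[1+3i] m))
  (λ m → fix (2 + m * 3) (norm-𝟏-q^[2+3i] m))
  where
  fix : ∀ e → norm (𝟏- q^ e) ≈ 𝟏- q^ e → norm (𝟏- q^ (1 * e)) ≈ 𝟏- q^ (1 * e)
  fix e = subst (λ i → norm (𝟏- q^ i) ≈ 𝟏- q^ i) (sym (ℕ.*-identityˡ e))

norm-f₂ : norm (f 2) · f 6 ≈ f 2 ↑ 4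
norm-f₂ = norm-f 1
  -- Doubling exchanges the residue classes 1 and 2 modulo 3.
  (λ m → fix (exponent₁ m) (norm-𝟏-q^[2+3i] (m * 2)))
  (λ m → fix (exponent₂ m) (norm-𝟏-q^[1+3i] (1 + m * 2)))
  where
  fix : ∀ {e g} → e ≡ g → norm (𝟏- q^ e) ≈ 𝟏- q^ e → norm (𝟏- q^ g) ≈ 𝟏- q^ g
  fix refl p = p
  exponent₁ : ∀ m → 2 + m * 2 * 3 ≡ 2 * (1 + m * 3)
  exponent₁ = ℕ-Tactic.solve-∀
  exponent₂ : ∀ m → 1 + (1 + m * 2) * 3 ≡ 2 * (2 + m * 3)
  exponent₂ = ℕ-Tactic.solve-∀

-- The modular equation

-- For identities that hold only modulo a relation `l ≈ r`: the solver checks the polynomial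
-- identity once the cofactor `c` of `l - r` is supplied. Below, the relation always says that the
-- product of the two outer components of the dissection is a square.
vanish : ∀ {F G l r} c → F ≈ G ⊕ c · (l ⊕ ⊝ r) → l ≈ r → F ≈ G
vanish {F} {G} {l} {r} c p l≈r = begin
  F                      ≈⟨ p ⟩
  G ⊕ c · (l ⊕ ⊝ r)      ≈⟨ R.+-congˡ (R.*-congˡ (R.+-congʳ l≈r)) ⟩
  G ⊕ c · (r ⊕ ⊝ r)      ≈⟨ solve 3 (λ g c r → g :+ c :* (r :- r) := g) ≈-refl G c r ⟩
  G                      ∎
  where open ≈-Reasoning

f₁f₂ f₃f₆ α₀ β₀ : PowerSeries
f₁f₂ = f 1 · f 2
f₃f₆ = f 3 · f 6
α₀ = θ 3 φ · Ψ
β₀ = Ω · θ 3 ψ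

θ-f₁f₂ : θ 3 f₁f₂ ≈ f₃f₆
θ-f₁f₂ = ≈-trans (θ-· 2 (f 1) (f 2)) (R.*-cong (θ-f 2 0) (θ-f 2 1))

θφθψ : θ 3 φ · θ 3 ψ ≈ f₃f₆
θφθψ = ≈-trans (≈-sym (θ-· 2 φ ψ)) (≈-trans (θ-cong 3 φψ≈f₁f₂) θ-f₁f₂)

α₀β₀ : α₀ · β₀ ≈ f₃f₆ · f₃f₆
α₀β₀ = ≈-trans (solve 4 (λ a b c d → a :* b :* (c :* d) := a :* d :* (c :* b)) ≈-refl (θ 3 φ) Ψ Ω (θ 3 ψ))
  (R.*-cong θφθψ ΩΨ≈f₃f₆)

f₁f₂-dissection : f₁f₂ ≈ T α₀ (⊝ f₃f₆) (⟨ ℤ.- ℤ.+ 2 ⟩ · β₀)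
f₁f₂-dissection = begin
  f₁f₂
    ≈⟨ φψ≈f₁f₂ ⟨
  φ · ψ
    ≈⟨ R.*-cong φ-dissection ψ-dissection ⟩
  (θ 9 φ ⊕ ⟨ ℤ.- ℤ.+ 2 ⟩ · (q₁ · θ 3 Ω)) · (θ 3 Ψ ⊕ q₁ · θ 9 ψ)
    ≈⟨ R.*-cong
         (≈-trans (solve 3 (λ q x y → x :+ con (ℤ.- ℤ.+ 2) :* (q :* y)
                := x :+ q :* (con (ℤ.- ℤ.+ 2) :* y) :+ q :* q :* con 0ℤ) ≈-refl q₁ (θ 9 φ) (θ 3 Ω))
           (≈-sym (R.+-cong (R.+-cong (θ-θ 2 2 φ) (R.*-congˡ (θ-scale 3 (ℤ.- ℤ.+ 2) Ω))) (R.*-congˡ θ-0))))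
         (≈-trans (solve 3 (λ q x y → x :+ q :* y := x :+ q :* y :+ q :* q :* con 0ℤ) ≈-refl q₁ (θ 3 Ψ) (θ 9 ψ))
           (≈-sym (R.+-cong (R.+-congˡ (R.*-congˡ (θ-θ 2 2 ψ))) (R.*-congˡ θ-0)))) ⟩
  T (θ 3 φ) (⟨ ℤ.- ℤ.+ 2 ⟩ · Ω) ⟨ 0ℤ ⟩ · T Ψ (θ 3 ψ) ⟨ 0ℤ ⟩
    ≈⟨ T-· _ _ _ _ _ _ ⟩
  T _ _ _
    ≈⟨ T-cong
         (solve 5 (λ q a b c d → a :* c :+ q :* (con (ℤ.- ℤ.+ 2) :* b :* con 0ℤ :+ con 0ℤ :* d)
                := a :* c) ≈-refl q₁ (θ 3 φ) Ω Ψ (θ 3 ψ))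
         -- Both contributions to the middle component are multiples of f₃f₆: φ(q³)ψ(q³) once and ΩΨ
         -- with coefficient -2.
         (≈-trans (solve 5 (λ q a b c d → a :* d :+ con (ℤ.- ℤ.+ 2) :* b :* c :+ q :* (con 0ℤ :* con 0ℤ)
             := a :* d :+ con (ℤ.- ℤ.+ 2) :* (b :* c)) ≈-refl q₁ (θ 3 φ) Ω Ψ (θ 3 ψ))
           (≈-trans (R.+-cong θφθψ (R.*-congˡ ΩΨ≈f₃f₆))
             (solve 1 (λ e → e :+ con (ℤ.- ℤ.+ 2) :* e := :- e) ≈-refl f₃f₆)))
         (solve 5 (λ q a b c d → a :* con 0ℤ :+ con (ℤ.- ℤ.+ 2) :* b :* d :+ con 0ℤ :* c
                := con (ℤ.- ℤ.+ 2) :* (b :* d)) ≈-refl q₁ (θ 3 φ) Ω Ψ (θ 3 ψ)) ⟩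
  T α₀ (⊝ f₃f₆) (⟨ ℤ.- ℤ.+ 2 ⟩ · β₀) ∎
  where open ≈-Reasoning

-- The coefficient -7 is -1 from the cube of the middle component and -6 from the mixed term, in
-- which α₀β₀ becomes (f₃f₆)².
norm-f₁f₂ : norm f₁f₂ ≈ α₀ ↑ 3 ⊕ ⟨ ℤ.- ℤ.+ 7 ⟩ · (q₁ · f₃f₆ ↑ 3) ⊕ ⟨ ℤ.- ℤ.+ 8 ⟩ · (q₁ ↑ 2 · β₀ ↑ 3)
norm-f₁f₂ = ≈-trans (norm-cong f₁f₂-dissection) (≈-trans (norm-T _ _ _)
  (vanish (⟨ ℤ.- ℤ.+ 6 ⟩ · (q₁ · f₃f₆))
    (solve 4 (λ q a e b →
       a :^ 3 :+ q :* (:- e) :^ 3 :+ q :^ 2 :* (con (ℤ.- ℤ.+ 2) :* b) :^ 3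
         :+ con (ℤ.- ℤ.+ 3) :* (q :* (a :* (:- e) :* (con (ℤ.- ℤ.+ 2) :* b)))
       := a :^ 3 :+ con (ℤ.- ℤ.+ 7) :* (q :* e :^ 3) :+ con (ℤ.- ℤ.+ 8) :* (q :^ 2 :* b :^ 3)
         :+ con (ℤ.- ℤ.+ 6) :* (q :* e) :* (a :* b :- e :* e)) ≈-refl q₁ α₀ f₃f₆ β₀)
    α₀β₀))

norm-f₁f₂·f₃f₆ : norm f₁f₂ · f₃f₆ ≈ f₁f₂ ↑ 4
norm-f₁f₂·f₃f₆ = begin
  norm f₁f₂ · f₃f₆
    ≈⟨ R.*-congʳ (norm-· (f 1) (f 2)) ⟩
  norm (f 1) · norm (f 2) · (f 3 · f 6)
    ≈⟨ solve 4 (λ a b c d → a :* b :* (c :* d) := a :* c :* (b :* d)) ≈-refl _ _ _ _ ⟩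
  norm (f 1) · f 3 · (norm (f 2) · f 6)
    ≈⟨ R.*-cong norm-f₁ norm-f₂ ⟩
  f 1 ↑ 4 · f 2 ↑ 4
    ≈⟨ solve 2 (λ a b → a :^ 4 :* b :^ 4 := (a :* b) :^ 4) ≈-refl (f 1) (f 2) ⟩
  f₁f₂ ↑ 4 ∎
  where open ≈-Reasoning

-- a₃ has the generating function η(3τ)η(6τ)/(η(τ)η(2τ)) up to a factor q^(1/4); after
-- q ↦ q⁴ the exponents in s are integers.
A F E α β s S : PowerSeries
A = θ 4 a₃
F = θ 4 f₁f₂
E = θ 4 f₃f₆
α = θ 4 α₀
β = θ 4 β₀
s = q₁ · A
S = θ 3 s

θ₄θ₃ : ∀ X → θ 4 (θ 3 X) ≈ θ 3 (θ 4 X)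
θ₄θ₃ X = ≈-trans (θ-θ 3 2 X) (≈-sym (θ-θ 2 3 X))

θ₄-q₁ : θ 4 q₁ ≈ q₁ ↑ 4
θ₄-q₁ = ≈-trans (θ-q^ 3 1) (q₁↑ 4)

AF≈E : A · F ≈ E
AF≈E = begin
  θ 4 a₃ · θ 4 f₁f₂    ≈⟨ θ-· 3 a₃ f₁f₂ ⟨
  θ 4 (a₃ · f₁f₂)      ≈⟨ θ-cong 4 (R.*-comm a₃ f₁f₂) ⟩
  θ 4 (f₁f₂ · a₃)      ≈⟨ θ-cong 4 generating ⟩
  θ 4 f₃f₆             ∎
  where
  open ≈-Reasoning
  generating : f₁f₂ · a₃ ≈ f₃f₆
  generating = mk≈ λ n → trans (·-cong≤ n (λ i _ → ·-⊛ (f 1) (f 2) i) (λ _ _ → refl))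
    (trans (·-⊛ (f 1 ⊛ f 2) a₃ n) (trans (a₃-generatingFunction n) (sym (·-⊛ (f 3) (f 6) n))))

θF≈E : θ 3 F ≈ E
θF≈E = ≈-trans (≈-sym (θ₄θ₃ f₁f₂)) (θ-cong 4 θ-f₁f₂)

αβ≈E² : α · β ≈ E · E
αβ≈E² = ≈-trans (≈-sym (θ-· 3 α₀ β₀)) (≈-trans (θ-cong 4 α₀β₀) (θ-· 3 f₃f₆ f₃f₆))

-- Since 4 ≡ 1 modulo 3, q ↦ q⁴ keeps the components in their places; q⁴ = q · q³ and q⁸ = q² · q⁶
-- account for the new factors `q₁` and `q₁ ↑ 2`.
F≈T : F ≈ T α (⊝ (q₁ · E)) (⟨ ℤ.- ℤ.+ 2 ⟩ · (q₁ ↑ 2 · β))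
F≈T = begin
  θ 4 f₁f₂
    ≈⟨ θ-cong 4 f₁f₂-dissection ⟩
  θ 4 (T α₀ (⊝ f₃f₆) (⟨ ℤ.- ℤ.+ 2 ⟩ · β₀))
    ≈⟨ ≈-trans (θ-⊕ 4 _ _) (R.+-cong (≈-trans (θ-⊕ 4 _ _) (R.+-cong (θ₄θ₃ α₀) (≈-trans (θ-· 3 _ _) (R.*-cong θ₄-q₁ (θ₄θ₃ _)))))
         (≈-trans (θ-· 3 _ _) (R.*-cong (≈-trans (θ-· 3 q₁ q₁) (R.*-cong θ₄-q₁ θ₄-q₁)) (θ₄θ₃ _)))) ⟩
  θ 3 α ⊕ q₁ ↑ 4 · θ 3 (θ 4 (⊝ f₃f₆)) ⊕ q₁ ↑ 4 · q₁ ↑ 4 · θ 3 (θ 4 (⟨ ℤ.- ℤ.+ 2 ⟩ · β₀))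
    ≈⟨ R.+-cong (R.+-congˡ (R.*-congˡ (≈-trans (θ-cong 3 (θ-⊝ 4 f₃f₆)) (θ-⊝ 3 E))))
         (R.*-congˡ (≈-trans (θ-cong 3 (θ-scale 4 _ β₀)) (θ-scale 3 _ β))) ⟩
  θ 3 α ⊕ q₁ ↑ 4 · ⊝ θ 3 E ⊕ q₁ ↑ 4 · q₁ ↑ 4 · (⟨ ℤ.- ℤ.+ 2 ⟩ · θ 3 β)
    ≈⟨ solve 4 (λ q a e b → a :+ q :^ 4 :* (:- e) :+ q :^ 4 :* q :^ 4 :* (con (ℤ.- ℤ.+ 2) :* b)
         := a :+ q :* (:- (q :* q :* q :* e)) :+ q :* q :* (con (ℤ.- ℤ.+ 2) :* ((q :* q :* q) :^ 2 :* b))) ≈-refl q₁ (θ 3 α) (θ 3 E) (θ 3 β) ⟩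
  θ 3 α ⊕ q₁ · ⊝ (q₁ · q₁ · q₁ · θ 3 E) ⊕ q₁ · q₁ · (⟨ ℤ.- ℤ.+ 2 ⟩ · ((q₁ · q₁ · q₁) ↑ 2 · θ 3 β))
    ≈⟨ R.+-cong (R.+-congˡ (R.*-congˡ (≈-trans (θ-⊝ 3 _) (R.-‿cong (≈-trans (θ-· 2 q₁ E) (R.*-congʳ θ-q₁))))))
         (R.*-congˡ (≈-trans (θ-scale 3 _ _) (R.*-congˡ (≈-trans (θ-· 2 _ β) (R.*-congʳ (≈-trans (θ-↑ 2 q₁ 2) (↑-congˡ 2 θ-q₁))))))) ⟨
  T α (⊝ (q₁ · E)) (⟨ ℤ.- ℤ.+ 2 ⟩ · (q₁ ↑ 2 · β)) ∎
  where open ≈-Reasoning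

-- The norm of f₁f₂ after q ↦ q⁴.
ν : PowerSeries
ν = α ↑ 3 ⊕ ⟨ ℤ.- ℤ.+ 7 ⟩ · (q₁ ↑ 4 · E ↑ 3) ⊕ ⟨ ℤ.- ℤ.+ 8 ⟩ · (q₁ ↑ 8 · β ↑ 3)

νE≈F⁴ : ν · E ≈ F ↑ 4
νE≈F⁴ = begin
  ν · E
    ≈⟨ R.*-congʳ (R.+-cong (R.+-cong (θ-↑ 3 α₀ 3)
         (≈-trans (θ-scale 4 _ _) (R.*-congˡ (≈-trans (θ-· 3 _ _) (R.*-cong θ₄-q₁ (θ-↑ 3 f₃f₆ 3))))))
         (≈-trans (θ-scale 4 _ _) (R.*-congˡ (≈-trans (θ-· 3 _ _) (R.*-cong
           (≈-trans (θ-↑ 3 q₁ 2) (≈-trans (↑-congˡ 2 θ₄-q₁) (solve 1 (λ q → (q :^ 4) :^ 2 := q :^ 8) ≈-refl q₁)))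
           (θ-↑ 3 β₀ 3)))))) ⟨
  (θ 4 (α₀ ↑ 3) ⊕ θ 4 (⟨ ℤ.- ℤ.+ 7 ⟩ · (q₁ · f₃f₆ ↑ 3)) ⊕ θ 4 (⟨ ℤ.- ℤ.+ 8 ⟩ · (q₁ ↑ 2 · β₀ ↑ 3))) · E
    ≈⟨ R.*-congʳ (≈-trans (θ-⊕ 4 _ _) (R.+-congʳ (θ-⊕ 4 _ _))) ⟨
  θ 4 (α₀ ↑ 3 ⊕ ⟨ ℤ.- ℤ.+ 7 ⟩ · (q₁ · f₃f₆ ↑ 3) ⊕ ⟨ ℤ.- ℤ.+ 8 ⟩ · (q₁ ↑ 2 · β₀ ↑ 3)) · E
    ≈⟨ R.*-congʳ (θ-cong 4 norm-f₁f₂) ⟨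
  θ 4 (norm f₁f₂) · θ 4 f₃f₆
    ≈⟨ θ-· 3 _ _ ⟨
  θ 4 (norm f₁f₂ · f₃f₆)
    ≈⟨ ≈-trans (θ-cong 4 norm-f₁f₂·f₃f₆) (θ-↑ 3 f₁f₂ 4) ⟩
  F ↑ 4 ∎
  where open ≈-Reasoning

-- `M` is the product of the two other conjugates of `F`. If `F` is `T X Y Z`, its components are X²
-- - qYZ, qZ² - XY and Y² - XZ; by α β = E² the last one is 3 q² E², the source of the factor 3 in
-- `U-s`. `K` is minus the middle term of `F`.
B G K M μ₀ μ₁ μ₂ : PowerSeries
B = θ 3 A
G = θ 3 E
K = q₁ ↑ 4 · G
μ₀ = α ↑ 2 ⊕ ⟨ ℤ.- ℤ.+ 2 ⟩ · (q₁ ↑ 4 · β · E)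
μ₁ = q₁ · (α · E ⊕ ⟨ ℤ.+ 4 ⟩ · (q₁ ↑ 4 · β ↑ 2))
μ₂ = ⟨ ℤ.+ 3 ⟩ · (q₁ ↑ 2 · E ↑ 2)
M = T μ₀ μ₁ μ₂

F₀≡1 : F 0 ≡ 1ℤ
F₀≡1 = ·-zero (f 1) (f 2)

E₀≡1 : E 0 ≡ 1ℤ
E₀≡1 = ·-zero (f 3) (f 6)

·-constant : ∀ {X Y} → X 0 ≡ 1ℤ → Y 0 ≡ 1ℤ → (X · Y) 0 ≡ 1ℤ
·-constant {X} {Y} p r = trans (·-zero X Y) (cong₂ ℤ._*_ p r)

↑-constant : ∀ {X} k → X 0 ≡ 1ℤ → (X ↑ k) 0 ≡ 1ℤ
↑-constant     zero    p = refl
↑-constant {X} (suc k) p = ·-constant {X} {X ↑ k} p (↑-constant {X} k p)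

T-00 : ∀ X → T X ⟨ 0ℤ ⟩ ⟨ 0ℤ ⟩ ≈ θ 3 X
T-00 X = ≈-trans (R.+-cong (R.+-congˡ (R.*-congˡ θ-0)) (R.*-congˡ θ-0))
  (solve 2 (λ q x → x :+ q :* con 0ℤ :+ q :* q :* con 0ℤ := x) ≈-refl q₁ (θ 3 X))

FM≈θν : F · M ≈ θ 3 ν
FM≈θν = begin
  F · M
    ≈⟨ ≈-trans (R.*-congʳ F≈T) (T-· _ _ _ _ _ _) ⟩
  T _ _ _
    ≈⟨ T-cong
         (vanish (⟨ ℤ.- ℤ.+ 4 ⟩ · (q₁ ↑ 4 · E))
           (solve 4 (λ q a e b → a :* m₀ q a e b :+ q :* (:- (q :* e) :* m₂ q a e b :+ con (ℤ.- ℤ.+ 2) :* (q :^ 2 :* b) :* m₁ q a e b)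
             := a :^ 3 :+ con (ℤ.- ℤ.+ 7) :* (q :^ 4 :* e :^ 3) :+ con (ℤ.- ℤ.+ 8) :* (q :^ 8 :* b :^ 3)
                :+ con (ℤ.- ℤ.+ 4) :* (q :^ 4 :* e) :* (a :* b :- e :* e)) ≈-refl q₁ α E β) αβ≈E²)
         (vanish (⟨ ℤ.+ 4 ⟩ · (q₁ ↑ 5 · β))
           (solve 4 (λ q a e b → a :* m₁ q a e b :+ :- (q :* e) :* m₀ q a e b :+ q :* (con (ℤ.- ℤ.+ 2) :* (q :^ 2 :* b) :* m₂ q a e b)
             := con 0ℤ :+ con (ℤ.+ 4) :* (q :^ 5 :* b) :* (a :* b :- e :* e)) ≈-refl q₁ α E β) αβ≈E²)
         (vanish (⟨ ℤ.- ℤ.+ 2 ⟩ · (q₁ ↑ 2 · α))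
           (solve 4 (λ q a e b → a :* m₂ q a e b :+ :- (q :* e) :* m₁ q a e b :+ con (ℤ.- ℤ.+ 2) :* (q :^ 2 :* b) :* m₀ q a e b
             := con 0ℤ :+ con (ℤ.- ℤ.+ 2) :* (q :^ 2 :* a) :* (a :* b :- e :* e)) ≈-refl q₁ α E β) αβ≈E²) ⟩
  T ν ⟨ 0ℤ ⟩ ⟨ 0ℤ ⟩
    ≈⟨ T-00 ν ⟩
  θ 3 ν ∎
  where
  open ≈-Reasoning
  m₀ m₁ m₂ : ∀ {n} (q a e b : Polynomial n) → Polynomial n
  m₀ q a e b = a :^ 2 :+ con (ℤ.- ℤ.+ 2) :* (q :^ 4 :* b :* e)
  m₁ q a e b = q :* (a :* e :+ con (ℤ.+ 4) :* (q :^ 4 :* b :^ 2))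
  m₂ q a e b = con (ℤ.+ 3) :* (q :^ 2 :* e :^ 2)

-- A = E/F with its denominator rationalised by `M`. Since `E` and `G` are series in q³, trisecting
-- `A` is reduced to trisecting `M`.
AE³≈MG : A · E ↑ 3 ≈ M · G
AE³≈MG = ·-cancelˡ F F₀≡1 (begin
  F · (A · E ↑ 3)     ≈⟨ solve 3 (λ f a e → f :* (a :* e) := a :* f :* e) ≈-refl F A (E ↑ 3) ⟩
  A · F · E ↑ 3       ≈⟨ R.*-congʳ AF≈E ⟩
  E ↑ 4               ≈⟨ ↑-congˡ 4 θF≈E ⟨
  θ 3 F ↑ 4           ≈⟨ θ-↑ 2 F 4 ⟨
  θ 3 (F ↑ 4)         ≈⟨ θ-cong 3 νE≈F⁴ ⟨
  θ 3 (ν · E)         ≈⟨ θ-· 2 ν E ⟩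
  θ 3 ν · G           ≈⟨ R.*-congʳ FM≈θν ⟨
  F · M · G           ≈⟨ R.*-assoc _ _ _ ⟩
  F · (M · G)         ∎)
  where open ≈-Reasoning

-- Let a, -K, c be the three terms of `F`. Then M = a² + K² + c² + aK + cK - ac, and α β = E² means
-- ac = -2K². Hence `M` depends on a and c only through a + c = F + K.
M≈FK : M ≈ F ↑ 2 ⊕ ⟨ ℤ.+ 3 ⟩ · (K · F) ⊕ ⟨ ℤ.+ 9 ⟩ · (K · K)
M≈FK = ≈-sym (begin
  F ↑ 2 ⊕ ⟨ ℤ.+ 3 ⟩ · (K · F) ⊕ ⟨ ℤ.+ 9 ⟩ · (K · K)
    ≈⟨ solve 2 (λ f k → f :^ 2 :+ con (ℤ.+ 3) :* (k :* f) :+ con (ℤ.+ 9) :* (k :* k)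
         := (f :+ con (ℤ.+ 3) :* k) :* f :+ con (ℤ.+ 9) :* (k :* k)) ≈-refl F K ⟩
  (F ⊕ ⟨ ℤ.+ 3 ⟩ · K) · F ⊕ ⟨ ℤ.+ 9 ⟩ · (K · K)
    ≈⟨ R.+-cong (R.*-cong (≈-trans (R.+-cong F≈T (≈-trans (R.*-congˡ K≈T) (⟨⟩·T _ _ _ _))) (T-⊕ _ _ _ _ _ _)) F≈T)
         (R.*-congˡ (R.*-cong K≈T K≈T)) ⟩
  T _ _ _ · T _ _ _ ⊕ ⟨ ℤ.+ 9 ⟩ · (T _ _ _ · T _ _ _)
    ≈⟨ R.+-cong (T-· _ _ _ _ _ _) (≈-trans (R.*-congˡ (T-· _ _ _ _ _ _)) (⟨⟩·T _ _ _ _)) ⟩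
  T _ _ _ ⊕ T _ _ _
    ≈⟨ T-⊕ _ _ _ _ _ _ ⟩
  T _ _ _
    ≈⟨ T-cong
         (solve 4 (λ q a e b → x q a e b :* a :+ q :* (y q a e b :* c q a e b :+ z q a e b :* d q a e b)
             :+ con (ℤ.+ 9) :* (con 0ℤ :* con 0ℤ :+ q :* (q :* e :* con 0ℤ :+ con 0ℤ :* (q :* e)))
           := a :^ 2 :+ con (ℤ.- ℤ.+ 2) :* (q :^ 4 :* b :* e)) ≈-refl q₁ α E β)
         (solve 4 (λ q a e b → x q a e b :* d q a e b :+ y q a e b :* a :+ q :* (z q a e b :* c q a e b)
             :+ con (ℤ.+ 9) :* (con 0ℤ :* (q :* e) :+ q :* e :* con 0ℤ :+ q :* (con 0ℤ :* con 0ℤ))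
           := q :* (a :* e :+ con (ℤ.+ 4) :* (q :^ 4 :* b :^ 2))) ≈-refl q₁ α E β)
         (vanish (⟨ ℤ.- ℤ.+ 4 ⟩ · q₁ ↑ 2)
           (solve 4 (λ q a e b → x q a e b :* c q a e b :+ y q a e b :* d q a e b :+ z q a e b :* a
               :+ con (ℤ.+ 9) :* (con 0ℤ :* con 0ℤ :+ q :* e :* (q :* e) :+ con 0ℤ :* con 0ℤ)
             := con (ℤ.+ 3) :* (q :^ 2 :* e :^ 2) :+ con (ℤ.- ℤ.+ 4) :* q :^ 2 :* (a :* b :- e :* e)) ≈-refl q₁ α E β) αβ≈E²) ⟩
  M ∎)
  where
  open ≈-Reasoning
  c d x y z : ∀ {n} (q a e b : Polynomial n) → Polynomial n
  c q a e b = con (ℤ.- ℤ.+ 2) :* (q :^ 2 :* b)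
  d q a e b = :- (q :* e)
  x q a e b = a :+ con (ℤ.+ 3) :* con 0ℤ
  y q a e b = d q a e b :+ con (ℤ.+ 3) :* (q :* e)
  z q a e b = c q a e b :+ con (ℤ.+ 3) :* con 0ℤ
  K≈T : K ≈ T ⟨ 0ℤ ⟩ (q₁ · E) ⟨ 0ℤ ⟩
  K≈T = ≈-trans
    (solve 2 (λ q g → q :^ 4 :* g := con 0ℤ :+ q :* (q :* q :* q :* g) :+ q :* q :* con 0ℤ) ≈-refl q₁ G)
    (≈-sym (R.+-cong (R.+-cong θ-0 (R.*-congˡ (≈-trans (θ-· 2 q₁ E) (R.*-congʳ θ-q₁)))) (R.*-congˡ θ-0)))

BE≈G : B · E ≈ G
BE≈G = ≈-trans (R.*-congˡ (≈-sym θF≈E)) (≈-trans (≈-sym (θ-· 2 A F)) (θ-cong 3 AF≈E))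

S≈q³B : S ≈ q₁ ↑ 3 · B
S≈q³B = ≈-trans (θ-· 2 q₁ A) (R.*-congʳ (≈-trans θ-q₁ (solve 1 (λ q → q :* q :* q := q :^ 3) ≈-refl q₁)))

-- This is `M≈FK` divided by F²: K/F = S s, q³G/E = S, and M/F² = E s³/(q³G) = s³/S. The factor
-- `E · F ↑ 3` clears all denominators.
s³ : s ↑ 3 ≈ S ⊕ ⟨ ℤ.+ 3 ⟩ · (S ↑ 2 · s) ⊕ ⟨ ℤ.+ 9 ⟩ · (S ↑ 3 · s ↑ 2)
s³ = ·-cancelˡ (E · F ↑ 3) (·-constant {E} {F ↑ 3} E₀≡1 (↑-constant {F} 3 F₀≡1)) (begin
  E · F ↑ 3 · s ↑ 3
    ≈⟨ solve 4 (λ q a e f → e :* f :^ 3 :* (q :* a) :^ 3 := q :^ 3 :* ((a :* f) :^ 3 :* e)) ≈-refl q₁ A E F ⟩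
  q₁ ↑ 3 · ((A · F) ↑ 3 · E)
    ≈⟨ R.*-congˡ (R.*-cong (↑-congˡ 3 AF≈E) (≈-sym AF≈E)) ⟩
  q₁ ↑ 3 · (E ↑ 3 · (A · F))
    ≈⟨ solve 4 (λ q a e f → q :^ 3 :* (e :^ 3 :* (a :* f)) := q :^ 3 :* f :* (a :* e :^ 3)) ≈-refl q₁ A E F ⟩
  q₁ ↑ 3 · F · (A · E ↑ 3)
    ≈⟨ R.*-congˡ (≈-trans AE³≈MG (R.*-congʳ M≈FK)) ⟩
  q₁ ↑ 3 · F · ((F ↑ 2 ⊕ ⟨ ℤ.+ 3 ⟩ · (K · F) ⊕ ⟨ ℤ.+ 9 ⟩ · (K · K)) · G)
    ≈⟨ solve 3 (λ q f g → q :^ 3 :* f :* ((f :^ 2 :+ con (ℤ.+ 3) :* (q :^ 4 :* g :* f) :+ con (ℤ.+ 9) :* (q :^ 4 :* g :* (q :^ 4 :* g))) :* g)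
         := q :^ 3 :* g :* f :^ 3 :+ con (ℤ.+ 3) :* (q :^ 7 :* (g :* g) :* f :^ 2) :+ con (ℤ.+ 9) :* (q :^ 11 :* (g :* g :* g) :* f))
         ≈-refl q₁ F G ⟩
  q₁ ↑ 3 · G · F ↑ 3 ⊕ ⟨ ℤ.+ 3 ⟩ · (q₁ ↑ 7 · (G · G) · F ↑ 2) ⊕ ⟨ ℤ.+ 9 ⟩ · (q₁ ↑ 11 · (G · G · G) · F)
    ≈⟨ R.+-cong (R.+-cong (R.*-congʳ (R.*-congˡ BE≈G)) (R.*-congˡ (R.*-congʳ (R.*-congˡ (R.*-cong BE≈G BAF≈G)))))
         (R.*-congˡ (R.*-congʳ (R.*-congˡ (R.*-cong (R.*-cong BE≈G BAF≈G) BAF≈G)))) ⟨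
  q₁ ↑ 3 · (B · E) · F ↑ 3 ⊕ ⟨ ℤ.+ 3 ⟩ · (q₁ ↑ 7 · (B · E · (B · (A · F))) · F ↑ 2)
    ⊕ ⟨ ℤ.+ 9 ⟩ · (q₁ ↑ 11 · (B · E · (B · (A · F)) · (B · (A · F))) · F)
    ≈⟨ solve 5 (λ q a b e f → q :^ 3 :* (b :* e) :* f :^ 3 :+ con (ℤ.+ 3) :* (q :^ 7 :* (b :* e :* (b :* (a :* f))) :* f :^ 2)
           :+ con (ℤ.+ 9) :* (q :^ 11 :* (b :* e :* (b :* (a :* f)) :* (b :* (a :* f))) :* f)
         := e :* f :^ 3 :* (q :^ 3 :* b :+ con (ℤ.+ 3) :* ((q :^ 3 :* b) :^ 2 :* (q :* a)) :+ con (ℤ.+ 9) :* ((q :^ 3 :* b) :^ 3 :* (q :* a) :^ 2)))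
         ≈-refl q₁ A B E F ⟩
  E · F ↑ 3 · (q₁ ↑ 3 · B ⊕ ⟨ ℤ.+ 3 ⟩ · ((q₁ ↑ 3 · B) ↑ 2 · s) ⊕ ⟨ ℤ.+ 9 ⟩ · ((q₁ ↑ 3 · B) ↑ 3 · s ↑ 2))
    ≈⟨ R.*-congˡ (R.+-cong (R.+-cong S≈q³B (R.*-congˡ (R.*-congʳ (↑-congˡ 2 S≈q³B)))) (R.*-congˡ (R.*-congʳ (↑-congˡ 3 S≈q³B)))) ⟨
  E · F ↑ 3 · (S ⊕ ⟨ ℤ.+ 3 ⟩ · (S ↑ 2 · s) ⊕ ⟨ ℤ.+ 9 ⟩ · (S ↑ 3 · s ↑ 2)) ∎)
  where
  open ≈-Reasoning
  BAF≈G : B · (A · F) ≈ G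
  BAF≈G = ≈-trans (R.*-congˡ AF≈E) BE≈G

θ-F↑ : ∀ k → θ 3 (F ↑ k) ≈ E ↑ k
θ-F↑ k = ≈-trans (θ-↑ 2 F k) (↑-congˡ k θF≈E)

-- Multiplication by q brings the last component `μ₂` of `M` into first place, where `U` reads it.
U-s : U s ≈ ⟨ ℤ.+ 3 ⟩ · s ↑ 3
U-s = ·-cancelˡ (F ↑ 3) (↑-constant {F} 3 F₀≡1) (begin
  F ↑ 3 · U s
    ≈⟨ U-θ· (F ↑ 3) s ⟨
  U (θ 3 (F ↑ 3) · s)
    ≈⟨ U-cong (begin
         θ 3 (F ↑ 3) · s                       ≈⟨ R.*-congʳ (θ-F↑ 3) ⟩
         E ↑ 3 · (q₁ · A)                      ≈⟨ solve 3 (λ e q a → e :* (q :* a) := q :* (a :* e)) ≈-refl (E ↑ 3) q₁ A ⟩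
         q₁ · (A · E ↑ 3)                      ≈⟨ R.*-congˡ AE³≈MG ⟩
         q₁ · (M · G)                          ≈⟨ solve 3 (λ q m g → q :* (m :* g) := g :* (q :* m)) ≈-refl q₁ M G ⟩
         θ 3 E · (q₁ · T μ₀ μ₁ μ₂)             ≈⟨ ≈-trans (R.*-congˡ (q₁·T μ₀ μ₁ μ₂)) (θ·T E _ _ _) ⟩
         T (E · (q₁ · μ₂)) (E · μ₀) (E · μ₁)   ∎) ⟩
  U (T (E · (q₁ · μ₂)) (E · μ₀) (E · μ₁))
    ≈⟨ U-T _ _ _ ⟩
  E · (q₁ · μ₂)
    ≈⟨ solve 2 (λ q e → e :* (q :* (con (ℤ.+ 3) :* (q :^ 2 :* e :^ 2))) := con (ℤ.+ 3) :* (q :^ 3 :* e :^ 3)) ≈-refl q₁ E ⟩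
  ⟨ ℤ.+ 3 ⟩ · (q₁ ↑ 3 · E ↑ 3)
    ≈⟨ R.*-congˡ (R.*-congˡ (↑-congˡ 3 AF≈E)) ⟨
  ⟨ ℤ.+ 3 ⟩ · (q₁ ↑ 3 · (A · F) ↑ 3)
    ≈⟨ solve 3 (λ q a f → con (ℤ.+ 3) :* (q :^ 3 :* (a :* f) :^ 3)
           := f :^ 3 :* (con (ℤ.+ 3) :* (q :* a) :^ 3)) ≈-refl q₁ A F ⟩
  F ↑ 3 · (⟨ ℤ.+ 3 ⟩ · s ↑ 3) ∎)
  where open ≈-Reasoning

-- Here q² brings the middle component of M² into first place. Modulo α β = E² it is a combination
-- of ν E = F⁴ and E⁴, which become s² and s⁶ after division by F⁶.
U-s² : U (s ↑ 2) ≈ ⟨ ℤ.+ 2 ⟩ · s ↑ 2 ⊕ ⟨ ℤ.+ 27 ⟩ · s ↑ 6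
U-s² = ·-cancelˡ (F ↑ 6) (↑-constant {F} 6 F₀≡1) (begin
  F ↑ 6 · U (s ↑ 2)
    ≈⟨ U-θ· (F ↑ 6) (s ↑ 2) ⟨
  U (θ 3 (F ↑ 6) · s ↑ 2)
    ≈⟨ U-cong (begin
         θ 3 (F ↑ 6) · s ↑ 2             ≈⟨ R.*-congʳ (θ-F↑ 6) ⟩
         E ↑ 6 · (q₁ · A) ↑ 2            ≈⟨ solve 3 (λ e q a → e :^ 6 :* (q :* a) :^ 2
                := q :^ 2 :* (a :* e :^ 3) :^ 2) ≈-refl E q₁ A ⟩
         q₁ ↑ 2 · (A · E ↑ 3) ↑ 2        ≈⟨ R.*-congˡ (↑-congˡ 2 AE³≈MG) ⟩
         q₁ ↑ 2 · (M · G) ↑ 2            ≈⟨ solve 3 (λ q m g → q :^ 2 :* (m :* g) :^ 2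
                := g :^ 2 :* (q :* (q :* (m :* m)))) ≈-refl q₁ M G ⟩
         G ↑ 2 · (q₁ · (q₁ · (M · M)))   ≈⟨ R.*-cong (≈-sym (θ-↑ 2 E 2)) (≈-trans (R.*-congˡ (≈-trans (R.*-congˡ (T-· _ _ _ _ _ _)) (q₁·T _ _ _))) (q₁·T _ _ _)) ⟩
         θ 3 (E ↑ 2) · T (q₁ · m) _ _    ≈⟨ θ·T (E ↑ 2) _ _ _ ⟩
         T (E ↑ 2 · (q₁ · m)) _ _        ∎) ⟩
  U (T (E ↑ 2 · (q₁ · m)) _ _)
    ≈⟨ U-T _ _ _ ⟩
  E ↑ 2 · (q₁ · m)
    ≈⟨ R.*-congˡ (vanish (⟨ ℤ.+ 2 ⟩ · (q₁ ↑ 6 · (⟨ ℤ.+ 4 ⟩ · (α · β) ⊕ ⟨ ℤ.+ 2 ⟩ · (E · E))))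
         (solve 4 (λ q a e b → q :* (m₀ q a e b :* m₁ q a e b :+ m₁ q a e b :* m₀ q a e b :+ q :* (m₂ q a e b :* m₂ q a e b))
           := con (ℤ.+ 2) :* (q :^ 2 :* ((a :^ 3 :+ con (ℤ.- ℤ.+ 7) :* (q :^ 4 :* e :^ 3) :+ con (ℤ.- ℤ.+ 8) :* (q :^ 8 :* b :^ 3)) :* e))
              :+ con (ℤ.+ 27) :* (q :^ 6 :* e :^ 4)
              :+ con (ℤ.+ 2) :* (q :^ 6 :* (con (ℤ.+ 4) :* (a :* b) :+ con (ℤ.+ 2) :* (e :* e))) :* (a :* b :- e :* e)) ≈-refl q₁ α E β)
         αβ≈E²) ⟩
  E ↑ 2 · (⟨ ℤ.+ 2 ⟩ · (q₁ ↑ 2 · (ν · E)) ⊕ ⟨ ℤ.+ 27 ⟩ · (q₁ ↑ 6 · E ↑ 4))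
    ≈⟨ R.*-cong (↑-congˡ 2 (≈-sym AF≈E))
         (R.+-cong (R.*-congˡ (R.*-congˡ νE≈F⁴)) (R.*-congˡ (R.*-congˡ (↑-congˡ 4 (≈-sym AF≈E))))) ⟩
  (A · F) ↑ 2 · (⟨ ℤ.+ 2 ⟩ · (q₁ ↑ 2 · F ↑ 4) ⊕ ⟨ ℤ.+ 27 ⟩ · (q₁ ↑ 6 · (A · F) ↑ 4))
    ≈⟨ solve 3 (λ q a f → (a :* f) :^ 2 :* (con (ℤ.+ 2) :* (q :^ 2 :* f :^ 4) :+ con (ℤ.+ 27) :* (q :^ 6 :* (a :* f) :^ 4))
         := f :^ 6 :* (con (ℤ.+ 2) :* (q :* a) :^ 2 :+ con (ℤ.+ 27) :* (q :* a) :^ 6)) ≈-refl q₁ A F ⟩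
  F ↑ 6 · (⟨ ℤ.+ 2 ⟩ · s ↑ 2 ⊕ ⟨ ℤ.+ 27 ⟩ · s ↑ 6) ∎)
  where
  open ≈-Reasoning
  m : PowerSeries
  m = μ₀ · μ₁ ⊕ μ₁ · μ₀ ⊕ q₁ · (μ₂ · μ₂)
  m₀ m₁ m₂ : ∀ {n} (q a e b : Polynomial n) → Polynomial n
  m₀ q a e b = a :^ 2 :+ con (ℤ.- ℤ.+ 2) :* (q :^ 4 :* b :* e)
  m₁ q a e b = q :* (a :* e :+ con (ℤ.+ 4) :* (q :^ 4 :* b :^ 2))
  m₂ q a e b = con (ℤ.+ 3) :* (q :^ 2 :* e :^ 2)

-- The action of U on polynomials in s

U-scale : ∀ c X → U (⟨ c ⟩ · X) ≈ ⟨ c ⟩ · U X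
U-scale c X = ≈-trans (U-cong (R.*-congʳ (≈-sym (θ-⟨⟩ 3 c)))) (U-θ· ⟨ c ⟩ X)

-- `S` is a series in q³ and leaves `U` as `s`. One of the two factors 3 in the coefficient 9 stays
-- inside `U` next to s², the form in which images of this type are recorded below.
U-s³· : ∀ X → U (s ↑ 3 · X) ≈ s · U X ⊕ ⟨ + 3 ⟩ · (s ↑ 2 · U (s · X)) ⊕ ⟨ + 3 ⟩ · (s ↑ 3 · U (⟨ + 3 ⟩ · (s ↑ 2 · X)))
U-s³· X = begin
  U (s ↑ 3 · X)
    ≈⟨ U-cong (≈-trans (R.*-congʳ s³)
         (solve 3 (λ S s x → (S :+ con (+ 3) :* (S :^ 2 :* s) :+ con (+ 9) :* (S :^ 3 :* s :^ 2)) :* x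
             := S :* x :+ con (+ 3) :* (S :^ 2 :* (s :* x)) :+ con (+ 3) :* (S :^ 3 :* (con (+ 3) :* (s :^ 2 :* x)))) ≈-refl S s X)) ⟩
  U (S · X ⊕ ⟨ + 3 ⟩ · (S ↑ 2 · (s · X)) ⊕ ⟨ + 3 ⟩ · (S ↑ 3 · (⟨ + 3 ⟩ · (s ↑ 2 · X))))
    ≈⟨ ≈-trans (U-⊕ _ _) (R.+-congʳ (U-⊕ _ _)) ⟩
  U (S · X) ⊕ U (⟨ + 3 ⟩ · (S ↑ 2 · (s · X))) ⊕ U (⟨ + 3 ⟩ · (S ↑ 3 · (⟨ + 3 ⟩ · (s ↑ 2 · X))))
    ≈⟨ R.+-cong (R.+-cong (U-θ· s X) (≈-trans (U-scale (+ 3) _) (R.*-congˡ (U-S↑· 2 _)))) (≈-trans (U-scale (+ 3) _) (R.*-congˡ (U-S↑· 3 _))) ⟩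
  s · U X ⊕ ⟨ + 3 ⟩ · (s ↑ 2 · U (s · X)) ⊕ ⟨ + 3 ⟩ · (s ↑ 3 · U (⟨ + 3 ⟩ · (s ↑ 2 · X))) ∎
  where
  open ≈-Reasoning
  U-S↑· : ∀ k Y → U (S ↑ k · Y) ≈ s ↑ k · U Y
  U-S↑· k Y = ≈-trans (U-cong (R.*-congʳ (≈-sym (θ-↑ 2 s k)))) (U-θ· (s ↑ k) Y)

-- With this weight the images stay integral: U s² = s² (2 + 3t) and U s³ = s (1 + 3t + 3t²).
t : PowerSeries
t = ⟨ + 9 ⟩ · s ↑ 4

infixl 6 _∔_
infix  7 t·_

-- Membership in ℤ[t].
data Λ : PowerSeries → Set where
  scalar : ∀ c → Λ ⟨ c ⟩
  _∔_    : ∀ {X Y} → Λ X → Λ Y → Λ (X ⊕ Y)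
  t·_    : ∀ {X} → Λ X → Λ (t · X)
  resp   : ∀ {X Y} → X ≈ Y → Λ X → Λ Y

Λ-scale : ∀ c {X} → Λ X → Λ (⟨ c ⟩ · X)
Λ-scale c (scalar d) = resp (⟨⟩-* c d) (scalar (c ℤ.* d))
Λ-scale c (x ∔ y)    = resp (≈-sym (R.distribˡ _ _ _)) (Λ-scale c x ∔ Λ-scale c y)
Λ-scale c (t· x)     = resp (solve 3 (λ c t x → t :* (c :* x) := c :* (t :* x)) ≈-refl _ _ _) (t· Λ-scale c x)
Λ-scale c (resp p x) = resp (R.*-congˡ p) (Λ-scale c x)

-- U maps ℤ[t], s ℤ[t], 3s² ℤ[t] and s³ ℤ[t] into ℤ[t], 3s³ ℤ[t], 3s² ℤ[t] and
-- s ℤ[t]; in 3s³ ℤ[t] the coefficients of t, t², … are moreover divisible by 3.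
record UImage (X : PowerSeries) : Set where
  field
    {Y₀ Y₁ Y₂ Y₃} : PowerSeries
    c₁  : ℤ
    ΛY₀ : Λ Y₀
    ΛY₁ : Λ Y₁
    ΛY₂ : Λ Y₂
    ΛY₃ : Λ Y₃
    U₀  : U X ≈ Y₀
    U₁  : U (s · X) ≈ ⟨ + 3 ⟩ · (s ↑ 3 · (⟨ c₁ ⟩ ⊕ ⟨ + 3 ⟩ · Y₁))
    U₂  : U (⟨ + 3 ⟩ · (s ↑ 2 · X)) ≈ ⟨ + 3 ⟩ · (s ↑ 2 · Y₂)
    U₃  : U (s ↑ 3 · X) ≈ s · Y₃

open UImage

uImage-scalar : ∀ c → UImage ⟨ c ⟩
uImage-scalar c = record
  { c₁  = c
  ; ΛY₀ = scalar c
  ; ΛY₁ = scalar 0ℤ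
  ; ΛY₂ = scalar (c ℤ.* + 2) ∔ Λ-scale (+ 3) (t· scalar c)
  ; ΛY₃ = Λ-scale c (scalar 1ℤ ∔ Λ-scale (+ 3) (t· (scalar 1ℤ ∔ t· scalar 1ℤ)))
  ; U₀  = U-c
  ; U₁  = ≈-trans U-sc (solve 2 (λ s c → con (+ 3) :* (s :^ 3 :* c)
         := con (+ 3) :* (s :^ 3 :* (c :+ con (+ 3) :* con 0ℤ))) ≈-refl s ⟨ c ⟩)
  ; U₂  = ≈-trans U-s²c (≈-trans
      (solve 2 (λ s c → con (+ 3) :* (c :* (con (+ 2) :* s :^ 2 :+ con (+ 27) :* s :^ 6))
         := con (+ 3) :* (s :^ 2 :* (c :* con (+ 2) :+ con (+ 3) :* (con (+ 9) :* s :^ 4 :* c)))) ≈-refl s ⟨ c ⟩)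
      (R.*-congˡ (R.*-congˡ (R.+-congʳ (≈-sym (⟨⟩-* c (+ 2)))))))
  ; U₃  = ≈-trans (U-s³· ⟨ c ⟩) (≈-trans
      (R.+-cong (R.+-cong (R.*-congˡ U-c) (R.*-congˡ (R.*-congˡ U-sc))) (R.*-congˡ (R.*-congˡ U-s²c)))
      (solve 2 (λ s c → s :* c :+ con (+ 3) :* (s :^ 2 :* (con (+ 3) :* (s :^ 3 :* c)))
           :+ con (+ 3) :* (s :^ 3 :* (con (+ 3) :* (c :* (con (+ 2) :* s :^ 2 :+ con (+ 27) :* s :^ 6))))
         := s :* (c :* (con 1ℤ :+ con (+ 3) :* (con (+ 9) :* s :^ 4 :* (con 1ℤ :+ con (+ 9) :* s :^ 4 :* con 1ℤ))))) ≈-refl s ⟨ c ⟩))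
  }
  where
  U-c : U ⟨ c ⟩ ≈ ⟨ c ⟩
  U-c = ≈-trans (U-cong (≈-sym (θ-⟨⟩ 3 c))) (U-θ ⟨ c ⟩)
  U-sc : U (s · ⟨ c ⟩) ≈ ⟨ + 3 ⟩ · (s ↑ 3 · ⟨ c ⟩)
  U-sc = ≈-trans (U-cong (R.*-comm _ _)) (≈-trans (U-scale c s) (≈-trans (R.*-congˡ U-s)
    (solve 2 (λ s c → c :* (con (+ 3) :* s) := con (+ 3) :* (s :* c)) ≈-refl (s ↑ 3) ⟨ c ⟩)))
  U-s²c : U (⟨ + 3 ⟩ · (s ↑ 2 · ⟨ c ⟩)) ≈ ⟨ + 3 ⟩ · (⟨ c ⟩ · (⟨ + 2 ⟩ · s ↑ 2 ⊕ ⟨ + 27 ⟩ · s ↑ 6))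
  U-s²c = ≈-trans (U-scale (+ 3) _) (R.*-congˡ (≈-trans (U-cong (R.*-comm _ _)) (≈-trans (U-scale c _) (R.*-congˡ U-s²))))

uImage-⊕ : ∀ {X X′} → UImage X → UImage X′ → UImage (X ⊕ X′)
uImage-⊕ x x′ = record
  { c₁  = c₁ x ℤ.+ c₁ x′
  ; ΛY₀ = ΛY₀ x ∔ ΛY₀ x′
  ; ΛY₁ = ΛY₁ x ∔ ΛY₁ x′
  ; ΛY₂ = ΛY₂ x ∔ ΛY₂ x′
  ; ΛY₃ = ΛY₃ x ∔ ΛY₃ x′
  ; U₀  = ≈-trans (U-⊕ _ _) (R.+-cong (U₀ x) (U₀ x′))
  ; U₁  = ≈-trans (U-cong (R.distribˡ _ _ _)) (≈-trans (U-⊕ _ _) (≈-trans (R.+-cong (U₁ x) (U₁ x′)) (≈-trans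
      (solve 5 (λ s c c′ y y′ → con (+ 3) :* (s :* (c :+ con (+ 3) :* y)) :+ con (+ 3) :* (s :* (c′ :+ con (+ 3) :* y′))
         := con (+ 3) :* (s :* (c :+ c′ :+ con (+ 3) :* (y :+ y′)))) ≈-refl (s ↑ 3) ⟨ c₁ x ⟩ ⟨ c₁ x′ ⟩ (Y₁ x) (Y₁ x′))
      (R.*-congˡ (R.*-congˡ (R.+-congʳ (≈-sym (⟨⟩-+ (c₁ x) (c₁ x′)))))))))
  ; U₂  = ≈-trans (U-cong (3s²-distrib _ _)) (≈-trans (U-⊕ _ _) (≈-trans (R.+-cong (U₂ x) (U₂ x′)) (≈-sym (3s²-distrib _ _))))
  ; U₃  = ≈-trans (U-cong (R.distribˡ _ _ _)) (≈-trans (U-⊕ _ _) (≈-trans (R.+-cong (U₃ x) (U₃ x′)) (≈-sym (R.distribˡ _ _ _))))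
  }
  where
  3s²-distrib : ∀ X Y → ⟨ + 3 ⟩ · (s ↑ 2 · (X ⊕ Y)) ≈ ⟨ + 3 ⟩ · (s ↑ 2 · X) ⊕ ⟨ + 3 ⟩ · (s ↑ 2 · Y)
  3s²-distrib X Y = solve 3 (λ s x y → con (+ 3) :* (s :* (x :+ y))
         := con (+ 3) :* (s :* x) :+ con (+ 3) :* (s :* y)) ≈-refl (s ↑ 2) X Y

uImage-resp : ∀ {X X′} → X ≈ X′ → UImage X → UImage X′
uImage-resp p x = record
  { c₁  = c₁ x
  ; ΛY₀ = ΛY₀ x
  ; ΛY₁ = ΛY₁ x
  ; ΛY₂ = ΛY₂ x
  ; ΛY₃ = ΛY₃ x
  ; U₀  = ≈-trans (U-cong (≈-sym p)) (U₀ x)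
  ; U₁  = ≈-trans (U-cong (R.*-congˡ (≈-sym p))) (U₁ x)
  ; U₂  = ≈-trans (U-cong (R.*-congˡ (R.*-congˡ (≈-sym p)))) (U₂ x)
  ; U₃  = ≈-trans (U-cong (R.*-congˡ (≈-sym p))) (U₃ x)
  }

-- Since t s^i = 9 s³ s^(i+1), `U-s³·` expresses each image through those of the next three powers
-- of s. The order matters: `V₀` needs only the data of `X`, `V₁` also uses `V₀`, `V₂` uses both,
-- and the image of s³ uses all three. The image of s t X is 9 s³ W, so `t` contributes nothing to
-- `c₁` and everything beyond c₁ carries the extra 3.
uImage-t· : ∀ {X} → Λ X → UImage X → UImage (t · X)
uImage-t· {X} Λx x = record
  { c₁  = 0ℤ
  ; ΛY₀ = ΛZ₀
  ; ΛY₁ = ΛW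
  ; ΛY₂ = ΛZ₂
  ; ΛY₃ = ΛZ₀ ∔ (t· (Λ-scale (+ 3) ΛW ∔ ΛZ₂))
  ; U₀  = V₀
  ; U₁  = V₁
  ; U₂  = V₂
  ; U₃  = ≈-trans (U-s³· (t · X)) (≈-trans (R.+-cong (R.+-cong (R.*-congˡ V₀) (R.*-congˡ (R.*-congˡ V₁))) (R.*-congˡ (R.*-congˡ V₂)))
      (solve 4 (λ s z₀ w z₂ → s :* z₀ :+ con (+ 3) :* (s :^ 2 :* (con (+ 3) :* (s :^ 3 :* (con 0ℤ :+ con (+ 3) :* w))))
           :+ con (+ 3) :* (s :^ 3 :* (con (+ 3) :* (s :^ 2 :* z₂)))
         := s :* (z₀ :+ con (+ 9) :* s :^ 4 :* (con (+ 3) :* w :+ z₂))) ≈-refl s Z₀ W Z₂))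
  }
  where
  open ≈-Reasoning
  y₁ = ⟨ c₁ x ⟩ ⊕ ⟨ + 3 ⟩ · Y₁ x
  Z₀ W Z₂ : PowerSeries
  Z₀ = t · (⟨ + 3 ⟩ · y₁ ⊕ ⟨ + 3 ⟩ · Y₂ x ⊕ ⟨ + 9 ⟩ · Y₃ x)
  W  = Y₂ x ⊕ ⟨ + 3 ⟩ · Y₃ x ⊕ Z₀
  Z₂ = ⟨ + 9 ⟩ · Y₃ x ⊕ ⟨ + 3 ⟩ · Z₀ ⊕ ⟨ + 9 ⟩ · (t · W)
  ΛZ₀ : Λ Z₀
  ΛZ₀ = t· (Λ-scale (+ 3) (scalar (c₁ x) ∔ Λ-scale (+ 3) (ΛY₁ x)) ∔ Λ-scale (+ 3) (ΛY₂ x) ∔ Λ-scale (+ 9) (ΛY₃ x))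
  ΛW : Λ W
  ΛW = ΛY₂ x ∔ Λ-scale (+ 3) (ΛY₃ x) ∔ ΛZ₀
  ΛZ₂ : Λ Z₂
  ΛZ₂ = Λ-scale (+ 9) (ΛY₃ x) ∔ Λ-scale (+ 3) ΛZ₀ ∔ Λ-scale (+ 9) (t· ΛW)
  V₀ : U (t · X) ≈ Z₀
  V₀ = begin
    U (t · X)
      ≈⟨ ≈-trans (U-cong (solve 2 (λ s x → con (+ 9) :* s :^ 4 :* x
             := con (+ 9) :* (s :^ 3 :* (s :* x))) ≈-refl s X)) (U-scale (+ 9) _) ⟩
    ⟨ + 9 ⟩ · U (s ↑ 3 · (s · X))
      ≈⟨ R.*-congˡ (U-s³· (s · X)) ⟩
    ⟨ + 9 ⟩ · (s · U (s · X) ⊕ ⟨ + 3 ⟩ · (s ↑ 2 · U (s · (s · X))) ⊕ ⟨ + 3 ⟩ · (s ↑ 3 · U (⟨ + 3 ⟩ · (s ↑ 2 · (s · X)))))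
      ≈⟨ solve 4 (λ s a b c → con (+ 9) :* (s :* a :+ con (+ 3) :* (s :^ 2 :* b) :+ con (+ 3) :* (s :^ 3 :* c))
           := con (+ 9) :* (s :* a :+ s :^ 2 :* (con (+ 3) :* b) :+ con (+ 3) :* (s :^ 3 :* c))) ≈-refl s _ _ _ ⟩
    ⟨ + 9 ⟩ · (s · U (s · X) ⊕ s ↑ 2 · (⟨ + 3 ⟩ · U (s · (s · X))) ⊕ ⟨ + 3 ⟩ · (s ↑ 3 · U (⟨ + 3 ⟩ · (s ↑ 2 · (s · X)))))
      ≈⟨ R.*-congˡ (R.+-cong (R.+-cong (R.*-congˡ (U₁ x)) (R.*-congˡ ssX)) (R.*-congˡ (R.*-congˡ s³X))) ⟩
    ⟨ + 9 ⟩ · (s · (⟨ + 3 ⟩ · (s ↑ 3 · y₁)) ⊕ s ↑ 2 · (⟨ + 3 ⟩ · (s ↑ 2 · Y₂ x)) ⊕ ⟨ + 3 ⟩ · (s ↑ 3 · (⟨ + 3 ⟩ · (s · Y₃ x))))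
      ≈⟨ solve 4 (λ s a b c → con (+ 9) :* (s :* (con (+ 3) :* (s :^ 3 :* a)) :+ s :^ 2 :* (con (+ 3) :* (s :^ 2 :* b)) :+ con (+ 3) :* (s :^ 3 :* (con (+ 3) :* (s :* c))))
           := con (+ 9) :* s :^ 4 :* (con (+ 3) :* a :+ con (+ 3) :* b :+ con (+ 9) :* c)) ≈-refl s y₁ (Y₂ x) (Y₃ x) ⟩
    Z₀ ∎
    where
    ssX : ⟨ + 3 ⟩ · U (s · (s · X)) ≈ ⟨ + 3 ⟩ · (s ↑ 2 · Y₂ x)
    ssX = ≈-trans (≈-sym (U-scale (+ 3) _)) (≈-trans
      (U-cong (solve 2 (λ s x → con (+ 3) :* (s :* (s :* x)) := con (+ 3) :* (s :^ 2 :* x)) ≈-refl s X)) (U₂ x))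
    s³X : U (⟨ + 3 ⟩ · (s ↑ 2 · (s · X))) ≈ ⟨ + 3 ⟩ · (s · Y₃ x)
    s³X = ≈-trans (U-scale (+ 3) _) (R.*-congˡ (≈-trans
      (U-cong (solve 2 (λ s x → s :^ 2 :* (s :* x) := s :^ 3 :* x) ≈-refl s X)) (U₃ x)))
  V₁ : U (s · (t · X)) ≈ ⟨ + 3 ⟩ · (s ↑ 3 · (⟨ 0ℤ ⟩ ⊕ ⟨ + 3 ⟩ · W))
  V₁ = begin
    U (s · (t · X))
      ≈⟨ ≈-trans (U-cong (solve 2 (λ s x → s :* (con (+ 9) :* s :^ 4 :* x)
             := con (+ 3) :* (s :^ 3 :* (con (+ 3) :* (s :^ 2 :* x)))) ≈-refl s X)) (U-scale (+ 3) _) ⟩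
    ⟨ + 3 ⟩ · U (s ↑ 3 · (⟨ + 3 ⟩ · (s ↑ 2 · X)))
      ≈⟨ R.*-congˡ (U-s³· _) ⟩
    ⟨ + 3 ⟩ · (s · U (⟨ + 3 ⟩ · (s ↑ 2 · X)) ⊕ ⟨ + 3 ⟩ · (s ↑ 2 · U (s · (⟨ + 3 ⟩ · (s ↑ 2 · X))))
      ⊕ ⟨ + 3 ⟩ · (s ↑ 3 · U (⟨ + 3 ⟩ · (s ↑ 2 · (⟨ + 3 ⟩ · (s ↑ 2 · X))))))
      ≈⟨ R.*-congˡ (R.+-cong (R.+-cong (R.*-congˡ (U₂ x)) (R.*-congˡ (R.*-congˡ s³X))) (R.*-congˡ (R.*-congˡ tX))) ⟩
    ⟨ + 3 ⟩ · (s · (⟨ + 3 ⟩ · (s ↑ 2 · Y₂ x)) ⊕ ⟨ + 3 ⟩ · (s ↑ 2 · (⟨ + 3 ⟩ · (s · Y₃ x))) ⊕ ⟨ + 3 ⟩ · (s ↑ 3 · Z₀))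
      ≈⟨ solve 4 (λ s b c z → con (+ 3) :* (s :* (con (+ 3) :* (s :^ 2 :* b)) :+ con (+ 3) :* (s :^ 2 :* (con (+ 3) :* (s :* c))) :+ con (+ 3) :* (s :^ 3 :* z))
           := con (+ 3) :* (s :^ 3 :* (con 0ℤ :+ con (+ 3) :* (b :+ con (+ 3) :* c :+ z)))) ≈-refl s (Y₂ x) (Y₃ x) Z₀ ⟩
    ⟨ + 3 ⟩ · (s ↑ 3 · (⟨ 0ℤ ⟩ ⊕ ⟨ + 3 ⟩ · W)) ∎
    where
    s³X : U (s · (⟨ + 3 ⟩ · (s ↑ 2 · X))) ≈ ⟨ + 3 ⟩ · (s · Y₃ x)
    s³X = ≈-trans (U-cong (solve 2 (λ s x → s :* (con (+ 3) :* (s :^ 2 :* x)) := con (+ 3) :* (s :^ 3 :* x)) ≈-refl s X))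
      (≈-trans (U-scale (+ 3) _) (R.*-congˡ (U₃ x)))
    tX : U (⟨ + 3 ⟩ · (s ↑ 2 · (⟨ + 3 ⟩ · (s ↑ 2 · X)))) ≈ Z₀
    tX = ≈-trans (U-cong (solve 2 (λ s x → con (+ 3) :* (s :^ 2 :* (con (+ 3) :* (s :^ 2 :* x)))
           := con (+ 9) :* s :^ 4 :* x) ≈-refl s X)) V₀
  V₂ : U (⟨ + 3 ⟩ · (s ↑ 2 · (t · X))) ≈ ⟨ + 3 ⟩ · (s ↑ 2 · Z₂)
  V₂ = begin
    U (⟨ + 3 ⟩ · (s ↑ 2 · (t · X)))
      ≈⟨ ≈-trans (U-cong (solve 2 (λ s x → con (+ 3) :* (s :^ 2 :* (con (+ 9) :* s :^ 4 :* x))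
             := con (+ 27) :* (s :^ 3 :* (s :^ 3 :* x))) ≈-refl s X)) (U-scale (+ 27) _) ⟩
    ⟨ + 27 ⟩ · U (s ↑ 3 · (s ↑ 3 · X))
      ≈⟨ R.*-congˡ (U-s³· _) ⟩
    ⟨ + 27 ⟩ · (s · U (s ↑ 3 · X) ⊕ ⟨ + 3 ⟩ · (s ↑ 2 · U (s · (s ↑ 3 · X))) ⊕ ⟨ + 3 ⟩ · (s ↑ 3 · U (⟨ + 3 ⟩ · (s ↑ 2 · (s ↑ 3 · X)))))
      ≈⟨ solve 4 (λ s a b c → con (+ 27) :* (s :* a :+ con (+ 3) :* (s :^ 2 :* b) :+ con (+ 3) :* (s :^ 3 :* c))
           := con (+ 27) :* (s :* a) :+ con (+ 9) :* (s :^ 2 :* (con (+ 9) :* b)) :+ con (+ 27) :* (s :^ 3 :* (con (+ 3) :* c))) ≈-refl s _ _ _ ⟩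
    ⟨ + 27 ⟩ · (s · U (s ↑ 3 · X)) ⊕ ⟨ + 9 ⟩ · (s ↑ 2 · (⟨ + 9 ⟩ · U (s · (s ↑ 3 · X)))) ⊕ ⟨ + 27 ⟩ · (s ↑ 3 · (⟨ + 3 ⟩ · U (⟨ + 3 ⟩ · (s ↑ 2 · (s ↑ 3 · X)))))
      ≈⟨ R.+-cong (R.+-cong (R.*-congˡ (R.*-congˡ (U₃ x))) (R.*-congˡ (R.*-congˡ tX))) (R.*-congˡ (R.*-congˡ stX)) ⟩
    ⟨ + 27 ⟩ · (s · (s · Y₃ x)) ⊕ ⟨ + 9 ⟩ · (s ↑ 2 · Z₀) ⊕ ⟨ + 27 ⟩ · (s ↑ 3 · (⟨ + 3 ⟩ · (s ↑ 3 · (⟨ 0ℤ ⟩ ⊕ ⟨ + 3 ⟩ · W))))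
      ≈⟨ solve 4 (λ s c z w → con (+ 27) :* (s :* (s :* c)) :+ con (+ 9) :* (s :^ 2 :* z) :+ con (+ 27) :* (s :^ 3 :* (con (+ 3) :* (s :^ 3 :* (con 0ℤ :+ con (+ 3) :* w))))
           := con (+ 3) :* (s :^ 2 :* (con (+ 9) :* c :+ con (+ 3) :* z :+ con (+ 9) :* (con (+ 9) :* s :^ 4 :* w)))) ≈-refl s (Y₃ x) Z₀ W ⟩
    ⟨ + 3 ⟩ · (s ↑ 2 · Z₂) ∎
    where
    tX : ⟨ + 9 ⟩ · U (s · (s ↑ 3 · X)) ≈ Z₀
    tX = ≈-trans (≈-sym (U-scale (+ 9) _)) (≈-trans
      (U-cong (solve 2 (λ s x → con (+ 9) :* (s :* (s :^ 3 :* x)) := con (+ 9) :* s :^ 4 :* x) ≈-refl s X)) V₀)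
    stX : ⟨ + 3 ⟩ · U (⟨ + 3 ⟩ · (s ↑ 2 · (s ↑ 3 · X))) ≈ ⟨ + 3 ⟩ · (s ↑ 3 · (⟨ 0ℤ ⟩ ⊕ ⟨ + 3 ⟩ · W))
    stX = ≈-trans (≈-sym (U-scale (+ 3) _)) (≈-trans
      (U-cong (solve 2 (λ s x → con (+ 3) :* (con (+ 3) :* (s :^ 2 :* (s :^ 3 :* x)))
             := s :* (con (+ 9) :* s :^ 4 :* x)) ≈-refl s X)) V₁)

uImage : ∀ {X} → Λ X → UImage X
uImage (scalar c) = uImage-scalar c
uImage (x ∔ y)    = uImage-⊕ (uImage x) (uImage y)
uImage (t· x)     = uImage-t· x (uImage x)
uImage (resp p x) = uImage-resp p (uImage x)

-- Iterating U on s

U^ : ℕ → PowerSeries → PowerSeries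
U^ zero    X = X
U^ (suc k) X = U (U^ k X)

U^-coeff : ∀ k X n → U^ k X n ≡ X (n * 3 ^ k)
U^-coeff zero    X n = cong X (sym (ℕ.*-identityʳ n))
U^-coeff (suc k) X n = trans (U^-coeff k X (n * 3)) (cong X (ℕ.*-assoc n 3 (3 ^ k)))

private
  *2-suc : ∀ α → 2 * suc α ≡ 2 + 2 * α
  *2-suc = ℕ-Tactic.solve-∀

mutual
  U^-even : ∀ α → ∃[ X ] Λ X × U^ (2 * α) s ≈ ⟨ + (3 ^ α) ⟩ · (s · X)
  U^-even zero    = ⟨ 1ℤ ⟩ , scalar 1ℤ , solve 1 (λ s → s := con 1ℤ :* (s :* con 1ℤ)) ≈-refl s
  U^-even (suc α) = let c , Y , ΛY , eq = U^-odd α in even-step α c ΛY eq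

  U^-odd : ∀ α → ∃[ c ] ∃[ Y ] Λ Y × U^ (1 + 2 * α) s ≈ ⟨ + (3 ^ suc α) ⟩ · (s ↑ 3 · (⟨ c ⟩ ⊕ ⟨ + 3 ⟩ · Y))
  U^-odd α = let X , ΛX , eq = U^-even α in odd-step α ΛX eq

  even-step : ∀ α c {Y} → Λ Y → U^ (1 + 2 * α) s ≈ ⟨ + (3 ^ suc α) ⟩ · (s ↑ 3 · (⟨ c ⟩ ⊕ ⟨ + 3 ⟩ · Y)) →
              ∃[ X ] Λ X × U^ (2 * suc α) s ≈ ⟨ + (3 ^ suc α) ⟩ · (s · X)
  even-step α c {Y} ΛY eq = Y₃ y , ΛY₃ y , (begin
    U^ (2 * suc α) s                                              ≈⟨ R.reflexive (cong (λ k → U^ k s) (*2-suc α)) ⟩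
    U (U^ (1 + 2 * α) s)                                          ≈⟨ U-cong eq ⟩
    U (⟨ + (3 ^ suc α) ⟩ · (s ↑ 3 · (⟨ c ⟩ ⊕ ⟨ + 3 ⟩ · Y)))       ≈⟨ U-scale (+ (3 ^ suc α)) (s ↑ 3 · (⟨ c ⟩ ⊕ ⟨ + 3 ⟩ · Y)) ⟩
    ⟨ + (3 ^ suc α) ⟩ · U (s ↑ 3 · (⟨ c ⟩ ⊕ ⟨ + 3 ⟩ · Y))         ≈⟨ R.*-congˡ (U₃ y) ⟩
    ⟨ + (3 ^ suc α) ⟩ · (s · Y₃ y)                                ∎)
    where
    open ≈-Reasoning
    y : UImage (⟨ c ⟩ ⊕ ⟨ + 3 ⟩ · Y)
    -- For the recursion c + 3Y is just an element of ℤ[t]; its special shape matters only for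
    -- `U^-odd-∣′`.
    y = uImage (scalar c ∔ Λ-scale (+ 3) ΛY)

  odd-step : ∀ α {X} → Λ X → U^ (2 * α) s ≈ ⟨ + (3 ^ α) ⟩ · (s · X) →
             ∃[ c ] ∃[ Y ] Λ Y × U^ (1 + 2 * α) s ≈ ⟨ + (3 ^ suc α) ⟩ · (s ↑ 3 · (⟨ c ⟩ ⊕ ⟨ + 3 ⟩ · Y))
  odd-step α {X} ΛX eq = c₁ x , Y₁ x , ΛY₁ x , (begin
    U (U^ (2 * α) s)                    ≈⟨ U-cong eq ⟩
    U (⟨ + (3 ^ α) ⟩ · (s · X))         ≈⟨ U-scale (+ (3 ^ α)) (s · X) ⟩
    ⟨ + (3 ^ α) ⟩ · U (s · X)           ≈⟨ R.*-congˡ (U₁ x) ⟩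
    ⟨ + (3 ^ α) ⟩ · (⟨ + 3 ⟩ · V)       ≈⟨ solve 2 (λ a v → a :* (con (+ 3) :* v)
           := con (+ 3) :* a :* v) ≈-refl ⟨ + (3 ^ α) ⟩ V ⟩
    ⟨ + 3 ⟩ · ⟨ + (3 ^ α) ⟩ · V         ≈⟨ R.*-congʳ (⟨⟩-* (+ 3) (+ (3 ^ α))) ⟨
    ⟨ + 3 ℤ.* + (3 ^ α) ⟩ · V           ≈⟨ R.*-congʳ (R.reflexive (cong ⟨_⟩ (sym (ℤ.pos-* 3 (3 ^ α))))) ⟩
    ⟨ + (3 ^ suc α) ⟩ · V               ∎)
    where
    open ≈-Reasoning
    x : UImage X
    x = uImage ΛX
    V : PowerSeries
    V = s ↑ 3 · (⟨ c₁ x ⟩ ⊕ ⟨ + 3 ⟩ · Y₁ x)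

-- Divisibility of coefficients

∣-multiple : ∀ {x} k y → x ≡ + k ℤ.* y → + k ∣ x
∣-multiple k y x≡ky = ℕ.divides ℤ.∣ y ∣ (trans (cong ℤ.∣_∣ x≡ky) (trans (ℤ.abs-* (+ k) y) (ℕ.*-comm k ℤ.∣ y ∣)))

≈⟨⟩·⇒∣ : ∀ {X Y} k n → X ≈ ⟨ + k ⟩ · Y → + k ∣ X n
≈⟨⟩·⇒∣ {X} {Y} k n eq = ∣-multiple k (Y n) (trans (coeff eq n) (⟨⟩·-coeff (+ k) Y n))

U^-even-∣ : ∀ α n → + (3 ^ α) ∣ U^ (2 * α) s n
U^-even-∣ α n = ≈⟨⟩·⇒∣ (3 ^ α) n (proj₂ (proj₂ (U^-even α)))

U^-odd-∣ : ∀ α n → + (3 ^ (α + 1)) ∣ U^ (1 + 2 * α) s n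
U^-odd-∣ α n = subst (λ k → + (3 ^ k) ∣ U^ (1 + 2 * α) s n) (ℕ.+-comm 1 α)
  (≈⟨⟩·⇒∣ (3 ^ suc α) n (proj₂ (proj₂ (proj₂ (U^-odd α)))))

-- s³ ≡ s(q³) modulo 3, so only exponents divisible by 3 survive modulo 3 in
-- s³ (c + 3Y).
s³-∣ : ∀ {X} k c Y n → X ≈ ⟨ + k ⟩ · (s ↑ 3 · (⟨ c ⟩ ⊕ ⟨ + 3 ⟩ · Y)) → S n ≡ 0ℤ → + (3 * k) ∣ X n
s³-∣ {X} k c Y n eq Sₙ≡0 = ∣-multiple (3 * k) (D n) (begin
  X n
    ≡⟨ trans (coeff eq n) (⟨⟩·-coeff (+ k) (s ↑ 3 · (⟨ c ⟩ ⊕ ⟨ + 3 ⟩ · Y)) n) ⟩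
  + k ℤ.* (s ↑ 3 · (⟨ c ⟩ ⊕ ⟨ + 3 ⟩ · Y)) n
    ≡⟨ cong (ℤ._*_ (+ k)) (coeff cube n) ⟩
  + k ℤ.* (⟨ c ⟩ · S ⊕ ⟨ + 3 ⟩ · D) n
    ≡⟨ cong (ℤ._*_ (+ k)) (⊕-coeff (⟨ c ⟩ · S) (⟨ + 3 ⟩ · D) n) ⟩
  + k ℤ.* ((⟨ c ⟩ · S) n ℤ.+ (⟨ + 3 ⟩ · D) n)
    ≡⟨ cong (ℤ._*_ (+ k)) (cong₂ ℤ._+_ (trans (⟨⟩·-coeff c S n) (cong (ℤ._*_ c) Sₙ≡0)) (⟨⟩·-coeff (+ 3) D n)) ⟩
  + k ℤ.* (c ℤ.* 0ℤ ℤ.+ + 3 ℤ.* D n)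
    ≡⟨ rearrange (+ k) c (D n) ⟩
  + 3 ℤ.* + k ℤ.* D n
    ≡⟨ cong (ℤ._* D n) (ℤ.pos-* 3 k) ⟨
  + (3 * k) ℤ.* D n ∎)
  where
  open ≡-Reasoning
  D : PowerSeries
  D = ⟨ c ⟩ · (S ↑ 2 · s ⊕ ⟨ + 3 ⟩ · (S ↑ 3 · s ↑ 2)) ⊕ s ↑ 3 · Y
  cube : s ↑ 3 · (⟨ c ⟩ ⊕ ⟨ + 3 ⟩ · Y) ≈ ⟨ c ⟩ · S ⊕ ⟨ + 3 ⟩ · D
  cube = ≈-trans (R.distribˡ (s ↑ 3) ⟨ c ⟩ (⟨ + 3 ⟩ · Y)) (≈-trans (R.+-congʳ (R.*-congʳ s³))
    (solve 4 (λ S s c y → (S :+ con (+ 3) :* (S :^ 2 :* s) :+ con (+ 9) :* (S :^ 3 :* s :^ 2)) :* c :+ s :^ 3 :* (con (+ 3) :* y)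
       := c :* S :+ con (+ 3) :* (c :* (S :^ 2 :* s :+ con (+ 3) :* (S :^ 3 :* s :^ 2)) :+ s :^ 3 :* y)) ≈-refl S s ⟨ c ⟩ Y))
  rearrange : ∀ a c d → a ℤ.* (c ℤ.* 0ℤ ℤ.+ + 3 ℤ.* d) ≡ + 3 ℤ.* a ℤ.* d
  rearrange = ℤ-Tactic.solve-∀

U^-odd-∣′ : ∀ α n → S n ≡ 0ℤ → + (3 ^ (α + 2)) ∣ U^ (1 + 2 * α) s n
U^-odd-∣′ α n Sₙ≡0 = subst (λ k → + (3 ^ k) ∣ U^ (1 + 2 * α) s n) (ℕ.+-comm 2 α)
  (let c , Y , _ , eq = U^-odd α in s³-∣ (3 ^ suc α) c Y n eq Sₙ≡0)

-- From exponents of s to indices of a₃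

θ₃-1+ : ∀ X n → θ 3 X (1 + n * 3) ≡ 0ℤ
θ₃-1+ X zero    = refl
θ₃-1+ X (suc n) = θ₃-1+ (tail X) n

θ₃-2+ : ∀ X n → θ 3 X (2 + n * 3) ≡ 0ℤ
θ₃-2+ X zero    = refl
θ₃-2+ X (suc n) = θ₃-2+ (tail X) n

s-coeff : ∀ n → s (1 + n * 4) ≡ a₃ n
s-coeff n = trans (q^·-suc 0 A (n * 4)) (trans (coeff (q^0· A) (n * 4)) (θ₄-*4 a₃ n))
  where
  θ₄-*4 : ∀ X n → θ 4 X (n * 4) ≡ X n
  θ₄-*4 X zero    = refl
  θ₄-*4 X (suc n) = θ₄-*4 (tail X) n

∣-a₃ : ∀ d k m i → 1 + i * 4 ≡ m * 3 ^ k → + d ∣ U^ k s m → + d ∣ a₃ i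
∣-a₃ d k m i eq = subst (+ d ∣_) (begin
  U^ k s m        ≡⟨ U^-coeff k s m ⟩
  s (m * 3 ^ k)   ≡⟨ cong s eq ⟨
  s (1 + i * 4)   ≡⟨ s-coeff i ⟩
  a₃ i            ∎)
  where open ≡-Reasoning

-- An exact quotient d with 9^α = 1 + 4d, so that the truncated subtraction and the rounded division
-- of the theorem can be evaluated; the 2 comes from 9 = 1 + 4 · 2.
[9^α-1]/4 : ℕ → ℕ
[9^α-1]/4 zero    = 0
[9^α-1]/4 (suc α) = 2 + [9^α-1]/4 α * 9

9^α≡1+ : ∀ α → 3 ^ (2 * α) ≡ 1 + [9^α-1]/4 α * 4
9^α≡1+ zero    = refl
9^α≡1+ (suc α) = trans (cong (3 ^_) (*2-suc α)) (trans (cong (λ z → 3 * (3 * z)) (9^α≡1+ α)) (lemma ([9^α-1]/4 α)))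
  where
  lemma : ∀ d → 3 * (3 * (1 + d * 4)) ≡ 1 + (2 + d * 9) * 4
  lemma = ℕ-Tactic.solve-∀

4e+1≡ : ∀ {x} N d → x ≡ 1 + d * 4 → 1 + (N + (x ∸ 1) / 4) * 4 ≡ N * 4 + x
4e+1≡ N d refl = trans (cong (λ e → 1 + (N + e) * 4) (ℕ.m*n/n≡m d 4)) (lemma N d)
  where
  lemma : ∀ N d → 1 + (N + d) * 4 ≡ N * 4 + (1 + d * 4)
  lemma = ℕ-Tactic.solve-∀

-- The index i of `a₃` belongs to the exponent 4i + 1 of `s`. The constant in i makes this exponent
-- a multiple of 3^(2α), and the cofactor is the index at which the iterate of `U` is read.
index₁ : ∀ α n → 1 + (3 ^ (2 * α) * n + (3 ^ (2 * α) ∸ 1) / 4) * 4 ≡ (1 + n * 4) * 3 ^ (2 * α)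
index₁ α n = trans (4e+1≡ (3 ^ (2 * α) * n) ([9^α-1]/4 α) (9^α≡1+ α)) (lemma (3 ^ (2 * α)) n)
  where
  lemma : ∀ P n → P * n * 4 + P ≡ (1 + n * 4) * P
  lemma = ℕ-Tactic.solve-∀

index₂ : ∀ α n → 1 + (3 ^ (2 * α + 1) * n + (3 ^ (2 * α + 2) ∸ 1) / 4) * 4 ≡ (3 + n * 4) * 3 ^ (1 + 2 * α)
index₂ α n rewrite ℕ.+-comm (2 * α) 1 | ℕ.+-comm (2 * α) 2 = trans (4e+1≡ (3 ^ (1 + 2 * α) * n) (2 + [9^α-1]/4 α * 9)
    (trans (cong (λ P → 3 * (3 * P)) (9^α≡1+ α)) (≡1+ ([9^α-1]/4 α)))) (lemma (3 ^ (1 + 2 * α)) n)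
  where
  ≡1+ : ∀ d → 3 * (3 * (1 + d * 4)) ≡ 1 + (2 + d * 9) * 4
  ≡1+ = ℕ-Tactic.solve-∀
  lemma : ∀ P n → P * n * 4 + 3 * P ≡ (3 + n * 4) * P
  lemma = ℕ-Tactic.solve-∀

-- The cofactor 7 + 12n is written as 1 + 3(2 + 4n) to display its residue modulo 3, as `θ₃-1+`
-- requires; likewise 11 + 12n = 2 + 3(3 + 4n) in `index₄`.
index₃ : ∀ α n → 1 + (3 ^ (2 * α + 2) * n + (7 * 3 ^ (2 * α + 1) ∸ 1) / 4) * 4 ≡ (1 + (2 + n * 4) * 3) * 3 ^ (1 + 2 * α)
index₃ α n rewrite ℕ.+-comm (2 * α) 1 | ℕ.+-comm (2 * α) 2 = trans (4e+1≡ (3 ^ (2 + 2 * α) * n) (5 + [9^α-1]/4 α * 21)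
    (trans (cong (λ P → 7 * (3 * P)) (9^α≡1+ α)) (≡1+ ([9^α-1]/4 α)))) (lemma (3 ^ (1 + 2 * α)) n)
  where
  ≡1+ : ∀ d → 7 * (3 * (1 + d * 4)) ≡ 1 + (5 + d * 21) * 4
  ≡1+ = ℕ-Tactic.solve-∀
  lemma : ∀ P n → 3 * P * n * 4 + 7 * P ≡ (1 + (2 + n * 4) * 3) * P
  lemma = ℕ-Tactic.solve-∀

index₄ : ∀ α n → 1 + (3 ^ (2 * α + 2) * n + (11 * 3 ^ (2 * α + 1) ∸ 1) / 4) * 4 ≡ (2 + (3 + n * 4) * 3) * 3 ^ (1 + 2 * α)
index₄ α n rewrite ℕ.+-comm (2 * α) 1 | ℕ.+-comm (2 * α) 2 = trans (4e+1≡ (3 ^ (2 + 2 * α) * n) (8 + [9^α-1]/4 α * 33)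
    (trans (cong (λ P → 11 * (3 * P)) (9^α≡1+ α)) (≡1+ ([9^α-1]/4 α)))) (lemma (3 ^ (1 + 2 * α)) n)
  where
  ≡1+ : ∀ d → 11 * (3 * (1 + d * 4)) ≡ 1 + (8 + d * 33) * 4
  ≡1+ = ℕ-Tactic.solve-∀
  lemma : ∀ P n → 3 * P * n * 4 + 11 * P ≡ (2 + (3 + n * 4) * 3) * P
  lemma = ℕ-Tactic.solve-∀

theorem1p1 : (α n : ℕ) →
    (+ (3 ^ α)       ∣ a₃ (3 ^ (2 * α) * n + (3 ^ (2 * α) ∸ 1) / 4))
    × (+ (3 ^ (α + 1)) ∣ a₃ (3 ^ (2 * α + 1) * n + (3 ^ (2 * α + 2) ∸ 1) / 4))
    × (+ (3 ^ (α + 2)) ∣ a₃ (3 ^ (2 * α + 2) * n + (7 * 3 ^ (2 * α + 1) ∸ 1) / 4))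
    × (+ (3 ^ (α + 2)) ∣ a₃ (3 ^ (2 * α + 2) * n + (11 * 3 ^ (2 * α + 1) ∸ 1) / 4))
theorem1p1 α n
  = ∣-a₃ (3 ^ α) (2 * α) (1 + n * 4) (3 ^ (2 * α) * n + (3 ^ (2 * α) ∸ 1) / 4) (index₁ α n)
      (U^-even-∣ α (1 + n * 4))
  , ∣-a₃ (3 ^ (α + 1)) (1 + 2 * α) (3 + n * 4) (3 ^ (2 * α + 1) * n + (3 ^ (2 * α + 2) ∸ 1) / 4) (index₂ α n)
      (U^-odd-∣ α (3 + n * 4))
  -- 7 + 12n and, in the last component, 11 + 12n are prime to 3, so the coefficient of `S`, a
  -- series in q³, vanishes there.
  , ∣-a₃ (3 ^ (α + 2)) (1 + 2 * α) (1 + (2 + n * 4) * 3) (3 ^ (2 * α + 2) * n + (7 * 3 ^ (2 * α + 1) ∸ 1) / 4) (index₃ α n)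
      (U^-odd-∣′ α (1 + (2 + n * 4) * 3) (θ₃-1+ s (2 + n * 4)))
  , ∣-a₃ (3 ^ (α + 2)) (1 + 2 * α) (2 + (3 + n * 4) * 3) (3 ^ (2 * α + 2) * n + (11 * 3 ^ (2 * α + 1) ∸ 1) / 4) (index₄ α n)
      (U^-odd-∣′ α (2 + (3 + n * 4) * 3) (θ₃-2+ s (3 + n * 4)))
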